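{- Let $G=(V,F)$ be a $12$-connected graph on $n$ vertices and let $S\subseteq F$ with $|S|\le 6$. Then $G-S$ is $C_2^1$-rigid, i.e. $F\setminus S$ spans the generic $C_2^1$-cofactor matroid $\mathcal{C}^1_{2,n}$ on $E(K_n)$, where $V$ is identified with $V(K_n)$.
   Context: A graph is $k$-connected if it has at least $k+1$ vertices and remains connected after deleting any fewer than $k$ vertices. Vertices of $K_n$ are $v_1,\dots,v_n$. Choose $p(v_i)=(x_i,y_i)\in\mathbb{R}^2$ with algebraically independent coordinates over $\mathbb{Q}$. $\mathcal{C}^1_{2,n}$ is the row matroid of the $|E(K_n)|\times 3n$ matrix with three columns per vertex. The row of edge $v_iv_j$ with $i<j$ has $D_{ij}=((x_i-x_j)^2,(x_i-x_j)(y_i-y_j),(y_i-y_j)^2)$ in the columns of $v_i$, $-D_{ij}$ in the columns of $v_j$, and zeros elsewhere. A set spans the matroid if its closure is $E(K_n)$. -}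

module Defs where

open import Algebra.Bundles.Raw using (RawMonoid)
import Algebra.Definitions.RawMonoid as RawMonoidDefinitions
open import Data.Fin using (Fin; zero; suc)
import Data.Fin as Fin
import Data.Fin.Properties as Fin
open import Data.Fin.Subset using (Subset; _∈_; _∉_; _⊆_; _∪_; ⁅_⁆; ∣_∣)
open import Data.List using (List; []; _∷_; allFin; cartesianProduct; filter; foldr; length; lookup)
open import Data.List.Relation.Unary.Any using (Any)
open import Data.Nat using (ℕ; zero; suc)
import Data.Nat as ℕ
import Data.Nat.Properties as ℕ
open import Data.Product using (_×_; _,_; ∃; ∃-syntax; proj₁; proj₂)
open import Data.Rational using (ℚ; 0ℚ; 1ℚ; ½)
import Data.Rational as ℚ
import Data.Rational.Properties as ℚ
open import Data.Rational.Solver using (module +-*-Solver)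
open import Data.Sum using (_⊎_)
open import Data.Vec using (Vec; []; _∷_; _++_; tabulate)
open import Relation.Binary.Construct.Closure.ReflexiveTransitive using (Star)
open import Relation.Binary.PropositionalEquality
  using (_≡_; _≢_; refl; sym; trans; cong; cong₂; subst)
open import Relation.Nullary using (yes; no)

-- Reals are Cauchy sequences of rationals; equality of reals is _≈_ below.
IsCauchy : (ℕ → ℚ) → Set
IsCauchy s = ∀ ε → 0ℚ ℚ.< ε →
  ∃[ N ] (∀ m n → N ℕ.≤ m → N ℕ.≤ n → ℚ.∣ s m ℚ.- s n ∣ ℚ.< ε)

record ℝ : Set where
  constructor mkℝ
  field
    seq    : ℕ → ℚ
    cauchy : IsCauchy seq

open ℝ public

infix 4 _≈_ _#_

_≈_ : ℝ → ℝ → Set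
x ≈ y = ∀ ε → 0ℚ ℚ.< ε →
  ∃[ N ] (∀ n → N ℕ.≤ n → ℚ.∣ seq x n ℚ.- seq y n ∣ ℚ.< ε)

-- Apartness, the positive form of "x ≠ y".  Classically it is the negation
-- of _≈_; constructively it is what makes x - y invertible.
_#_ : ℝ → ℝ → Set
x # y = ∃[ ε ] (0ℚ ℚ.< ε ×
  ∃[ N ] (∀ n → N ℕ.≤ n → ε ℚ.≤ ℚ.∣ seq x n ℚ.- seq y n ∣))

private

  ½-pos : ∀ ε → 0ℚ ℚ.< ε → 0ℚ ℚ.< ½ ℚ.* ε
  ½-pos ε 0<ε =
    subst (ℚ._< ½ ℚ.* ε) (ℚ.*-zeroʳ ½) (ℚ.*-monoʳ-<-pos ½ 0<ε)

  ½+½ : ∀ ε → ½ ℚ.* ε ℚ.+ ½ ℚ.* ε ≡ ε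
  ½+½ ε = trans (sym (ℚ.*-distribʳ-+ ε ½ ½)) (ℚ.*-identityˡ ε)

  const-cauchy : ∀ q → IsCauchy (λ _ → q)
  const-cauchy q ε 0<ε = 0 , λ _ _ _ _ →
    subst (λ d → ℚ.∣ d ∣ ℚ.< ε) (sym (ℚ.+-inverseʳ q)) 0<ε

  neg-cauchy : ∀ {s} → IsCauchy s → IsCauchy (λ n → ℚ.- s n)
  neg-cauchy {s} cs ε 0<ε with cs ε 0<ε
  ... | N , close = N , λ m n N≤m N≤n →
    subst (ℚ._< ε)
      (trans (sym (ℚ.∣-p∣≡∣p∣ (s m ℚ.- s n)))
             (cong ℚ.∣_∣ (ℚ.neg-distrib-+ (s m) (ℚ.- s n))))
      (close m n N≤m N≤n)

  +-cauchy : ∀ {s t} → IsCauchy s → IsCauchy t → IsCauchy (λ n → s n ℚ.+ t n)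
  +-cauchy {s} {t} cs ct ε 0<ε
    with cs (½ ℚ.* ε) (½-pos ε 0<ε) | ct (½ ℚ.* ε) (½-pos ε 0<ε)
  ... | M , closeₛ | N , closeₜ = M ℕ.⊔ N , λ m n ≤m ≤n →
    let open ℚ.≤-Reasoning in begin-strict
      ℚ.∣ (s m ℚ.+ t m) ℚ.- (s n ℚ.+ t n) ∣
        ≡⟨ cong ℚ.∣_∣ (rearrange (s m) (t m) (s n) (t n)) ⟩
      ℚ.∣ (s m ℚ.- s n) ℚ.+ (t m ℚ.- t n) ∣
        ≤⟨ ℚ.∣p+q∣≤∣p∣+∣q∣ (s m ℚ.- s n) (t m ℚ.- t n) ⟩
      ℚ.∣ s m ℚ.- s n ∣ ℚ.+ ℚ.∣ t m ℚ.- t n ∣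
        <⟨ ℚ.+-mono-<
             (closeₛ m n (ℕ.m⊔n≤o⇒m≤o M N ≤m) (ℕ.m⊔n≤o⇒m≤o M N ≤n))
             (closeₜ m n (ℕ.m⊔n≤o⇒n≤o M N ≤m) (ℕ.m⊔n≤o⇒n≤o M N ≤n)) ⟩
      ½ ℚ.* ε ℚ.+ ½ ℚ.* ε
        ≡⟨ ½+½ ε ⟩
      ε ∎
    where
    rearrange : ∀ a b c d →
      (a ℚ.+ b) ℚ.- (c ℚ.+ d) ≡ (a ℚ.- c) ℚ.+ (b ℚ.- d)
    rearrange = solve 4
      (λ a b c d → (a :+ b) :- (c :+ d) := (a :- c) :+ (b :- d)) refl
      where open +-*-Solver

  eventually-bounded : ∀ {s} → IsCauchy s →
    ∃[ B ] (ℚ.Positive B × ∃[ N ] (∀ n → N ℕ.≤ n → ℚ.∣ s n ∣ ℚ.≤ B))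
  eventually-bounded {s} cs with cs 1ℚ (ℚ.positive⁻¹ 1ℚ)
  ... | N , close = 1ℚ ℚ.+ ℚ.∣ s N ∣
    , ℚ.pos+nonNeg⇒pos 1ℚ ℚ.∣ s N ∣ {{ℚ.nonNegative (ℚ.0≤∣p∣ (s N))}}
    , N , λ n N≤n → let open ℚ.≤-Reasoning in begin
      ℚ.∣ s n ∣
        ≡⟨ cong ℚ.∣_∣ (split (s n) (s N)) ⟩
      ℚ.∣ (s n ℚ.- s N) ℚ.+ s N ∣
        ≤⟨ ℚ.∣p+q∣≤∣p∣+∣q∣ (s n ℚ.- s N) (s N) ⟩
      ℚ.∣ s n ℚ.- s N ∣ ℚ.+ ℚ.∣ s N ∣
        ≤⟨ ℚ.+-monoˡ-≤ ℚ.∣ s N ∣ (ℚ.<⇒≤ (close n N N≤n ℕ.≤-refl)) ⟩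
      1ℚ ℚ.+ ℚ.∣ s N ∣ ∎
    where
    split : ∀ a b → a ≡ (a ℚ.- b) ℚ.+ b
    split = solve 2 (λ a b → a := (a :- b) :+ b) refl
      where open +-*-Solver

  scale : ∀ B → ℚ.Positive B → ∀ ε → 0ℚ ℚ.< ε →
    ∃[ δ ] (0ℚ ℚ.< δ × B ℚ.* δ ≡ ε)
  scale B B>0 ε 0<ε = B⁻¹ ℚ.* ε , δ>0 , eq
    where
    instance
      _ = B>0
      _ = ℚ.pos⇒nonZero B
      _ = ℚ.1/pos⇒pos B
    B⁻¹ = ℚ.1/ B
    δ>0 : 0ℚ ℚ.< B⁻¹ ℚ.* ε
    δ>0 = subst (ℚ._< B⁻¹ ℚ.* ε) (ℚ.*-zeroʳ B⁻¹) (ℚ.*-monoʳ-<-pos B⁻¹ 0<ε)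
    eq : B ℚ.* (B⁻¹ ℚ.* ε) ≡ ε
    eq = trans (sym (ℚ.*-assoc B B⁻¹ ε))
        (trans (cong (ℚ._* ε) (ℚ.*-inverseʳ B)) (ℚ.*-identityˡ ε))

  module _ {a b c d B C β γ : ℚ} (B>0 : ℚ.Positive B) (C>0 : ℚ.Positive C) where

    product-close : ℚ.∣ a ∣ ℚ.≤ B → ℚ.∣ d ∣ ℚ.≤ C →
      ℚ.∣ a ℚ.- c ∣ ℚ.< γ → ℚ.∣ b ℚ.- d ∣ ℚ.< β →
      ℚ.∣ a ℚ.* b ℚ.- c ℚ.* d ∣ ℚ.< B ℚ.* β ℚ.+ C ℚ.* γ
    product-close a≤B d≤C a-c<γ b-d<β = begin-strict
      ℚ.∣ a ℚ.* b ℚ.- c ℚ.* d ∣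
        ≡⟨ cong ℚ.∣_∣ rearrange ⟩
      ℚ.∣ a ℚ.* (b ℚ.- d) ℚ.+ d ℚ.* (a ℚ.- c) ∣
        ≤⟨ ℚ.∣p+q∣≤∣p∣+∣q∣ (a ℚ.* (b ℚ.- d)) (d ℚ.* (a ℚ.- c)) ⟩
      ℚ.∣ a ℚ.* (b ℚ.- d) ∣ ℚ.+ ℚ.∣ d ℚ.* (a ℚ.- c) ∣
        ≡⟨ cong₂ ℚ._+_ (ℚ.∣p*q∣≡∣p∣*∣q∣ a (b ℚ.- d)) (ℚ.∣p*q∣≡∣p∣*∣q∣ d (a ℚ.- c)) ⟩
      ℚ.∣ a ∣ ℚ.* ℚ.∣ b ℚ.- d ∣ ℚ.+ ℚ.∣ d ∣ ℚ.* ℚ.∣ a ℚ.- c ∣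
        ≤⟨ ℚ.+-mono-≤ (weaken (b ℚ.- d) a≤B) (weaken (a ℚ.- c) d≤C) ⟩
      B ℚ.* ℚ.∣ b ℚ.- d ∣ ℚ.+ C ℚ.* ℚ.∣ a ℚ.- c ∣
        <⟨ ℚ.+-mono-< (ℚ.*-monoʳ-<-pos B {{B>0}} b-d<β)
                      (ℚ.*-monoʳ-<-pos C {{C>0}} a-c<γ) ⟩
      B ℚ.* β ℚ.+ C ℚ.* γ ∎
      where
      open ℚ.≤-Reasoning
      weaken : ∀ x {y z} → y ℚ.≤ z → y ℚ.* ℚ.∣ x ∣ ℚ.≤ z ℚ.* ℚ.∣ x ∣
      weaken x = ℚ.*-monoʳ-≤-nonNeg ℚ.∣ x ∣ {{ℚ.nonNegative (ℚ.0≤∣p∣ x)}}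
      rearrange : a ℚ.* b ℚ.- c ℚ.* d ≡ a ℚ.* (b ℚ.- d) ℚ.+ d ℚ.* (a ℚ.- c)
      rearrange = solve 4
        (λ a b c d → a :* b :- c :* d := a :* (b :- d) :+ d :* (a :- c)) refl a b c d
        where open +-*-Solver

  *-cauchy : ∀ {s t} → IsCauchy s → IsCauchy t → IsCauchy (λ n → s n ℚ.* t n)
  *-cauchy {s} {t} cs ct ε 0<ε = combine (eventually-bounded {s} cs) (eventually-bounded {t} ct)
    where
    Bound : (ℕ → ℚ) → Set
    Bound s = ∃[ B ] (ℚ.Positive B × ∃[ N ] (∀ n → N ℕ.≤ n → ℚ.∣ s n ∣ ℚ.≤ B))
    Scaled : ℚ → Set
    Scaled B = ∃[ δ ] (0ℚ ℚ.< δ × B ℚ.* δ ≡ ½ ℚ.* ε)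
    combine′ : (Bs : Bound s) (Bt : Bound t) → Scaled (proj₁ Bs) → Scaled (proj₁ Bt) →
      ∃[ N ] (∀ m n → N ℕ.≤ m → N ℕ.≤ n → ℚ.∣ s m ℚ.* t m ℚ.- s n ℚ.* t n ∣ ℚ.< ε)
    combine′ (B , B>0 , M₁ , s≤B) (C , C>0 , M₂ , t≤C) (β , 0<β , Bβ≡) (γ , 0<γ , Cγ≡) =
      (M₁ ℕ.⊔ M₂) ℕ.⊔ (N₁ ℕ.⊔ N₂) , λ m n ≤m ≤n →
        subst (ℚ.∣ s m ℚ.* t m ℚ.- s n ℚ.* t n ∣ ℚ.<_)
          (trans (cong₂ ℚ._+_ Bβ≡ Cγ≡) (½+½ ε))
          (product-close {s m} {t m} {s n} {t n} B>0 C>0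
            (s≤B m (ℕ.m⊔n≤o⇒m≤o M₁ M₂ (left ≤m)))
            (t≤C n (ℕ.m⊔n≤o⇒n≤o M₁ M₂ (left ≤n)))
            (proj₂ (cs γ 0<γ) m n (ℕ.m⊔n≤o⇒m≤o N₁ N₂ (right ≤m)) (ℕ.m⊔n≤o⇒m≤o N₁ N₂ (right ≤n)))
            (proj₂ (ct β 0<β) m n (ℕ.m⊔n≤o⇒n≤o N₁ N₂ (right ≤m)) (ℕ.m⊔n≤o⇒n≤o N₁ N₂ (right ≤n))))
      where
      N₁ = proj₁ (cs γ 0<γ)
      N₂ = proj₁ (ct β 0<β)
      left : ∀ {k} → (M₁ ℕ.⊔ M₂) ℕ.⊔ (N₁ ℕ.⊔ N₂) ℕ.≤ k → M₁ ℕ.⊔ M₂ ℕ.≤ k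
      left = ℕ.m⊔n≤o⇒m≤o (M₁ ℕ.⊔ M₂) (N₁ ℕ.⊔ N₂)
      right : ∀ {k} → (M₁ ℕ.⊔ M₂) ℕ.⊔ (N₁ ℕ.⊔ N₂) ℕ.≤ k → N₁ ℕ.⊔ N₂ ℕ.≤ k
      right = ℕ.m⊔n≤o⇒n≤o (M₁ ℕ.⊔ M₂) (N₁ ℕ.⊔ N₂)
    combine : Bound s → Bound t →
      ∃[ N ] (∀ m n → N ℕ.≤ m → N ℕ.≤ n → ℚ.∣ s m ℚ.* t m ℚ.- s n ℚ.* t n ∣ ℚ.< ε)
    combine Bs@(B , B>0 , _) Bt@(C , C>0 , _) = combine′ Bs Bt
      (scale B B>0 (½ ℚ.* ε) (½-pos ε 0<ε))
      (scale C C>0 (½ ℚ.* ε) (½-pos ε 0<ε))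

infixl 6 _+_ _-_
infixl 7 _*_
infix  8 -_

fromℚ : ℚ → ℝ
fromℚ q = mkℝ (λ _ → q) (const-cauchy q)

0ℝ : ℝ
0ℝ = fromℚ 0ℚ

_+_ : ℝ → ℝ → ℝ
x + y = mkℝ (λ n → seq x n ℚ.+ seq y n) (+-cauchy {seq x} {seq y} (cauchy x) (cauchy y))

_*_ : ℝ → ℝ → ℝ
x * y = mkℝ (λ n → seq x n ℚ.* seq y n) (*-cauchy {seq x} {seq y} (cauchy x) (cauchy y))

-_ : ℝ → ℝ
- x = mkℝ (λ n → ℚ.- seq x n) (neg-cauchy {seq x} (cauchy x))

_-_ : ℝ → ℝ → ℝ
x - y = x + (- y)

+-0-rawMonoid : RawMonoid _ _
+-0-rawMonoid = record { Carrier = ℝ ; _≈_ = _≈_ ; _∙_ = _+_ ; ε = 0ℝ }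

open RawMonoidDefinitions +-0-rawMonoid using (sum) public

-- ℚ[X₁,…,Xₘ], as ℚ[X₂,…,Xₘ][X₁]: a list of coefficients, constant term
-- first.  Trailing zero coefficients are allowed.
Poly : ℕ → Set
Poly zero    = ℚ
Poly (suc m) = List (Poly m)

Nonzero : ∀ m → Poly m → Set
Nonzero zero    q = q ≢ 0ℚ
Nonzero (suc m) P = Any (Nonzero m) P

eval : ∀ {m} → Poly m → Vec ℝ m → ℝ
eval q []       = fromℚ q
eval P (x ∷ xs) = foldr (λ c r → eval c xs + x * r) 0ℝ P

AlgebraicallyIndependent : ∀ {m} → Vec ℝ m → Set
AlgebraicallyIndependent {m} xs = ∀ P → Nonzero m P → eval P xs # 0ℝ

-- A matroid on Fin m is presented by its independent sets.  Rank is a relation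
-- rather than a function because independence of real vectors is undecidable.
module _ {m : ℕ} (Indep : Subset m → Set) where

  HasRank : Subset m → ℕ → Set
  HasRank X r =
      (∃[ I ] (I ⊆ X × Indep I × ∣ I ∣ ≡ r))
    × (∀ I → I ⊆ X → Indep I → ∣ I ∣ ℕ.≤ r)

  _∈Closure_ : Fin m → Subset m → Set
  e ∈Closure X = ∃[ r ] (HasRank X r × HasRank (X ∪ ⁅ e ⁆) r)

  Spans : Subset m → Set
  Spans X = ∀ e → e ∈Closure X

-- The coefficient family is indexed by all rows and required to be supported
-- on I; columns are indexed by an arbitrary type.
RowIndependent : ∀ {m} {Col : Set} → (Fin m → Col → ℝ) → Subset m → Set
RowIndependent {m} A I = ∀ (c : Fin m → ℝ) →
  (∀ e → e ∉ I → c e ≈ 0ℝ) →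
  (∀ j → sum (λ e → c e * A e j) ≈ 0ℝ) →
  ∀ e → c e ≈ 0ℝ

-- V(Kₙ) = Fin n, and each edge vᵢvⱼ of Kₙ occurs once, as (i , j) with i < j.
edgesK : ∀ n → List (Fin n × Fin n)
edgesK n = filter (λ (i , j) → i Fin.<? j) (cartesianProduct (allFin n) (allFin n))

∣EK∣ : ℕ → ℕ
∣EK∣ n = length (edgesK n)

ends : ∀ n → Fin (∣EK∣ n) → Fin n × Fin n
ends n = lookup (edgesK n)

-- A graph with vertex set V(Kₙ) is given by its edge set F ⊆ E(Kₙ).
EdgeSet : ℕ → Set
EdgeSet n = Subset (∣EK∣ n)

Adjacent : ∀ n → EdgeSet n → Fin n → Fin n → Set
Adjacent n F u v = ∃[ e ] (e ∈ F × (ends n e ≡ (u , v) ⊎ ends n e ≡ (v , u)))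

-- The graph obtained from F by deleting the vertices in X is connected.
ConnectedWithout : ∀ n → EdgeSet n → Subset n → Set
ConnectedWithout n F X = ∀ u v → u ∉ X → v ∉ X →
  Star (λ a b → a ∉ X × b ∉ X × Adjacent n F a b) u v

Connected[_] : ℕ → ∀ n → EdgeSet n → Set
Connected[ k ] n F =
  suc k ℕ.≤ n × (∀ (X : Subset n) → ∣ X ∣ ℕ.< k → ConnectedWithout n F X)

Points : ℕ → Set
Points n = Fin n → ℝ × ℝ

Generic : ∀ {n} → Points n → Set
Generic p = AlgebraicallyIndependent
  (tabulate (λ i → proj₁ (p i)) ++ tabulate (λ i → proj₂ (p i)))

D : ℝ × ℝ → ℝ × ℝ → Fin 3 → ℝ
D (x , y) (x′ , y′) zero             = (x - x′) * (x - x′)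
D (x , y) (x′ , y′) (suc zero)       = (x - x′) * (y - y′)
D (x , y) (x′ , y′) (suc (suc zero)) = (y - y′) * (y - y′)

cofactorMatrix : ∀ {n} → Points n → Fin (∣EK∣ n) → Fin n × Fin 3 → ℝ
cofactorMatrix {n} p e (v , t) with ends n e
... | i , j with v Fin.≟ i | v Fin.≟ j
...   | yes _ | _     = D (p i) (p j) t
...   | no _  | yes _ = - D (p i) (p j) t
...   | no _  | no _  = 0ℝ

-- For generic p these are the independent sets of 𝒞¹₂,ₙ.
CofactorIndependent : ∀ {n} → Points n → EdgeSet n → Set
CofactorIndependent p = RowIndependent (cofactorMatrix p)

{-# OPTIONS --safe #-}
-- A random-ordering argument (after Villányi). Let C be the closure of F ∖ S and add the vertices
-- one at a time in random order. A vertex with at least 3 earlier C-neighbours contributes 3 new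
-- independent edges (0-extension), and 4 when those neighbours number at least 4 and are not a
-- C-clique (1-extension, as a non-edge of the closed graph C is independent of C). With D neighbours
-- in all, its expected contribution is 3 - 6/(D+1) when they form a clique and at least 7/2 - 6/D
-- otherwise. Now D + s ≥ 12 where s is the degree in S, so every vertex contributes at least 3 - s/2,
-- except one with s = 0 and a clique neighbourhood; such a vertex can be deleted, preserving
-- 12-connectivity, unless n = 13 and C is complete. The total is at least 3n - |S| ≥ 3n - 6, which
-- is the rank of Kₙ.
--
-- Genericity: independence of rows over ℚ at a single rational point makes them independent as
-- rows of polynomials, hence at almost all rational points and at an algebraically independent
-- real point. Fraction-free Gaussian elimination makes this effective and the matroid decidable.
module Submission where

open import Algebra.Bundles using (CommutativeRing)
open import Algebra.Bundles.Raw using (RawRing)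
import Algebra.Construct.Pointwise as Pointwise
import Algebra.Morphism.RingMonomorphism as RingMonomorphism
open import Algebra.Morphism.Structures using (IsRingMonomorphism)
import Algebra.Properties.CommutativeMonoid.Sum as CommutativeMonoidSum
import Algebra.Properties.Ring as RingProperties
import Algebra.Properties.Semiring.Sum as SemiringSum
open import Algebra.Structures using (IsCommutativeRing)
open import Data.Bool using (Bool; true; false; _∧_; _∨_; not; if_then_else_)
import Data.Bool.Properties as Bool
open import Data.Empty using (⊥; ⊥-elim)
open import Data.Fin using (Fin; zero; suc; toℕ; punchIn; punchOut; _↑ˡ_; _↑ʳ_)
import Data.Fin as Fin
open import Data.Fin.Patterns using (0F; 1F; 2F)
import Data.Fin.Properties as Fin
import Data.Fin.Subset.Properties as Subset
open import Data.List using (List; []; _∷_; length; allFin)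
import Data.List as List
open import Data.List.Membership.Propositional using (_∈_; _∉_)
import Data.List.Membership.Propositional.Properties as List
import Data.List.Properties as List
open import Data.List.Relation.Unary.All using (All; []; _∷_)
import Data.List.Relation.Unary.All as All
open import Data.List.Relation.Unary.AllPairs using ([]; _∷_)
open import Data.List.Relation.Unary.Any using (Any; here; there)
import Data.List.Relation.Unary.Any as Any
open import Data.List.Relation.Unary.Any.Properties using (lookup-index)
open import Data.List.Relation.Unary.Unique.Propositional using (Unique)
import Data.List.Relation.Unary.Unique.Propositional.Properties as Unique
open import Data.Nat using (ℕ; zero; suc; z≤n; s≤s)
import Data.Nat as ℕ
import Data.Nat.Properties as ℕ
open import Data.Product using (_×_; _,_; ∃-syntax; proj₁; proj₂)
open import Data.Rational using (ℚ; 0ℚ; 1ℚ; ½)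
import Data.Rational as ℚ
import Data.Rational.Properties as ℚ
open import Data.Sum using (_⊎_; inj₁; inj₂; [_,_]′)
open import Data.Unit using (⊤; tt)
open import Data.Vec using (Vec; []; _∷_)
import Data.Vec as Vec
import Data.Vec.Properties as Vec
import Data.Product.Properties as Product
import Defs
open import Function using (_∘_)
open import Level using (0ℓ)
open import Relation.Binary using (tri<; tri≈; tri>)
open import Relation.Binary.PropositionalEquality as ≡ using (_≡_; _≢_)
open import Relation.Nullary using (¬_; Dec; yes; no; ¬?; does; _×-dec_)
open import Relation.Nullary.Decidable using (decidable-stable; dec-true; dec-false; dec⇒maybe)
open import Relation.Unary using (Decidable)
open import Tactic.RingSolver using (solve-∀)
open import Tactic.RingSolver.Core.AlmostCommutativeRing using (AlmostCommutativeRing; fromCommutativeRing)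
import Algebra.Properties.Group ℚ.+-0-group as ℚGroup

-- No permutations are formed. `total W` is a potential: a lower bound for the expected gain in a
-- random order of `W`. Averaging over the last vertex finds one whose own gain covers the drop of
-- the potential, and recursion produces an explicit independent set. The potential has to satisfy a
-- recurrence in the neighbourhood B of a vertex v. For a non-clique B the value 7/2 - 6/D rests on
-- the fact that at most one deletion turns B into a clique: two such vertices a, b would yield K₅
-- minus ab inside C, and its nine edges already have the rank of K₅, so ab would lie in C. The
-- constant 12 enters through 12 ≤ D + s ≤ (D + 1)s for cliques with s ≥ 1, and 12 ≤ D + s ≤ D(s +
-- 1) for non-cliques with D ≥ 3. These say that 6/(D + 1), respectively 6/D - 1/2, is at most s/2.
-- The 1-extension is checked at a degenerate position of v, so each step leaves the polynomial
-- matrix for a rational point chosen for it and returns. Over the reals nothing can be decided: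
-- independence there comes from pivots that are nonzero polynomials, and dependence from a
-- polynomial relation.

ℚ-ring : AlmostCommutativeRing _ _
ℚ-ring = fromCommutativeRing ℚ.+-*-commutativeRing λ q → dec⇒maybe (0ℚ ℚ.≟ q)

-- Cauchy reals as a commutative ring, with cancellation of elements apart from zero

module Reals where

  open Defs
  open ≡ using (refl; sym; trans; cong; cong₂; subst)

  Eventually : (ℕ → Set) → Set
  Eventually P = ∃[ N ] (∀ n → N ℕ.≤ n → P n)

  eventually₂ : ∀ {P Q R : ℕ → Set} → (∀ n → P n → Q n → R n) →
    Eventually P → Eventually Q → Eventually R
  eventually₂ f (M , p) (N , q) = M ℕ.⊔ N , λ n le →
    f n (p n (ℕ.m⊔n≤o⇒m≤o M N le)) (q n (ℕ.m⊔n≤o⇒n≤o M N le))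

  half-pos : ∀ {ε} → 0ℚ ℚ.< ε → 0ℚ ℚ.< ½ ℚ.* ε
  half-pos {ε} 0<ε = subst (ℚ._< ½ ℚ.* ε) (ℚ.*-zeroʳ ½) (ℚ.*-monoʳ-<-pos ½ 0<ε)

  half+half : ∀ ε → ½ ℚ.* ε ℚ.+ ½ ℚ.* ε ≡ ε
  half+half ε = trans (sym (ℚ.*-distribʳ-+ ε ½ ½)) (ℚ.*-identityˡ ε)

  ∣p-q∣≡∣q-p∣ : ∀ p q → ℚ.∣ p ℚ.- q ∣ ≡ ℚ.∣ q ℚ.- p ∣
  ∣p-q∣≡∣q-p∣ p q = trans (sym (ℚ.∣-p∣≡∣p∣ (p ℚ.- q))) (cong ℚ.∣_∣ (swap p q))
    where
    swap : ∀ p q → ℚ.- (p ℚ.- q) ≡ q ℚ.- p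
    swap = solve-∀ ℚ-ring

  sum-close : ∀ p q r s {ε} → p ℚ.- s ≡ (p ℚ.- q) ℚ.+ r →
    ℚ.∣ p ℚ.- q ∣ ℚ.< ½ ℚ.* ε → ℚ.∣ r ∣ ℚ.< ½ ℚ.* ε → ℚ.∣ p ℚ.- s ∣ ℚ.< ε
  sum-close p q r s {ε} eq a b = begin-strict
    ℚ.∣ p ℚ.- s ∣                 ≡⟨ cong ℚ.∣_∣ eq ⟩
    ℚ.∣ (p ℚ.- q) ℚ.+ r ∣         ≤⟨ ℚ.∣p+q∣≤∣p∣+∣q∣ (p ℚ.- q) r ⟩
    ℚ.∣ p ℚ.- q ∣ ℚ.+ ℚ.∣ r ∣     <⟨ ℚ.+-mono-< a b ⟩
    ½ ℚ.* ε ℚ.+ ½ ℚ.* ε           ≡⟨ half+half ε ⟩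
    ε                             ∎
    where open ℚ.≤-Reasoning

  pointwise⇒≈ : ∀ x y → (∀ n → seq x n ≡ seq y n) → x ≈ y
  pointwise⇒≈ x y eq ε 0<ε = 0 , λ n _ →
    subst (λ d → ℚ.∣ d ∣ ℚ.< ε)
      (trans (sym (ℚ.+-inverseʳ (seq y n))) (cong (ℚ._- seq y n) (sym (eq n)))) 0<ε

  ≈-refl : ∀ {x} → x ≈ x
  ≈-refl {x} = pointwise⇒≈ x x λ _ → refl

  ≈-sym : ∀ {x y} → x ≈ y → y ≈ x
  ≈-sym {x} {y} x≈y ε 0<ε with x≈y ε 0<ε
  ... | N , close = N , λ n le → subst (ℚ._< ε) (∣p-q∣≡∣q-p∣ (seq x n) (seq y n)) (close n le)

  ≈-trans : ∀ {x y z} → x ≈ y → y ≈ z → x ≈ z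
  ≈-trans {x} {y} {z} x≈y y≈z ε 0<ε =
    eventually₂ (λ n → sum-close (seq x n) (seq y n) (seq y n ℚ.- seq z n) (seq z n) (split (seq x n) (seq y n) (seq z n)))
      (x≈y _ (half-pos 0<ε)) (y≈z _ (half-pos 0<ε))
    where
    split : ∀ p q s → p ℚ.- s ≡ (p ℚ.- q) ℚ.+ (q ℚ.- s)
    split = solve-∀ ℚ-ring

  +-cong : ∀ {x y u v} → x ≈ y → u ≈ v → x + u ≈ y + v
  +-cong {x} {y} {u} {v} x≈y u≈v ε 0<ε =
    eventually₂ (λ n a b → begin-strict
      ℚ.∣ (seq x n ℚ.+ seq u n) ℚ.- (seq y n ℚ.+ seq v n) ∣
        ≡⟨ cong ℚ.∣_∣ (split (seq x n) (seq u n) (seq y n) (seq v n)) ⟩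
      ℚ.∣ (seq x n ℚ.- seq y n) ℚ.+ (seq u n ℚ.- seq v n) ∣
        ≤⟨ ℚ.∣p+q∣≤∣p∣+∣q∣ (seq x n ℚ.- seq y n) (seq u n ℚ.- seq v n) ⟩
      ℚ.∣ seq x n ℚ.- seq y n ∣ ℚ.+ ℚ.∣ seq u n ℚ.- seq v n ∣
        <⟨ ℚ.+-mono-< a b ⟩
      ½ ℚ.* ε ℚ.+ ½ ℚ.* ε
        ≡⟨ half+half ε ⟩
      ε ∎)
      (x≈y _ (half-pos 0<ε)) (u≈v _ (half-pos 0<ε))
    where
    open ℚ.≤-Reasoning
    split : ∀ a b c d → (a ℚ.+ b) ℚ.- (c ℚ.+ d) ≡ (a ℚ.- c) ℚ.+ (b ℚ.- d)
    split = solve-∀ ℚ-ring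

  -‿cong : ∀ {x y} → x ≈ y → - x ≈ - y
  -‿cong {x} {y} x≈y ε 0<ε with x≈y ε 0<ε
  ... | N , close = N , λ n le →
    subst (ℚ._< ε)
      (trans (∣p-q∣≡∣q-p∣ (seq x n) (seq y n)) (cong ℚ.∣_∣ (swap (seq x n) (seq y n))))
      (close n le)
    where
    swap : ∀ p q → q ℚ.- p ≡ (ℚ.- p) ℚ.- (ℚ.- q)
    swap = solve-∀ ℚ-ring

  bounded : ∀ x → ∃[ B ] (0ℚ ℚ.< B × Eventually (λ n → ℚ.∣ seq x n ∣ ℚ.≤ B))
  bounded x with cauchy x 1ℚ (ℚ.positive⁻¹ 1ℚ)
  ... | N , close = 1ℚ ℚ.+ ℚ.∣ seq x N ∣
    , ℚ.<-≤-trans (ℚ.positive⁻¹ 1ℚ)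
        (subst (ℚ._≤ 1ℚ ℚ.+ ℚ.∣ seq x N ∣) (ℚ.+-identityʳ 1ℚ) (ℚ.+-monoʳ-≤ 1ℚ (ℚ.0≤∣p∣ (seq x N))))
    , N , λ n le → begin
      ℚ.∣ seq x n ∣                                ≡⟨ cong ℚ.∣_∣ (split (seq x n) (seq x N)) ⟩
      ℚ.∣ (seq x n ℚ.- seq x N) ℚ.+ seq x N ∣      ≤⟨ ℚ.∣p+q∣≤∣p∣+∣q∣ (seq x n ℚ.- seq x N) (seq x N) ⟩
      ℚ.∣ seq x n ℚ.- seq x N ∣ ℚ.+ ℚ.∣ seq x N ∣  ≤⟨ ℚ.+-monoˡ-≤ ℚ.∣ seq x N ∣ (ℚ.<⇒≤ (close n N le ℕ.≤-refl)) ⟩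
      1ℚ ℚ.+ ℚ.∣ seq x N ∣                         ∎
    where
    open ℚ.≤-Reasoning
    split : ∀ a b → a ≡ (a ℚ.- b) ℚ.+ b
    split = solve-∀ ℚ-ring

  divide : ∀ {B ε} → 0ℚ ℚ.< B → 0ℚ ℚ.< ε → ∃[ δ ] (0ℚ ℚ.< δ × B ℚ.* δ ≡ ε)
  divide {B} {ε} 0<B 0<ε = B⁻¹ ℚ.* ε
    , subst (ℚ._< B⁻¹ ℚ.* ε) (ℚ.*-zeroʳ B⁻¹) (ℚ.*-monoʳ-<-pos B⁻¹ 0<ε)
    , trans (sym (ℚ.*-assoc B B⁻¹ ε)) (trans (cong (ℚ._* ε) (ℚ.*-inverseʳ B)) (ℚ.*-identityˡ ε))
    where
    instance
      _ = ℚ.positive 0<B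
      _ = ℚ.pos⇒nonZero B
      _ = ℚ.1/pos⇒pos B
    B⁻¹ = ℚ.1/ B

  *-congˡ : ∀ {x y z} → y ≈ z → x * y ≈ x * z
  *-congˡ {x} {y} {z} y≈z ε 0<ε = eventually₂ step (proj₂ (proj₂ B>0)) (y≈z δ (proj₁ (proj₂ δ>0)))
    where
    open ℚ.≤-Reasoning
    B>0 = bounded x
    B = proj₁ B>0
    δ>0 = divide (proj₁ (proj₂ B>0)) 0<ε
    δ = proj₁ δ>0
    factor : ∀ a b c → a ℚ.* b ℚ.- a ℚ.* c ≡ a ℚ.* (b ℚ.- c)
    factor = solve-∀ ℚ-ring
    step : ∀ n → ℚ.∣ seq x n ∣ ℚ.≤ B → ℚ.∣ seq y n ℚ.- seq z n ∣ ℚ.< δ →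
      ℚ.∣ seq x n ℚ.* seq y n ℚ.- seq x n ℚ.* seq z n ∣ ℚ.< ε
    step n x≤B close = begin-strict
      ℚ.∣ seq x n ℚ.* seq y n ℚ.- seq x n ℚ.* seq z n ∣
        ≡⟨ cong ℚ.∣_∣ (factor (seq x n) (seq y n) (seq z n)) ⟩
      ℚ.∣ seq x n ℚ.* (seq y n ℚ.- seq z n) ∣
        ≡⟨ ℚ.∣p*q∣≡∣p∣*∣q∣ (seq x n) (seq y n ℚ.- seq z n) ⟩
      ℚ.∣ seq x n ∣ ℚ.* ℚ.∣ seq y n ℚ.- seq z n ∣
        ≤⟨ ℚ.*-monoʳ-≤-nonNeg ℚ.∣ seq y n ℚ.- seq z n ∣
             {{ℚ.nonNegative (ℚ.0≤∣p∣ (seq y n ℚ.- seq z n))}} x≤B ⟩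
      B ℚ.* ℚ.∣ seq y n ℚ.- seq z n ∣
        <⟨ ℚ.*-monoʳ-<-pos B {{ℚ.positive (proj₁ (proj₂ B>0))}} close ⟩
      B ℚ.* δ
        ≡⟨ proj₂ (proj₂ δ>0) ⟩
      ε ∎

  *-comm : ∀ x y → x * y ≈ y * x
  *-comm x y = pointwise⇒≈ (x * y) (y * x) λ n → ℚ.*-comm (seq x n) (seq y n)

  *-cong : ∀ {x y u v} → x ≈ y → u ≈ v → x * u ≈ y * v
  *-cong {x} {y} {u} {v} x≈y u≈v =
    ≈-trans {x * u} {u * x} {y * v} (*-comm x u)
      (≈-trans {u * x} {u * y} {y * v} (*-congˡ {u} {x} {y} x≈y)
        (≈-trans {u * y} {y * u} {y * v} (*-comm u y) (*-congˡ {y} {u} {v} u≈v)))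

  -- Opaque, lest comparing two reals unfold their Cauchy proofs.
  opaque

    plus times : ℝ → ℝ → ℝ
    plus  = _+_
    times = _*_

    negate : ℝ → ℝ
    negate = -_

  opaque
    unfolding plus

    times≡ : ∀ x y → times x y ≡ x * y
    times≡ x y = refl

    ℝ-isCommutativeRing : IsCommutativeRing _≈_ plus times negate 0ℝ (fromℚ 1ℚ)
    ℝ-isCommutativeRing = record
      { isRing = record
        { +-isAbelianGroup = record
          { isGroup = record
            { isMonoid = record
              { isSemigroup = record
                { isMagma = record
                  { isEquivalence = record
                    { refl = λ {x} → ≈-refl {x}
                    ; sym = λ {x} {y} → ≈-sym {x} {y}
                    ; trans = λ {x} {y} {z} → ≈-trans {x} {y} {z} }
                  ; ∙-cong = λ {x} {y} {u} {v} → +-cong {x} {y} {u} {v} }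
                ; assoc = λ x y z → pointwise⇒≈ ((x + y) + z) (x + (y + z)) λ n →
                    ℚ.+-assoc (seq x n) (seq y n) (seq z n) }
              ; identity = (λ x → pointwise⇒≈ (0ℝ + x) x λ n → ℚ.+-identityˡ (seq x n))
                         , (λ x → pointwise⇒≈ (x + 0ℝ) x λ n → ℚ.+-identityʳ (seq x n)) }
            ; inverse = (λ x → pointwise⇒≈ (- x + x) 0ℝ λ n → ℚ.+-inverseˡ (seq x n))
                      , (λ x → pointwise⇒≈ (x - x) 0ℝ λ n → ℚ.+-inverseʳ (seq x n))
            ; ⁻¹-cong = λ {x} {y} → -‿cong {x} {y} }
          ; comm = λ x y → pointwise⇒≈ (x + y) (y + x) λ n → ℚ.+-comm (seq x n) (seq y n) }
        ; *-cong = λ {x} {y} {u} {v} → *-cong {x} {y} {u} {v}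
        ; *-assoc = λ x y z → pointwise⇒≈ ((x * y) * z) (x * (y * z)) λ n →
            ℚ.*-assoc (seq x n) (seq y n) (seq z n)
        ; *-identity = (λ x → pointwise⇒≈ (fromℚ 1ℚ * x) x λ n → ℚ.*-identityˡ (seq x n))
                     , (λ x → pointwise⇒≈ (x * fromℚ 1ℚ) x λ n → ℚ.*-identityʳ (seq x n))
        ; distrib = (λ x y z → pointwise⇒≈ (x * (y + z)) (x * y + x * z) λ n →
                      ℚ.*-distribˡ-+ (seq x n) (seq y n) (seq z n))
                  , (λ x y z → pointwise⇒≈ ((y + z) * x) (y * x + z * x) λ n →
                      ℚ.*-distribʳ-+ (seq x n) (seq y n) (seq z n)) }
      ; *-comm = *-comm }

  ℝ-commutativeRing : CommutativeRing 0ℓ 0ℓ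
  ℝ-commutativeRing = record { isCommutativeRing = ℝ-isCommutativeRing }

  -- Apartness keeps |x| above a fixed `η` eventually, so |y| is at most |xy| divided by `η`.
  -- Cancellation is all that elimination will ask of a real pivot.
  #0⇒cancel : ∀ x → x # 0ℝ → ∀ y → x * y ≈ 0ℝ → y ≈ 0ℝ
  #0⇒cancel x (η , 0<η , apart) y xy≈0 ε 0<ε = eventually₂ step apart (xy≈0 (η ℚ.* ε) 0<ηε)
    where
    open ℚ.≤-Reasoning
    drop-zeros : ∀ a b → (a ℚ.- 0ℚ) ℚ.* (b ℚ.- 0ℚ) ≡ a ℚ.* b ℚ.- 0ℚ
    drop-zeros a b = trans (cong₂ ℚ._*_ (ℚ.+-identityʳ a) (ℚ.+-identityʳ b)) (sym (ℚ.+-identityʳ (a ℚ.* b)))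
    0<ηε : 0ℚ ℚ.< η ℚ.* ε
    0<ηε = subst (ℚ._< η ℚ.* ε) (ℚ.*-zeroʳ η) (ℚ.*-monoʳ-<-pos η {{ℚ.positive 0<η}} 0<ε)
    step : ∀ n → η ℚ.≤ ℚ.∣ seq x n ℚ.- 0ℚ ∣ → ℚ.∣ seq x n ℚ.* seq y n ℚ.- 0ℚ ∣ ℚ.< η ℚ.* ε →
      ℚ.∣ seq y n ℚ.- 0ℚ ∣ ℚ.< ε
    step n η≤ small = ℚ.*-cancelˡ-<-nonNeg η {{ℚ.nonNegative (ℚ.<⇒≤ 0<η)}} (begin-strict
      η ℚ.* ℚ.∣ seq y n ℚ.- 0ℚ ∣
        ≤⟨ ℚ.*-monoʳ-≤-nonNeg ℚ.∣ seq y n ℚ.- 0ℚ ∣ {{ℚ.nonNegative (ℚ.0≤∣p∣ (seq y n ℚ.- 0ℚ))}} η≤ ⟩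
      ℚ.∣ seq x n ℚ.- 0ℚ ∣ ℚ.* ℚ.∣ seq y n ℚ.- 0ℚ ∣
        ≡⟨ sym (ℚ.∣p*q∣≡∣p∣*∣q∣ (seq x n ℚ.- 0ℚ) (seq y n ℚ.- 0ℚ)) ⟩
      ℚ.∣ (seq x n ℚ.- 0ℚ) ℚ.* (seq y n ℚ.- 0ℚ) ∣
        ≡⟨ cong ℚ.∣_∣ (drop-zeros (seq x n) (seq y n)) ⟩
      ℚ.∣ seq x n ℚ.* seq y n ℚ.- 0ℚ ∣
        <⟨ small ⟩
      η ℚ.* ε ∎)

  #⇒≉ : ∀ x → x # 0ℝ → ¬ x ≈ 0ℝ
  #⇒≉ x (η , 0<η , N , apart) x≈0 = contradict (x≈0 η 0<η)
    where
    contradict : Eventually (λ n → ℚ.∣ seq x n ℚ.- 0ℚ ∣ ℚ.< η) → ⊥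
    contradict (M , small) = ℚ.<-irrefl refl (ℚ.≤-<-trans (apart (M ℕ.⊔ N) (ℕ.m≤n⊔m M N)) (small (M ℕ.⊔ N) (ℕ.m≤m⊔n M N)))

-- Linear algebra

open Defs using (Poly; Nonzero; ℝ; 0ℝ; fromℚ; eval; _#_; AlgebraicallyIndependent; ∣EK∣; edgesK; ends; Points; D; cofactorMatrix)
open Reals using (ℝ-commutativeRing; #0⇒cancel; #⇒≉; pointwise⇒≈; plus; times; negate; times≡)

record Removal {A : Set} (x : A) (xs : List A) : Set where
  field
    rest    : List A
    shorter : length xs ≡ suc (length rest)
    unique  : Unique rest
    x∉rest  : x ∉ rest
    rest⊆   : ∀ {y} → y ∈ rest → y ∈ xs
    ⊆rest   : ∀ {y} → y ∈ xs → y ≢ x → y ∈ rest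

∉-head : ∀ {A : Set} {x : A} {xs} → Unique (x ∷ xs) → x ∉ xs
∉-head (px ∷ _) x∈xs = All.lookup px x∈xs ≡.refl

∉⇒All≢ : ∀ {A : Set} {x : A} {xs} → x ∉ xs → All (x ≢_) xs
∉⇒All≢ x∉ = All.tabulate λ y∈ x≡y → x∉ (≡.subst (_∈ _) (≡.sym x≡y) y∈)

remove : ∀ {A : Set} {x : A} {xs} → x ∈ xs → Unique xs → Removal x xs
remove {xs = x ∷ xs} (here ≡.refl) u@(_ ∷ u′) = record
  { rest = xs ; shorter = ≡.refl ; unique = u′ ; x∉rest = ∉-head u ; rest⊆ = there
  ; ⊆rest = λ { (here y≡x) y≢x → ⊥-elim (y≢x y≡x) ; (there y∈) _ → y∈ } }
remove {x = x} {xs = y ∷ xs} (there x∈) u@(px ∷ u′) = record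
  { rest = y ∷ rest ; shorter = ≡.cong suc shorter
  ; unique = ∉⇒All≢ (∉-head u ∘ rest⊆) ∷ unique
  ; x∉rest = λ { (here x≡y) → ∉-head u (≡.subst (_∈ xs) x≡y x∈) ; (there x∈r) → x∉rest x∈r }
  ; rest⊆ = λ { (here e) → here e ; (there z∈) → there (rest⊆ z∈) }
  ; ⊆rest = λ { (here e) _ → here e ; (there z∈) z≢x → there (⊆rest z∈ z≢x) } }
  where open Removal (remove x∈ u′)

-- Finding a pivot means deciding whether a row has a nonzero entry. Columns are an arbitrary type,
-- `Fin k` when rows are counted against columns and `Fin n × Fin 3` for the cofactor matrix, so the
-- search is a parameter.
Searchable : Set → Set₁
Searchable A = ∀ {P : A → Set} → Decidable P → Dec (∃[ a ] P a)

module Linear (R : CommutativeRing 0ℓ 0ℓ) where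

  open CommutativeRing R hiding (zero)
  open CommutativeMonoidSum +-commutativeMonoid public using (sum; sum-cong-≋; ∑-distrib-+; ∑-comm; sum-replicate-zero)
  open SemiringSum semiring using (*-distribˡ-sum; *-distribʳ-sum)
  open RingProperties ring using (-‿distribˡ-*; -‿distribʳ-*; -‿involutive; -0#≈0#)
  open import Relation.Binary.Reasoning.Setoid setoid

  -- Elimination uses nothing else about a pivot. Over the rationals and the polynomials it follows
  -- from being nonzero, over the reals from apartness, so one development serves all three rings.
  Regular : Carrier → Set
  Regular a = ∀ x → a * x ≈ 0# → x ≈ 0#

  Matrix : ℕ → Set → Set
  Matrix m Col = Fin m → Col → Carrier

  δ : ∀ {m} → Fin m → Fin m → Carrier
  δ i e with i Fin.≟ e
  ... | yes _ = 1#
  ... | no _  = 0#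

  sum-zero : ∀ {m} {f : Fin m → Carrier} → (∀ e → f e ≈ 0#) → sum f ≈ 0#
  sum-zero {m} f≈0 = trans (sum-cong-≋ f≈0) (sum-replicate-zero m)

  δ-same : ∀ {m} (i : Fin m) → δ i i ≈ 1#
  δ-same i with i Fin.≟ i
  ... | yes _  = refl
  ... | no i≢i = ⊥-elim (i≢i ≡.refl)

  δ-diff : ∀ {m} {i e : Fin m} → i ≢ e → δ i e ≈ 0#
  δ-diff {i = i} {e} i≢e with i Fin.≟ e
  ... | yes i≡e = ⊥-elim (i≢e i≡e)
  ... | no _    = refl

  δ-suc : ∀ {m} (i e : Fin m) → δ (suc i) (suc e) ≈ δ i e
  δ-suc i e = by-cases (i Fin.≟ e)
    where
    by-cases : Dec (i ≡ e) → δ (suc i) (suc e) ≈ δ i e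
    by-cases (yes ≡.refl) = trans (δ-same (suc i)) (sym (δ-same i))
    by-cases (no i≢e)     = trans (δ-diff (i≢e ∘ Fin.suc-injective)) (sym (δ-diff i≢e))

  sum-δ : ∀ {m} (i : Fin m) (f : Fin m → Carrier) → sum (λ e → δ i e * f e) ≈ f i
  sum-δ zero f = begin
    1# * f zero + sum (λ e → 0# * f (suc e))  ≈⟨ +-cong (*-identityˡ _) (sum-zero λ e → zeroˡ (f (suc e))) ⟩
    f zero + 0#                               ≈⟨ +-identityʳ _ ⟩
    f zero                                    ∎
  sum-δ (suc i) f = begin
    0# * f zero + sum (λ e → δ (suc i) (suc e) * f (suc e))
      ≈⟨ +-cong (zeroˡ _) (sum-cong-≋ λ e → *-congʳ (δ-suc i e)) ⟩
    0# + sum (λ e → δ i e * f (suc e))  ≈⟨ +-identityˡ _ ⟩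
    sum (λ e → δ i e * f (suc e))       ≈⟨ sum-δ i (f ∘ suc) ⟩
    f (suc i)                           ∎

  sum-cong : ∀ {m} (f g : Fin m → Carrier) → (∀ e → f e ≈ g e) → sum f ≈ sum g
  sum-cong f g f≈g = sum-cong-≋ f≈g

  sum-linear : ∀ {m} (h f g : Fin m → Carrier) a b → (∀ e → h e ≈ a * f e + b * g e) →
    sum h ≈ a * sum f + b * sum g
  sum-linear h f g a b h≈ = begin
    sum h                                        ≈⟨ sum-cong h (λ e → a * f e + b * g e) h≈ ⟩
    sum (λ e → a * f e + b * g e)                ≈⟨ ∑-distrib-+ (λ e → a * f e) (λ e → b * g e) ⟩
    sum (λ e → a * f e) + sum (λ e → b * g e)    ≈⟨ +-cong (sym (*-distribˡ-sum a f)) (sym (*-distribˡ-sum b g)) ⟩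
    a * sum f + b * sum g                        ∎

  listSum : ∀ {m} → (Fin m → Carrier) → List (Fin m) → Carrier
  listSum f []       = 0#
  listSum f (i ∷ es) = f i + listSum f es

  listSum-cong : ∀ {m} (f g : Fin m → Carrier) es → (∀ {e} → e ∈ es → f e ≈ g e) → listSum f es ≈ listSum g es
  listSum-cong f g []       f≈g = refl
  listSum-cong f g (i ∷ es) f≈g = +-cong (f≈g (here ≡.refl)) (listSum-cong f g es (f≈g ∘ there))

  sum-support : ∀ {m} (f : Fin m → Carrier) es → Unique es → (∀ e → e ∉ es → f e ≈ 0#) → sum f ≈ listSum f es
  sum-support f [] _ f≈0 = sum-zero λ e → f≈0 e λ ()
  sum-support {m} f (i ∷ es) u@(_ ∷ u′) supp = begin
    sum f
      ≈⟨ sum-cong f (λ e → δ i e * f e + f′ e) split ⟩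
    sum (λ e → δ i e * f e + f′ e)
      ≈⟨ ∑-distrib-+ (λ e → δ i e * f e) f′ ⟩
    sum (λ e → δ i e * f e) + sum f′
      ≈⟨ +-cong (sum-δ i f) (sum-support f′ es u′ supp′) ⟩
    f i + listSum f′ es
      ≈⟨ +-congˡ (listSum-cong f′ f es λ e∈ → f′-other λ i≡e → ∉-head u (≡.subst (_∈ es) (≡.sym i≡e) e∈)) ⟩
    f i + listSum f es ∎
    where
    f′ : Fin m → Carrier
    f′ e with i Fin.≟ e
    ... | yes _ = 0#
    ... | no _  = f e
    f′-other : ∀ {e} → i ≢ e → f′ e ≈ f e
    f′-other {e} i≢e with i Fin.≟ e
    ... | yes i≡e = ⊥-elim (i≢e i≡e)
    ... | no _    = refl
    split : ∀ e → f e ≈ δ i e * f e + f′ e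
    split e with i Fin.≟ e
    ... | yes _ = sym (trans (+-identityʳ _) (*-identityˡ _))
    ... | no _  = sym (trans (+-congʳ (zeroˡ _)) (+-identityˡ _))
    supp′ : ∀ e → e ∉ es → f′ e ≈ 0#
    supp′ e e∉ with i Fin.≟ e
    ... | yes _   = refl
    ... | no i≢e  = supp e λ { (here e≡i) → i≢e (≡.sym e≡i) ; (there e∈) → e∉ e∈ }

  *-sum : ∀ {m} a (f : Fin m → Carrier) → a * sum f ≈ sum (λ e → a * f e)
  *-sum a f = *-distribˡ-sum a f

  sum-* : ∀ {m} (f : Fin m → Carrier) a → sum f * a ≈ sum (λ e → f e * a)
  sum-* f a = *-distribʳ-sum a f

  comb : ∀ {m Col} → (Fin m → Carrier) → Matrix m Col → Col → Carrier
  comb c A j = sum (λ e → c e * A e j)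

  -- A predicate instead of a list lets elimination adjoin or drop the pivot row without rearranging
  -- anything.
  Indep : ∀ {m Col} → Matrix m Col → (Fin m → Set) → Set
  Indep {m} A P = ∀ (c : Fin m → Carrier) →
    (∀ e → ¬ P e → c e ≈ 0#) → (∀ j → comb c A j ≈ 0#) → ∀ e → c e ≈ 0#

  indep-⊆ : ∀ {m Col} {A : Matrix m Col} {P Q : Fin m → Set} →
    (∀ {e} → P e → Q e) → Indep A Q → Indep A P
  indep-⊆ P⊆Q ind c supp = ind c λ e ¬Qe → supp e (¬Qe ∘ P⊆Q)

  -- Multiplying by the pivot replaces division by it. This is a relation up to `≈` because
  -- evaluating an eliminated polynomial matrix gives the elimination of the evaluated one only up
  -- to the equality of the target ring.
  IsElim : ∀ {m Col} → Matrix m Col → Fin m → Col → Matrix m Col → Set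
  IsElim A i j A′ = ∀ e k → A′ e k ≈ A i j * A e k - A e j * A i k

  elimination : ∀ {m Col} → Matrix m Col → Fin m → Col → Matrix m Col
  elimination A i j e k = A i j * A e k - A e j * A i k

  module _ {m : ℕ} {Col : Set} {A A′ : Matrix m Col} {i : Fin m} {j : Col} (el : IsElim A i j A′) where

    comb-elim : ∀ c k → comb c A′ k ≈ A i j * comb c A k - comb c A j * A i k
    comb-elim c k = begin
      comb c A′ k
        ≈⟨ sum-linear (λ e → c e * A′ e k) (λ e → c e * A e k) (λ e → c e * A e j) (A i j) (- A i k)
             (λ e → trans (*-congˡ (el e k)) (entry e)) ⟩
      A i j * comb c A k + (- A i k) * comb c A j
        ≈⟨ +-congˡ (trans (*-comm _ _) (sym (-‿distribʳ-* _ _))) ⟩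
      A i j * comb c A k - comb c A j * A i k ∎
      where
      entry : ∀ e → c e * (A i j * A e k - A e j * A i k) ≈
        A i j * (c e * A e k) + (- A i k) * (c e * A e j)
      entry e = begin
        c e * (A i j * A e k - A e j * A i k)                   ≈⟨ distribˡ _ _ _ ⟩
        c e * (A i j * A e k) + c e * (- (A e j * A i k))       ≈⟨ +-cong (swap _ _ _) (*-congˡ (-‿distribʳ-* _ _)) ⟩
        A i j * (c e * A e k) + c e * (A e j * (- A i k))       ≈⟨ +-congˡ (trans (sym (*-assoc _ _ _)) (*-comm _ _)) ⟩
        A i j * (c e * A e k) + (- A i k) * (c e * A e j)       ∎
        where
        swap : ∀ x y z → x * (y * z) ≈ y * (x * z)
        swap x y z = trans (sym (*-assoc x y z)) (trans (*-congʳ (*-comm x y)) (*-assoc y x z))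

    -- Scaling by the pivot and giving row `i` the coefficient that clears column `j` turns a
    -- relation among the eliminated rows into one among the original rows.
    lift-relation : (Fin m → Carrier) → Fin m → Carrier
    lift-relation c e = A i j * c e + δ i e * (- comb c A j)

    comb-lift : ∀ c k → comb (lift-relation c) A k ≈ comb c A′ k
    comb-lift c k = begin
      comb (lift-relation c) A k
        ≈⟨ sum-linear (λ e → lift-relation c e * A e k) (λ e → c e * A e k) (λ e → δ i e * A e k) (A i j) (- comb c A j) entry ⟩
      A i j * comb c A k + (- comb c A j) * sum (λ e → δ i e * A e k)
        ≈⟨ +-congˡ (*-congˡ (sum-δ i (λ e → A e k))) ⟩
      A i j * comb c A k + (- comb c A j) * A i k
        ≈⟨ +-congˡ (sym (-‿distribˡ-* _ _)) ⟩
      A i j * comb c A k - comb c A j * A i k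
        ≈⟨ sym (comb-elim c k) ⟩
      comb c A′ k ∎
      where
      entry : ∀ e → lift-relation c e * A e k ≈ A i j * (c e * A e k) + (- comb c A j) * (δ i e * A e k)
      entry e = trans (distribʳ _ _ _)
        (+-cong (*-assoc _ _ _) (trans (*-congʳ (*-comm _ _)) (*-assoc _ _ _)))

    lift-other : ∀ c {e} → e ≢ i → lift-relation c e ≈ A i j * c e
    lift-other c e≢i = trans (+-congˡ (trans (*-congʳ (δ-diff (e≢i ∘ ≡.sym))) (zeroˡ _))) (+-identityʳ _)

    lift-same : ∀ c → c i ≈ 0# → lift-relation c i ≈ - comb c A j
    lift-same c ci≈0 = trans (+-cong (trans (*-congˡ ci≈0) (zeroʳ _)) (trans (*-congʳ (δ-same i)) (*-identityˡ _))) (+-identityˡ _)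

    pivot-row-zero : ∀ k → A′ i k ≈ 0#
    pivot-row-zero k = trans (el i k) (-‿inverseʳ _)

    -- The eliminated row `i` is zero, so the coefficient at `i` may be erased before the hypothesis
    -- is applied. Once all other coefficients vanish, column `j` reads pivot times coefficient, and
    -- regularity ends the argument.
    indep-elim : ∀ {P} → Regular (A i j) → Indep A′ P → Indep A (λ e → e ≡ i ⊎ P e)
    indep-elim {P} reg ind c supp rel = c≈0
      where
      c′ : Fin m → Carrier
      c′ e with e Fin.≟ i
      ... | yes _ = 0#
      ... | no _  = c e
      c′-other : ∀ {e} → e ≢ i → c′ e ≈ c e
      c′-other {e} e≢i with e Fin.≟ i
      ... | yes e≡i = ⊥-elim (e≢i e≡i)
      ... | no _    = refl
      c′-supp : ∀ e → ¬ P e → c′ e ≈ 0#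
      c′-supp e ¬Pe with e Fin.≟ i
      ... | yes _   = refl
      ... | no e≢i  = supp e λ { (inj₁ e≡i) → e≢i e≡i ; (inj₂ Pe) → ¬Pe Pe }
      term : ∀ k e → c′ e * A′ e k ≈ c e * A′ e k
      term k e with e Fin.≟ i
      ... | yes ≡.refl = trans (zeroˡ _) (sym (trans (*-congˡ (pivot-row-zero k)) (zeroʳ _)))
      ... | no _       = refl
      c′≈0 : ∀ e → c′ e ≈ 0#
      c′≈0 = ind c′ c′-supp λ k → begin
        comb c′ A′ k                             ≈⟨ sum-cong (λ e → c′ e * A′ e k) (λ e → c e * A′ e k) (term k) ⟩
        comb c A′ k                              ≈⟨ comb-elim c k ⟩
        A i j * comb c A k - comb c A j * A i k
          ≈⟨ +-cong (trans (*-congˡ (rel k)) (zeroʳ _)) (-‿cong (trans (*-congʳ (rel j)) (zeroˡ _))) ⟩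
        0# - 0#                                  ≈⟨ -‿inverseʳ 0# ⟩
        0#                                       ∎
      other : ∀ {e} → e ≢ i → c e ≈ 0#
      other {e} e≢i = trans (sym (c′-other e≢i)) (c′≈0 e)
      only-pivot : ∀ e → δ i e * (c e * A e j) ≈ c e * A e j
      only-pivot e with i Fin.≟ e
      ... | yes _  = *-identityˡ _
      ... | no i≢e = trans (zeroˡ _) (sym (trans (*-congʳ (other (i≢e ∘ ≡.sym))) (zeroˡ _)))
      pivot : c i ≈ 0#
      pivot = reg (c i) (begin
        A i j * c i                       ≈⟨ *-comm _ _ ⟩
        c i * A i j                       ≈⟨ sym (sum-δ i (λ e → c e * A e j)) ⟩
        sum (λ e → δ i e * (c e * A e j)) ≈⟨ sum-cong (λ e → δ i e * (c e * A e j)) (λ e → c e * A e j) only-pivot ⟩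
        comb c A j                        ≈⟨ rel j ⟩
        0#                                ∎)
      c≈0 : ∀ e → c e ≈ 0#
      c≈0 e with e Fin.≟ i
      ... | yes e≡i = trans (reflexive (≡.cong c e≡i)) pivot
      ... | no e≢i  = other e≢i

    -- Converse of `indep-elim`: elimination at a regular pivot of row `i` is the contraction of `i`
    -- in the matroid of rows. Off row `i` the lifted relation is the pivot times `c`.
    indep-unelim : ∀ {P} → Regular (A i j) → ¬ P i → Indep A (λ e → e ≡ i ⊎ P e) → Indep A′ P
    indep-unelim {P} reg ¬Pi ind c supp rel e with e Fin.≟ i
    ... | yes ≡.refl = supp e ¬Pi
    ... | no e≢i     = reg (c e) (trans (sym (lift-other c e≢i))
      (ind (lift-relation c) lift-supp (λ k → trans (comb-lift c k) (rel k)) e))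
      where
      lift-supp : ∀ e → ¬ (e ≡ i ⊎ P e) → lift-relation c e ≈ 0#
      lift-supp e out = trans (lift-other c (out ∘ inj₁)) (trans (*-congˡ (supp e (out ∘ inj₂))) (zeroʳ _))

  split-∈ : ∀ {m} {e i : Fin m} {es} → e ∈ i ∷ es → e ≡ i ⊎ e ∈ es
  split-∈ (here e≡i)  = inj₁ e≡i
  split-∈ (there e∈)  = inj₂ e∈

  join-∈ : ∀ {m} {e i : Fin m} {es} → e ≡ i ⊎ e ∈ es → e ∈ i ∷ es
  join-∈ (inj₁ e≡i) = here e≡i
  join-∈ (inj₂ e∈)  = there e∈

  Independent : ∀ {m Col} → Matrix m Col → List (Fin m) → Set
  Independent A es = Indep A (_∈ es)

  independent-[] : ∀ {m Col} (A : Matrix m Col) → Independent A []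
  independent-[] A c supp rel e = supp e λ ()

  module Domain (_≟0 : ∀ x → Dec (x ≈ 0#)) (cancel : ∀ {x} → ¬ x ≈ 0# → Regular x) (1≉0 : ¬ 1# ≈ 0#)
    where

    pivot? : ∀ {m Col} → Searchable Col → (A : Matrix m Col) (i : Fin m) →
      (∃[ j ] ¬ A i j ≈ 0#) ⊎ (∀ j → A i j ≈ 0#)
    pivot? search A i with search (λ j → ¬? (A i j ≟0))
    ... | yes p = inj₁ p
    ... | no ¬p = inj₂ λ j → decidable-stable (A i j ≟0) λ ≉0 → ¬p (j , ≉0)

    -- The trace of a successful elimination, one nonzero pivot per row. Being finite data, it can
    -- be carried to another ring by evaluating its pivots there.
    data Certificate {m Col} (A : Matrix m Col) : List (Fin m) → Set where
      []   : Certificate A []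
      step : ∀ {i es} j → ¬ A i j ≈ 0# → Certificate (elimination A i j) es → Certificate A (i ∷ es)

    Relation : ∀ {m Col} → Matrix m Col → List (Fin m) → Set
    Relation {m} A es = ∃[ c ] ((∀ e → e ∉ es → c e ≈ 0#) × (∀ j → comb c A j ≈ 0#) × ∃[ e ] ¬ c e ≈ 0#)

    relation⇒dependent : ∀ {m Col} {A : Matrix m Col} {es} → Relation A es → ¬ Independent A es
    relation⇒dependent (c , supp , rel , e , ce≉0) ind = ce≉0 (ind c supp rel e)

    zero-row-relation : ∀ {m Col} {A : Matrix m Col} {i es} → (∀ j → A i j ≈ 0#) → Relation A (i ∷ es)
    zero-row-relation {A = A} {i} Ai≈0 = δ i
      , (λ e e∉ → δ-diff (λ i≡e → e∉ (here (≡.sym i≡e))))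
      , (λ j → trans (sum-δ i (λ e → A e j)) (Ai≈0 j))
      , i , λ δ≈0 → 1≉0 (trans (sym (δ-same i)) δ≈0)

    certificate⇒independent : ∀ {m Col} {A : Matrix m Col} {es} → Certificate A es → Independent A es
    certificate⇒independent {A = A} [] = independent-[] A
    certificate⇒independent {A = A} (step {i} j ≉0 cert) =
      indep-⊆ split-∈ (indep-elim {A = A} {i = i} {j} (λ _ _ → refl) (cancel ≉0) (certificate⇒independent cert))

    module _ {Col : Set} (search : Searchable Col) where

      -- A zero row is itself a relation; otherwise eliminate and recurse. A relation found later
      -- lifts back, and its nonzero coefficient, multiplied by a nonzero pivot, stays nonzero.
      dichotomy : ∀ {m} (A : Matrix m Col) es → Unique es → Certificate A es ⊎ Relation A es
      dichotomy A [] _ = inj₁ []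
      dichotomy A (i ∷ es) u@(_ ∷ u′) with pivot? search A i
      ... | inj₂ Ai≈0 = inj₂ (zero-row-relation Ai≈0)
      ... | inj₁ (j , ≉0) with dichotomy (elimination A i j) es u′
      ... | inj₁ cert = inj₁ (step j ≉0 cert)
      ... | inj₂ (c , supp , rel , f , cf≉0) = inj₂
        ( lift-relation el c
        , (λ e e∉ → trans (lift-other el c (e∉ ∘ here))
            (trans (*-congˡ (supp e (e∉ ∘ there))) (zeroʳ _)))
        , (λ k → trans (comb-lift el c k) (rel k))
        , f , λ lift≈0 → cf≉0 (cancel ≉0 (c f) (trans (sym (lift-other el c f≢i)) lift≈0)))
        where
        el : IsElim A i j (elimination A i j)
        el _ _ = refl
        f≢i : f ≢ i
        f≢i f≡i = cf≉0 (supp f (≡.subst (_∉ es) (≡.sym f≡i) (∉-head u)))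

      independent⇒certificate : ∀ {m} {A : Matrix m Col} {es} → Unique es → Independent A es → Certificate A es
      independent⇒certificate {A = A} {es} u ind with dichotomy A es u
      ... | inj₁ cert = cert
      ... | inj₂ rel  = ⊥-elim (relation⇒dependent rel ind)

      independent-pivot : ∀ {m} {A : Matrix m Col} {i es} → Independent A (i ∷ es) → ∃[ j ] ¬ A i j ≈ 0#
      independent-pivot {A = A} {i} {es} ind with pivot? search A i
      ... | inj₁ p    = p
      ... | inj₂ Ai≈0 = ⊥-elim (relation⇒dependent {es = i ∷ es} (zero-row-relation Ai≈0) ind)

      -- Contraction of `i` costs an independent set at most one row. If a relation `c` appears on
      -- `es` after elimination, a row `f` in its support is given up: another relation on the rest
      -- could be combined with `c` so that row `i` disappears, against the independence of `es`.
      exchange : ∀ {m} {A : Matrix m Col} {i j es} → ¬ A i j ≈ 0# → Unique es → Independent A es →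
        ∃[ fs ] (Unique fs × i ∉ fs × (∀ {e} → e ∈ fs → e ∈ es) × length es ℕ.≤ suc (length fs)
               × Independent (elimination A i j) fs)
      exchange {A = A} {i} {j} {es} ≉0 u ind with Any.any? (i Fin.≟_) es
      ... | yes i∈es = rest , unique , x∉rest , rest⊆ , ℕ.≤-reflexive shorter
          , indep-unelim {A = A} (λ _ _ → refl) (cancel ≉0) x∉rest
              (indep-⊆ (λ { (inj₁ ≡.refl) → i∈es ; (inj₂ e∈) → rest⊆ e∈ }) ind)
        where open Removal (remove i∈es u)
      ... | no i∉es with dichotomy (elimination A i j) es u
      ... | inj₁ cert = es , u , i∉es , (λ e∈ → e∈) , ℕ.n≤1+n _ , certificate⇒independent cert
      ... | inj₂ (c , supp , rel , f , cf≉0) = rest , unique , (i∉es ∘ rest⊆) , rest⊆ , ℕ.≤-reflexive shorter , ind′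
        where
        f∈es : f ∈ es
        f∈es = decidable-stable (Any.any? (f Fin.≟_) es) λ f∉ → cf≉0 (supp f f∉)
        open Removal (remove f∈es u)
        el : IsElim A i j (elimination A i j)
        el _ _ = refl
        c̃ = lift-relation el c
        c̃f≉0 : ¬ c̃ f ≈ 0#
        c̃f≉0 c̃f≈0 = cf≉0 (cancel ≉0 (c f) (trans (sym (lift-other el c f≢i)) c̃f≈0))
          where
          f≢i : f ≢ i
          f≢i f≡i = i∉es (≡.subst (_∈ es) f≡i f∈es)
        s = - comb c A j
        ind′ : Independent (elimination A i j) rest
        ind′ d d-supp d-rel e with e Fin.≟ i
        ... | yes ≡.refl = d-supp e (i∉es ∘ rest⊆)
        ... | no e≢i     = cancel ≉0 (d e) (trans (sym (lift-other el d e≢i)) (d̃≈0 e))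
          where
          d̃ = lift-relation el d
          t = - comb d A j
          comb-d̃ : ∀ k → comb d̃ A k ≈ 0#
          comb-d̃ k = trans (comb-lift el d k) (d-rel k)
          d̃-other : ∀ {e} → e ∉ rest → e ≢ i → d̃ e ≈ 0#
          d̃-other e∉ e≢i = trans (lift-other el d e≢i) (trans (*-congˡ (d-supp _ e∉)) (zeroʳ _))
          d̃-same : d̃ i ≈ t
          d̃-same = lift-same el d (d-supp i (i∉es ∘ rest⊆))
          c̃-same : c̃ i ≈ s
          c̃-same = lift-same el c (supp i i∉es)
          c̃-other : ∀ {e} → e ∉ es → e ≢ i → c̃ e ≈ 0#
          c̃-other e∉ e≢i = trans (lift-other el c e≢i) (trans (*-congˡ (supp _ e∉)) (zeroʳ _))
          -- The combination of the two lifted relations whose coefficient at row i vanishes.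
          g : Fin _ → Carrier
          g e = s * d̃ e + (- t) * c̃ e
          comb-g : ∀ k → comb g A k ≈ 0#
          comb-g k = begin
            comb g A k
              ≈⟨ sum-linear (λ e → g e * A e k) (λ e → d̃ e * A e k) (λ e → c̃ e * A e k) s (- t)
                   (λ e → trans (distribʳ _ _ _) (+-cong (*-assoc _ _ _) (*-assoc _ _ _))) ⟩
            s * comb d̃ A k + (- t) * comb c̃ A k
              ≈⟨ +-cong (*-congˡ (comb-d̃ k)) (*-congˡ (trans (comb-lift el c k) (rel k))) ⟩
            s * 0# + (- t) * 0#
              ≈⟨ +-cong (zeroʳ _) (zeroʳ _) ⟩
            0# + 0#
              ≈⟨ +-identityˡ _ ⟩
            0# ∎
          g-supp : ∀ e → e ∉ es → g e ≈ 0#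
          g-supp e e∉ with e Fin.≟ i
          ... | yes ≡.refl = begin
            s * d̃ e + (- t) * c̃ e  ≈⟨ +-cong (*-congˡ d̃-same) (*-congˡ c̃-same) ⟩
            s * t + (- t) * s      ≈⟨ +-cong (*-comm _ _) (sym (-‿distribˡ-* _ _)) ⟩
            t * s - t * s          ≈⟨ -‿inverseʳ _ ⟩
            0#                     ∎
          ... | no e≢i = trans
            (+-cong (trans (*-congˡ (d̃-other (e∉ ∘ rest⊆) e≢i)) (zeroʳ _)) (trans (*-congˡ (c̃-other e∉ e≢i)) (zeroʳ _)))
            (+-identityˡ _)
          -- Since `f` is not in `rest`, only the term with `c̃ f` survives in `g f`. As `c̃ f` is
          -- nonzero, `t` vanishes, and `d̃` becomes a relation supported on `es`.
          t≈0 : t ≈ 0#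
          t≈0 = cancel c̃f≉0 t (begin
            c̃ f * t                 ≈⟨ *-comm _ _ ⟩
            t * c̃ f                 ≈⟨ sym (-‿involutive _) ⟩
            - - (t * c̃ f)           ≈⟨ -‿cong (-‿distribˡ-* _ _) ⟩
            - ((- t) * c̃ f)         ≈⟨ -‿cong (sym (+-identityˡ _)) ⟩
            - (0# + (- t) * c̃ f)    ≈⟨ -‿cong (+-congʳ (sym (trans (*-congˡ d̃f≈0) (zeroʳ _)))) ⟩
            - g f                   ≈⟨ -‿cong (ind g g-supp comb-g f) ⟩
            - 0#                    ≈⟨ -0#≈0# ⟩
            0#                      ∎)
            where
            d̃f≈0 : d̃ f ≈ 0#
            d̃f≈0 = d̃-other x∉rest λ f≡i → i∉es (≡.subst (_∈ es) f≡i f∈es)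
          d̃-supp : ∀ e → e ∉ es → d̃ e ≈ 0#
          d̃-supp e e∉ with e Fin.≟ i
          ... | yes ≡.refl = trans d̃-same t≈0
          ... | no e≢i     = d̃-other (e∉ ∘ rest⊆) e≢i
          d̃≈0 : ∀ e → d̃ e ≈ 0#
          d̃≈0 = ind d̃ d̃-supp comb-d̃

      -- Induction by contracting the head of `is`: the first set loses one row and the second at
      -- most one, so the strict inequality of lengths survives.
      augment : ∀ {m} (A : Matrix m Col) is js → Unique is → Independent A is → Unique js → Independent A js →
        length is ℕ.< length js → ∃[ e ] (e ∈ js × e ∉ is × Independent A (e ∷ is))
      augment A [] (e ∷ js) _ _ _ ind-js _ =
        e , here ≡.refl , (λ ()) , indep-⊆ (λ { (here e≡) → here e≡ }) ind-js
      augment A (i ∷ is) js u@(_ ∷ u′) ind-is u-js ind-js lt =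
        let j , ≉0 = independent-pivot ind-is
            fs , u-fs , i∉fs , fs⊆ , len , ind-fs = exchange ≉0 u-js ind-js
            e , e∈fs , e∉is , ind = augment (elimination A i j) is fs u′
              (indep-unelim {A = A} (λ _ _ → refl) (cancel ≉0) (∉-head u) (indep-⊆ join-∈ ind-is))
              u-fs ind-fs (ℕ.≤-pred (ℕ.≤-trans lt len))
        in e , fs⊆ e∈fs
         , (λ { (here e≡i) → i∉fs (≡.subst (_∈ fs) e≡i e∈fs) ; (there e∈is) → e∉is e∈is })
         , indep-⊆ (λ { (here e≡) → inj₂ (here e≡) ; (there (here e≡i)) → inj₁ e≡i ; (there (there e∈)) → inj₂ (there e∈) })
             (indep-elim {A = A} {i = i} {j} (λ _ _ → refl) (cancel ≉0) ind)

    Fin-searchable : ∀ {k} → Searchable (Fin k)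
    Fin-searchable P? = Fin.any? P?

    -- After elimination the pivot column is zero in every row and can be deleted, so each
    -- independent row uses up one column.
    rows≤columns : ∀ {m} k (A : Matrix m (Fin k)) es → Unique es → Independent A es → length es ℕ.≤ k
    rows≤columns k A [] _ _ = z≤n
    rows≤columns zero A (i ∷ es) _ ind with () ← proj₁ (independent-pivot Fin-searchable ind)
    rows≤columns (suc k) A (i ∷ es) u@(_ ∷ u′) ind =
      let j , ≉0 = independent-pivot Fin-searchable ind
      in s≤s (rows≤columns k (λ e l → elimination A i j e (punchIn j l)) es u′ λ c supp rel →
        indep-unelim {A = A} (λ _ _ → refl) (cancel ≉0) (∉-head u) (indep-⊆ join-∈ ind) c supp
          (λ l → other-columns c rel l (j Fin.≟ l)))
      where
      other-columns : ∀ {j} c → (∀ l → comb c (λ e l → elimination A i j e (punchIn j l)) l ≈ 0#) →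
        ∀ l → Dec (j ≡ l) → comb c (elimination A i j) l ≈ 0#
      other-columns c rel l (yes ≡.refl) =
        sum-zero {f = λ e → c e * elimination A i l e l} λ e →
          trans (*-congˡ (trans (+-congʳ (*-comm (A i l) (A e l))) (-‿inverseʳ _))) (zeroʳ (c e))
      other-columns {j} c rel l (no j≢l) =
        ≡.subst (λ l → comb c (elimination A i j) l ≈ 0#) (Fin.punchIn-punchOut j≢l) (rel (punchOut j≢l))

-- Polynomials

infixl 6 _⊕_
infixl 7 _⊗_
infix  8 ⊖_

_⊕_ : ∀ {m} → Poly m → Poly m → Poly m
_⊕_ {zero}  p q = p ℚ.+ q
_⊕_ {suc m} [] Q = Q
_⊕_ {suc m} (c ∷ P) [] = c ∷ P
_⊕_ {suc m} (c ∷ P) (d ∷ Q) = (c ⊕ d) ∷ (_⊕_ {suc m} P Q)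

constant : ∀ {m} → ℚ → Poly m
constant {zero}  q = q
constant {suc m} q = constant q ∷ []

variable′ : ∀ {m} → Fin m → Poly m
variable′ zero    = constant 0ℚ ∷ constant 1ℚ ∷ []
variable′ (suc i) = variable′ i ∷ []

⊖_ : ∀ {m} → Poly m → Poly m
⊖_ {zero}  p = ℚ.- p
⊖_ {suc m} [] = []
⊖_ {suc m} (c ∷ P) = (⊖ c) ∷ (⊖_ {suc m} P)

mutual

  _⊗_ : ∀ {m} → Poly m → Poly m → Poly m
  _⊗_ {zero}  p q = p ℚ.* q
  _⊗_ {suc m} [] Q = []
  _⊗_ {suc m} (c ∷ P) Q = _⊕_ {suc m} (scale c Q) (constant 0ℚ ∷ (_⊗_ {suc m} P Q))

  scale : ∀ {m} → Poly m → List (Poly m) → List (Poly m)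
  scale c []      = []
  scale c (d ∷ Q) = (c ⊗ d) ∷ scale c Q

-- Evaluation is described by its defining equations, so that the homomorphism laws are proved once
-- for rational and for real points.
record Evaluation (R : CommutativeRing 0ℓ 0ℓ) : Set₁ where
  open CommutativeRing R
  field
    κ    : ℚ → Carrier
    κ-0  : κ 0ℚ ≈ 0#
    κ-1  : κ 1ℚ ≈ 1#
    κ-+  : ∀ p q → κ (p ℚ.+ q) ≈ κ p + κ q
    κ-*  : ∀ p q → κ (p ℚ.* q) ≈ κ p * κ q
    κ-‿  : ∀ p → κ (ℚ.- p) ≈ - κ p
    ev   : ∀ {m} → Poly m → Vec Carrier m → Carrier
    ev-0 : ∀ q → ev {0} q [] ≈ κ q
    ev-[] : ∀ {m x} {xs : Vec Carrier m} → ev {suc m} [] (x ∷ xs) ≈ 0#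
    ev-∷  : ∀ {m} c P x (xs : Vec Carrier m) → ev {suc m} (c ∷ P) (x ∷ xs) ≈ ev c xs + x * ev {suc m} P (x ∷ xs)

module EvaluationProperties {R : CommutativeRing 0ℓ 0ℓ} (E : Evaluation R) where
  open CommutativeRing R hiding (zero)
  open Evaluation E
  open RingProperties ring using (-‿distribʳ-*; -0#≈0#; -‿+-comm)
  open import Relation.Binary.Reasoning.Setoid setoid

  private
    rearrange : ∀ a b x r s → (a + b) + x * (r + s) ≈ (a + x * r) + (b + x * s)
    rearrange a b x r s = begin
      (a + b) + x * (r + s)        ≈⟨ +-congˡ (distribˡ _ _ _) ⟩
      (a + b) + (x * r + x * s)    ≈⟨ +-assoc _ _ _ ⟩
      a + (b + (x * r + x * s))    ≈⟨ +-congˡ (trans (sym (+-assoc _ _ _)) (trans (+-congʳ (+-comm _ _)) (+-assoc _ _ _))) ⟩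
      a + (x * r + (b + x * s))    ≈⟨ sym (+-assoc _ _ _) ⟩
      (a + x * r) + (b + x * s)    ∎

    swap : ∀ x y z → x * (y * z) ≈ y * (x * z)
    swap x y z = trans (sym (*-assoc x y z)) (trans (*-congʳ (*-comm x y)) (*-assoc y x z))

  ev-zero : ∀ {m} (P : Poly m) xs → ¬ Nonzero m P → ev P xs ≈ 0#
  ev-zero {zero} q [] q≡0 = trans (ev-0 q) (trans (reflexive (≡.cong κ (decidable-stable (q ℚ.≟ 0ℚ) q≡0))) κ-0)
  ev-zero {suc m} [] (x ∷ xs) _ = ev-[]
  ev-zero {suc m} (c ∷ P) (x ∷ xs) z = begin
    ev {suc m} (c ∷ P) (x ∷ xs)           ≈⟨ ev-∷ c P x xs ⟩
    ev c xs + x * ev {suc m} P (x ∷ xs)   ≈⟨ +-cong (ev-zero c xs (z ∘ here)) (trans (*-congˡ (ev-zero {suc m} P (x ∷ xs) (z ∘ there))) (zeroʳ _)) ⟩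
    0# + 0#                               ≈⟨ +-identityˡ _ ⟩
    0#                                    ∎

  ev-constant : ∀ {m} q (xs : Vec Carrier m) → ev (constant {m} q) xs ≈ κ q
  ev-constant {zero} q [] = ev-0 q
  ev-constant {suc m} q (x ∷ xs) = begin
    ev {suc m} (constant q ∷ []) (x ∷ xs)                     ≈⟨ ev-∷ (constant q) [] x xs ⟩
    ev (constant {m} q) xs + x * ev {suc m} [] (x ∷ xs)       ≈⟨ +-cong (ev-constant q xs) (trans (*-congˡ ev-[]) (zeroʳ _)) ⟩
    κ q + 0#                                                  ≈⟨ +-identityʳ _ ⟩
    κ q                                                       ∎

  ev-variable : ∀ {m} (i : Fin m) xs → ev (variable′ i) xs ≈ Vec.lookup xs i
  ev-variable {suc m} zero (x ∷ xs) = begin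
    ev {suc m} (constant 0ℚ ∷ constant 1ℚ ∷ []) (x ∷ xs)
      ≈⟨ ev-∷ (constant 0ℚ) (constant 1ℚ ∷ []) x xs ⟩
    ev (constant {m} 0ℚ) xs + x * ev {suc m} (constant 1ℚ ∷ []) (x ∷ xs)
      ≈⟨ +-cong (trans (ev-constant 0ℚ xs) κ-0) (*-congˡ (trans (ev-constant {suc m} 1ℚ (x ∷ xs)) κ-1)) ⟩
    0# + x * 1#
      ≈⟨ trans (+-identityˡ _) (*-identityʳ _) ⟩
    x ∎
  ev-variable {suc m} (suc i) (x ∷ xs) = begin
    ev {suc m} (variable′ i ∷ []) (x ∷ xs)
      ≈⟨ ev-∷ (variable′ i) [] x xs ⟩
    ev (variable′ i) xs + x * ev {suc m} [] (x ∷ xs)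
      ≈⟨ +-cong (ev-variable i xs) (trans (*-congˡ ev-[]) (zeroʳ _)) ⟩
    Vec.lookup xs i + 0#
      ≈⟨ +-identityʳ _ ⟩
    Vec.lookup xs i ∎

  ev-⊕ : ∀ {m} (P Q : Poly m) xs → ev (P ⊕ Q) xs ≈ ev P xs + ev Q xs
  ev-⊕ {zero} p q [] = trans (ev-0 (p ℚ.+ q)) (trans (κ-+ p q) (sym (+-cong (ev-0 p) (ev-0 q))))
  ev-⊕ {suc m} [] Q (x ∷ xs) = sym (trans (+-congʳ ev-[]) (+-identityˡ _))
  ev-⊕ {suc m} (c ∷ P) [] (x ∷ xs) = sym (trans (+-congˡ ev-[]) (+-identityʳ _))
  ev-⊕ {suc m} (c ∷ P) (d ∷ Q) (x ∷ xs) = begin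
    ev {suc m} ((c ⊕ d) ∷ (_⊕_ {suc m} P Q)) (x ∷ xs)
      ≈⟨ ev-∷ (c ⊕ d) (_⊕_ {suc m} P Q) x xs ⟩
    ev (c ⊕ d) xs + x * ev {suc m} (_⊕_ {suc m} P Q) (x ∷ xs)
      ≈⟨ +-cong (ev-⊕ c d xs) (*-congˡ (ev-⊕ {suc m} P Q (x ∷ xs))) ⟩
    (ev c xs + ev d xs) + x * (ev {suc m} P (x ∷ xs) + ev {suc m} Q (x ∷ xs))
      ≈⟨ rearrange _ _ _ _ _ ⟩
    (ev c xs + x * ev {suc m} P (x ∷ xs)) + (ev d xs + x * ev {suc m} Q (x ∷ xs))
      ≈⟨ sym (+-cong (ev-∷ c P x xs) (ev-∷ d Q x xs)) ⟩
    ev {suc m} (c ∷ P) (x ∷ xs) + ev {suc m} (d ∷ Q) (x ∷ xs) ∎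

  ev-⊖ : ∀ {m} (P : Poly m) xs → ev (⊖ P) xs ≈ - ev P xs
  ev-⊖ {zero} p [] = trans (ev-0 (ℚ.- p)) (trans (κ-‿ p) (sym (-‿cong (ev-0 p))))
  ev-⊖ {suc m} [] (x ∷ xs) = trans ev-[] (sym (trans (-‿cong ev-[]) -0#≈0#))
  ev-⊖ {suc m} (c ∷ P) (x ∷ xs) = begin
    ev {suc m} ((⊖ c) ∷ (⊖_ {suc m} P)) (x ∷ xs)
      ≈⟨ ev-∷ (⊖ c) (⊖_ {suc m} P) x xs ⟩
    ev (⊖ c) xs + x * ev {suc m} (⊖_ {suc m} P) (x ∷ xs)
      ≈⟨ +-cong (ev-⊖ c xs) (trans (*-congˡ (ev-⊖ {suc m} P (x ∷ xs))) (sym (-‿distribʳ-* _ _))) ⟩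
    - ev c xs + - (x * ev {suc m} P (x ∷ xs))
      ≈⟨ -‿+-comm _ _ ⟩
    - (ev c xs + x * ev {suc m} P (x ∷ xs))
      ≈⟨ -‿cong (sym (ev-∷ c P x xs)) ⟩
    - ev {suc m} (c ∷ P) (x ∷ xs) ∎

  mutual

    ev-⊗ : ∀ {m} (P Q : Poly m) xs → ev (P ⊗ Q) xs ≈ ev P xs * ev Q xs
    ev-⊗ {zero} p q [] = trans (ev-0 (p ℚ.* q)) (trans (κ-* p q) (sym (*-cong (ev-0 p) (ev-0 q))))
    ev-⊗ {suc m} [] Q (x ∷ xs) = trans ev-[] (sym (trans (*-congʳ ev-[]) (zeroˡ _)))
    ev-⊗ {suc m} (c ∷ P) Q (x ∷ xs) = begin
      ev {suc m} (_⊕_ {suc m} (scale c Q) (constant 0ℚ ∷ (_⊗_ {suc m} P Q))) (x ∷ xs)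
        ≈⟨ ev-⊕ {suc m} (scale c Q) (constant 0ℚ ∷ (_⊗_ {suc m} P Q)) (x ∷ xs) ⟩
      ev {suc m} (scale c Q) (x ∷ xs) + ev {suc m} (constant 0ℚ ∷ (_⊗_ {suc m} P Q)) (x ∷ xs)
        ≈⟨ +-cong (ev-scale c Q x xs) (ev-∷ (constant 0ℚ) (_⊗_ {suc m} P Q) x xs) ⟩
      ev c xs * q + (ev (constant {m} 0ℚ) xs + x * ev {suc m} (_⊗_ {suc m} P Q) (x ∷ xs))
        ≈⟨ +-congˡ (trans (+-congʳ (trans (ev-constant 0ℚ xs) κ-0)) (+-identityˡ _)) ⟩
      ev c xs * q + x * ev {suc m} (_⊗_ {suc m} P Q) (x ∷ xs)
        ≈⟨ +-congˡ (trans (*-congˡ (ev-⊗ {suc m} P Q (x ∷ xs))) (sym (*-assoc _ _ _))) ⟩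
      ev c xs * q + (x * ev {suc m} P (x ∷ xs)) * q
        ≈⟨ sym (distribʳ _ _ _) ⟩
      (ev c xs + x * ev {suc m} P (x ∷ xs)) * q
        ≈⟨ *-congʳ (sym (ev-∷ c P x xs)) ⟩
      ev {suc m} (c ∷ P) (x ∷ xs) * q ∎
      where q = ev {suc m} Q (x ∷ xs)

    ev-scale : ∀ {m} (c : Poly m) (Q : List (Poly m)) x xs →
      ev {suc m} (scale c Q) (x ∷ xs) ≈ ev c xs * ev {suc m} Q (x ∷ xs)
    ev-scale c [] x xs = trans ev-[] (sym (trans (*-congˡ ev-[]) (zeroʳ _)))
    ev-scale {m} c (d ∷ Q) x xs = begin
      ev {suc m} ((c ⊗ d) ∷ scale c Q) (x ∷ xs)
        ≈⟨ ev-∷ (c ⊗ d) (scale c Q) x xs ⟩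
      ev (c ⊗ d) xs + x * ev {suc m} (scale c Q) (x ∷ xs)
        ≈⟨ +-cong (ev-⊗ c d xs) (trans (*-congˡ (ev-scale c Q x xs)) (swap _ _ _)) ⟩
      ev c xs * ev d xs + ev c xs * (x * ev {suc m} Q (x ∷ xs))
        ≈⟨ sym (distribˡ _ _ _) ⟩
      ev c xs * (ev d xs + x * ev {suc m} Q (x ∷ xs))
        ≈⟨ *-congˡ (sym (ev-∷ d Q x xs)) ⟩
      ev c xs * ev {suc m} (d ∷ Q) (x ∷ xs) ∎

evalℚ : ∀ {m} → Poly m → Vec ℚ m → ℚ
evalℚ q []       = q
evalℚ P (x ∷ xs) = List.foldr (λ c r → evalℚ c xs ℚ.+ x ℚ.* r) 0ℚ P

ℚ-evaluation : Evaluation ℚ.+-*-commutativeRing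
ℚ-evaluation = record
  { κ = λ q → q ; κ-0 = ≡.refl ; κ-1 = ≡.refl ; κ-+ = λ _ _ → ≡.refl ; κ-* = λ _ _ → ≡.refl
  ; κ-‿ = λ _ → ≡.refl ; ev = evalℚ ; ev-0 = λ _ → ≡.refl ; ev-[] = ≡.refl ; ev-∷ = λ _ _ _ _ → ≡.refl }

opaque
  unfolding plus

  eval-∷ : ∀ {m} c (P : Poly (suc m)) x (xs : Vec ℝ m) →
    eval {suc m} (c ∷ P) (x ∷ xs) Defs.≈ plus (eval c xs) (times x (eval {suc m} P (x ∷ xs)))
  eval-∷ {m} c P x xs =
    pointwise⇒≈ (eval {suc m} (c ∷ P) (x ∷ xs)) (eval c xs Defs.+ x Defs.* eval {suc m} P (x ∷ xs)) λ _ → ≡.refl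

  fromℚ-+ : ∀ p q → fromℚ (p ℚ.+ q) Defs.≈ plus (fromℚ p) (fromℚ q)
  fromℚ-+ p q = pointwise⇒≈ (fromℚ (p ℚ.+ q)) (fromℚ p Defs.+ fromℚ q) λ _ → ≡.refl

  fromℚ-* : ∀ p q → fromℚ (p ℚ.* q) Defs.≈ times (fromℚ p) (fromℚ q)
  fromℚ-* p q = pointwise⇒≈ (fromℚ (p ℚ.* q)) (fromℚ p Defs.* fromℚ q) λ _ → ≡.refl

  fromℚ-neg : ∀ p → fromℚ (ℚ.- p) Defs.≈ negate (fromℚ p)
  fromℚ-neg p = pointwise⇒≈ (fromℚ (ℚ.- p)) (Defs.- fromℚ p) λ _ → ≡.refl

ℝ-evaluation : Evaluation ℝ-commutativeRing
ℝ-evaluation = record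
  { κ = fromℚ ; κ-0 = refl {0ℝ} ; κ-1 = refl {fromℚ 1ℚ} ; κ-+ = fromℚ-+ ; κ-* = fromℚ-* ; κ-‿ = fromℚ-neg
  ; ev = eval ; ev-0 = λ q → refl {fromℚ q} ; ev-[] = refl {0ℝ}
  ; ev-∷ = eval-∷ }
  where open CommutativeRing ℝ-commutativeRing using (refl)

nonzero? : ∀ {m} (P : Poly m) → Dec (Nonzero m P)
nonzero? {zero}  q = ¬? (q ℚ.≟ 0ℚ)
nonzero? {suc m} P = Any.any? nonzero? P

-- In Horner form the value is `e + x * f x`. If the tail `f` has a nonzero coefficient, it is
-- bounded away from zero for large `x`, and then `x * f x` outweighs `e`. This finds nonroots
-- without degrees or a count of roots.
bounded-away : ∀ {m} (P : List (Poly m)) xs → Any (λ c → evalℚ c xs ≢ 0ℚ) P →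
  ∃[ N ] ∃[ d ] (0ℚ ℚ.< d × 0ℚ ℚ.≤ N × (∀ x → N ℚ.≤ x → d ℚ.≤ ℚ.∣ evalℚ {suc m} P (x ∷ xs) ∣))
bounded-away {m} (c ∷ P) xs nz = by-cases (Any.any? (λ c → ¬? (evalℚ c xs ℚ.≟ 0ℚ)) P) nz
  where
  open ℚ.≤-Reasoning
  e = evalℚ c xs
  f : ℚ → ℚ
  f x = evalℚ {suc m} P (x ∷ xs)
  Goal : Set
  Goal = ∃[ N ] ∃[ d ] (0ℚ ℚ.< d × 0ℚ ℚ.≤ N × (∀ x → N ℚ.≤ x → d ℚ.≤ ℚ.∣ e ℚ.+ x ℚ.* f x ∣))
  f≡0 : ∀ {P} → ¬ Any (λ c → evalℚ c xs ≢ 0ℚ) P → ∀ x → evalℚ {suc m} P (x ∷ xs) ≡ 0ℚ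
  f≡0 {[]} _ x = ≡.refl
  f≡0 {c ∷ P} none x = ≡.trans
    (≡.cong₂ (λ a b → a ℚ.+ x ℚ.* b) (decidable-stable (evalℚ c xs ℚ.≟ 0ℚ) (none ∘ here)) (f≡0 {P} (none ∘ there) x))
    (≡.trans (≡.cong (0ℚ ℚ.+_) (ℚ.*-zeroʳ x)) (ℚ.+-identityˡ 0ℚ))
  0<∣e∣ : e ≢ 0ℚ → 0ℚ ℚ.< ℚ.∣ e ∣
  0<∣e∣ e≢0 = ℚ.≰⇒> λ ∣e∣≤0 → e≢0 (ℚ.∣p∣≡0⇒p≡0 e (ℚ.≤-antisym ∣e∣≤0 (ℚ.0≤∣p∣ e)))
  by-cases : Dec (Any (λ c → evalℚ c xs ≢ 0ℚ) P) → Any (λ c → evalℚ c xs ≢ 0ℚ) (c ∷ P) → Goal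
  by-cases (no none) (there any) = ⊥-elim (none any)
  by-cases (no none) (here e≢0) = 0ℚ , ℚ.∣ e ∣ , 0<∣e∣ e≢0 , ℚ.≤-refl , λ x _ → ℚ.≤-reflexive (≡.cong ℚ.∣_∣ (≡.sym
    (≡.trans (≡.cong (λ t → e ℚ.+ x ℚ.* t) (f≡0 none x)) (≡.trans (≡.cong (e ℚ.+_) (ℚ.*-zeroʳ x)) (ℚ.+-identityʳ e)))))
  by-cases (yes any) _ = extend (bounded-away P xs any)
    where
    extend : ∃[ N ] ∃[ d ] (0ℚ ℚ.< d × 0ℚ ℚ.≤ N × (∀ x → N ℚ.≤ x → d ℚ.≤ ℚ.∣ f x ∣)) → Goal
    extend (N , d , 0<d , 0≤N , away) = N ℚ.+ r , d , 0<d , 0≤M , bound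
      where
      0≤q : 0ℚ ℚ.≤ ℚ.∣ e ∣ ℚ.+ d
      0≤q = ℚ.+-mono-≤ (ℚ.0≤∣p∣ e) (ℚ.<⇒≤ 0<d)
      instance
        _ = ℚ.positive 0<d
        _ = ℚ.nonNegative (ℚ.<⇒≤ 0<d)
        _ = ℚ.pos⇒nonZero d
        _ = ℚ.1/pos⇒pos d
        _ = ℚ.pos⇒nonNeg (ℚ.1/ d)
      -- From `r` on, the term `x * f x` has absolute value at least `|e| + d`, so `d` remains after
      -- the constant term is taken off.
      r = (ℚ.∣ e ∣ ℚ.+ d) ℚ.* ℚ.1/ d
      rd≡ : r ℚ.* d ≡ ℚ.∣ e ∣ ℚ.+ d
      rd≡ = ≡.trans (ℚ.*-assoc (ℚ.∣ e ∣ ℚ.+ d) (ℚ.1/ d) d)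
        (≡.trans (≡.cong ((ℚ.∣ e ∣ ℚ.+ d) ℚ.*_) (ℚ.*-inverseˡ d)) (ℚ.*-identityʳ _))
      0≤r : 0ℚ ℚ.≤ r
      0≤r = ≡.subst (ℚ._≤ r) (ℚ.*-zeroˡ (ℚ.1/ d)) (ℚ.*-monoʳ-≤-nonNeg (ℚ.1/ d) 0≤q)
      0≤M : 0ℚ ℚ.≤ N ℚ.+ r
      0≤M = ℚ.+-mono-≤ 0≤N 0≤r
      N≤M : N ℚ.≤ N ℚ.+ r
      N≤M = ≡.subst (ℚ._≤ N ℚ.+ r) (ℚ.+-identityʳ N) (ℚ.+-monoʳ-≤ N 0≤r)
      r≤M : r ℚ.≤ N ℚ.+ r
      r≤M = ≡.subst (ℚ._≤ N ℚ.+ r) (ℚ.+-identityˡ r) (ℚ.+-monoˡ-≤ r 0≤N)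
      bound : ∀ x → N ℚ.+ r ℚ.≤ x → d ℚ.≤ ℚ.∣ e ℚ.+ x ℚ.* f x ∣
      bound x M≤x = ℚ.≤-trans (ℚ.≤-reflexive (≡.sym (isolate ℚ.∣ e ∣ d)))
        (ℚ.≤-trans (ℚ.+-monoˡ-≤ (ℚ.- ℚ.∣ e ∣) large) (ℚ.≤-trans (ℚ.+-monoˡ-≤ (ℚ.- ℚ.∣ e ∣) triangle) (ℚ.≤-reflexive (drop ℚ.∣ e ∣ _))))
        where
        isolate : ∀ a d → (a ℚ.+ d) ℚ.- a ≡ d
        isolate = solve-∀ ℚ-ring
        drop : ∀ a t → (t ℚ.+ a) ℚ.- a ≡ t
        drop = solve-∀ ℚ-ring
        undo : ∀ a b → b ≡ (a ℚ.+ b) ℚ.+ ℚ.- a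
        undo = solve-∀ ℚ-ring
        0≤x : 0ℚ ℚ.≤ x
        0≤x = ℚ.≤-trans 0≤M M≤x
        large : ℚ.∣ e ∣ ℚ.+ d ℚ.≤ ℚ.∣ x ℚ.* f x ∣
        large = begin
          ℚ.∣ e ∣ ℚ.+ d            ≡⟨ ≡.sym rd≡ ⟩
          r ℚ.* d                  ≤⟨ ℚ.*-monoʳ-≤-nonNeg d (ℚ.≤-trans r≤M M≤x) ⟩
          x ℚ.* d                  ≤⟨ ℚ.*-monoˡ-≤-nonNeg x {{ℚ.nonNegative 0≤x}} (away x (ℚ.≤-trans N≤M M≤x)) ⟩
          x ℚ.* ℚ.∣ f x ∣          ≡⟨ ≡.cong (ℚ._* ℚ.∣ f x ∣) (≡.sym (ℚ.0≤p⇒∣p∣≡p 0≤x)) ⟩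
          ℚ.∣ x ∣ ℚ.* ℚ.∣ f x ∣    ≡⟨ ≡.sym (ℚ.∣p*q∣≡∣p∣*∣q∣ x (f x)) ⟩
          ℚ.∣ x ℚ.* f x ∣          ∎
        triangle : ℚ.∣ x ℚ.* f x ∣ ℚ.≤ ℚ.∣ e ℚ.+ x ℚ.* f x ∣ ℚ.+ ℚ.∣ e ∣
        triangle = begin
          ℚ.∣ x ℚ.* f x ∣                             ≡⟨ ≡.cong ℚ.∣_∣ (undo e (x ℚ.* f x)) ⟩
          ℚ.∣ (e ℚ.+ x ℚ.* f x) ℚ.+ ℚ.- e ∣           ≤⟨ ℚ.∣p+q∣≤∣p∣+∣q∣ (e ℚ.+ x ℚ.* f x) (ℚ.- e) ⟩
          ℚ.∣ e ℚ.+ x ℚ.* f x ∣ ℚ.+ ℚ.∣ ℚ.- e ∣       ≡⟨ ≡.cong (ℚ.∣ e ℚ.+ x ℚ.* f x ∣ ℚ.+_) (ℚ.∣-p∣≡∣p∣ e) ⟩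
          ℚ.∣ e ℚ.+ x ℚ.* f x ∣ ℚ.+ ℚ.∣ e ∣           ∎

away⇒nonzero : ∀ {d q} → 0ℚ ℚ.< d → d ℚ.≤ ℚ.∣ q ∣ → q ≢ 0ℚ
away⇒nonzero 0<d d≤ ≡.refl = ℚ.<-irrefl ≡.refl (ℚ.<-≤-trans 0<d d≤)

locate : ∀ {A : Set} {P : A → Set} {xs} → Any P xs →
  ∃[ x ] ((∀ (Q : A → Set) → Q x → Any Q xs) × P x)
locate (here px) = _ , (λ Q → here) , px
locate (there any) = let x , at , px = locate any in x , (λ Q → there ∘ at Q) , px

-- One nonzero coefficient of each polynomial is kept nonzero at a common point by induction, and
-- the outermost variable is then taken large enough for both. Treating two polynomials together is
-- what makes products of nonzero polynomials nonzero.
common-nonroot : ∀ {m} (P Q : Poly m) → Nonzero m P → Nonzero m Q →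
  ∃[ xs ] (evalℚ P xs ≢ 0ℚ × evalℚ Q xs ≢ 0ℚ)
common-nonroot {zero} p q p≢0 q≢0 = [] , p≢0 , q≢0
common-nonroot {suc m} P Q P≢0 Q≢0 =
  let c , c∈P , c≢0 = locate P≢0
      d , d∈Q , d≢0 = locate Q≢0
      xs , c≢ , d≢ = common-nonroot c d c≢0 d≢0
      M , δ₁ , 0<δ₁ , 0≤M , P-away = bounded-away P xs (c∈P (λ c → evalℚ c xs ≢ 0ℚ) c≢)
      N , δ₂ , 0<δ₂ , 0≤N , Q-away = bounded-away Q xs (d∈Q (λ c → evalℚ c xs ≢ 0ℚ) d≢)
      x = M ℚ.⊔ N
  in x ∷ xs , away⇒nonzero 0<δ₁ (P-away x (ℚ.p≤p⊔q M N)) , away⇒nonzero 0<δ₂ (Q-away x (ℚ.p≤q⊔p M N))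

module ℚEval = EvaluationProperties ℚ-evaluation

ℚ-cancel : ∀ {p} → p ≢ 0ℚ → ∀ q → p ℚ.* q ≡ 0ℚ → q ≡ 0ℚ
ℚ-cancel {p} p≢0 q pq≡0 = ≡.trans (≡.sym (ℚ.*-identityˡ q)) (≡.trans (≡.cong (ℚ._* q) (≡.sym (ℚ.*-inverseˡ p)))
  (≡.trans (ℚ.*-assoc (ℚ.1/ p) p q) (≡.trans (≡.cong (ℚ.1/ p ℚ.*_) pq≡0) (ℚ.*-zeroʳ (ℚ.1/ p)))))
  where instance _ = ℚ.≢-nonZero p≢0

module ℝLinear = Linear ℝ-commutativeRing

#⇒regular : ∀ x → x # 0ℝ → ℝLinear.Regular x
#⇒regular x x#0 y xy≈0 = #0⇒cancel x x#0 y (≡.subst (Defs._≈ 0ℝ) (times≡ x y) xy≈0)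

module ℚLinear = Linear ℚ.+-*-commutativeRing
module ℚDomain = ℚLinear.Domain (λ q → q ℚ.≟ 0ℚ) ℚ-cancel (λ ())

-- Polynomials as an integral domain

infix 4 _≋_

-- Coefficient lists may end in zeros, so equality is taken as functions on rational points;
-- `nonzero⇒≉0` shows that no nonzero polynomial is identified with zero.
_≋_ : ∀ {m} → Poly m → Poly m → Set
P ≋ Q = ∀ xs → evalℚ P xs ≡ evalℚ Q xs

Poly-rawRing : ℕ → RawRing 0ℓ 0ℓ
Poly-rawRing m = record
  { Carrier = Poly m ; _≈_ = _≋_ ; _+_ = _⊕_ ; _*_ = _⊗_ ; -_ = ⊖_ ; 0# = constant 0ℚ ; 1# = constant 1ℚ }

-- The ring laws are pulled back from the pointwise ring of functions ℚᵐ → ℚ.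
Poly-commutativeRing : ℕ → CommutativeRing 0ℓ 0ℓ
Poly-commutativeRing m = record
  { RawRing (Poly-rawRing m)
  ; isCommutativeRing = RingMonomorphism.isCommutativeRing evaluation (CommutativeRing.isCommutativeRing functions) }
  where
  open ℚEval
  functions : CommutativeRing 0ℓ 0ℓ
  functions = Pointwise.commutativeRing (Vec ℚ m) ℚ.+-*-commutativeRing
  evaluation : IsRingMonomorphism (Poly-rawRing m) (CommutativeRing.rawRing functions) evalℚ
  evaluation = record
    { isRingHomomorphism = record
      { isSemiringHomomorphism = record
        { isNearSemiringHomomorphism = record
          { +-isMonoidHomomorphism = record
            { isMagmaHomomorphism = record { isRelHomomorphism = record { cong = λ p → p } ; homo = ev-⊕ }
            ; ε-homo = ev-constant 0ℚ }
          ; *-homo = ev-⊗ }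
        ; 1#-homo = ev-constant 1ℚ }
      ; -‿homo = ev-⊖ }
    ; injective = λ p → p }

nonzero⇒≉0 : ∀ {m} {P : Poly m} → Nonzero m P → ¬ P ≋ constant 0ℚ
nonzero⇒≉0 {P = P} nz P≋0 =
  let xs , P≢0 , _ = common-nonroot P P nz nz in P≢0 (≡.trans (P≋0 xs) (ℚEval.ev-constant 0ℚ xs))

≉0⇒nonzero : ∀ {m} {P : Poly m} → ¬ P ≋ constant 0ℚ → Nonzero m P
≉0⇒nonzero {P = P} P≉0 = decidable-stable (nonzero? P) λ z →
  P≉0 λ xs → ≡.trans (ℚEval.ev-zero P xs z) (≡.sym (ℚEval.ev-constant 0ℚ xs))

nonroot⇒nonzero : ∀ {m} (P : Poly m) xs → evalℚ P xs ≢ 0ℚ → Nonzero m P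
nonroot⇒nonzero P xs P≢0 = decidable-stable (nonzero? P) λ z → P≢0 (ℚEval.ev-zero P xs z)

*-nonzeroℚ : ∀ {p q} → p ≢ 0ℚ → q ≢ 0ℚ → p ℚ.* q ≢ 0ℚ
*-nonzeroℚ {q = q} p≢0 q≢0 pq≡0 = q≢0 (ℚ-cancel p≢0 q pq≡0)

⊗-nonzero : ∀ {m} {P Q : Poly m} → Nonzero m P → Nonzero m Q → Nonzero m (P ⊗ Q)
⊗-nonzero {P = P} {Q} p q =
  let xs , P≢0 , Q≢0 = common-nonroot P Q p q
  in nonroot⇒nonzero (P ⊗ Q) xs (λ PQ≡0 → *-nonzeroℚ P≢0 Q≢0 (≡.trans (≡.sym (ℚEval.ev-⊗ P Q xs)) PQ≡0))

⊗-nonroot : ∀ {m} (P Q : Poly m) xs → evalℚ (P ⊗ Q) xs ≢ 0ℚ → evalℚ P xs ≢ 0ℚ × evalℚ Q xs ≢ 0ℚ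
⊗-nonroot P Q xs PQ≢0 =
    (λ P≡0 → PQ≢0 (≡.trans (ℚEval.ev-⊗ P Q xs) (≡.trans (≡.cong (ℚ._* evalℚ Q xs) P≡0) (ℚ.*-zeroˡ (evalℚ Q xs)))))
  , (λ Q≡0 → PQ≢0 (≡.trans (ℚEval.ev-⊗ P Q xs) (≡.trans (≡.cong (evalℚ P xs ℚ.*_) Q≡0) (ℚ.*-zeroʳ (evalℚ P xs)))))

Poly-≟0 : ∀ {m} (P : Poly m) → Dec (P ≋ constant 0ℚ)
Poly-≟0 P with nonzero? P
... | yes nz = no (nonzero⇒≉0 {P = P} nz)
... | no z   = yes λ xs → ≡.trans (ℚEval.ev-zero P xs z) (≡.sym (ℚEval.ev-constant 0ℚ xs))

Poly-cancel : ∀ {m} {P : Poly m} → ¬ P ≋ constant 0ℚ → ∀ Q → P ⊗ Q ≋ constant 0ℚ → Q ≋ constant 0ℚ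
Poly-cancel {P = P} P≉0 Q PQ≋0 = decidable-stable (Poly-≟0 Q) λ Q≉0 →
  nonzero⇒≉0 {P = P ⊗ Q} (⊗-nonzero {P = P} {Q} (≉0⇒nonzero {P = P} P≉0) (≉0⇒nonzero {P = Q} Q≉0)) PQ≋0

1ℚ≢0ℚ : 1ℚ ≢ 0ℚ
1ℚ≢0ℚ ()

Poly-1≉0 : ∀ {m} → ¬ constant {m} 1ℚ ≋ constant 0ℚ
Poly-1≉0 {m} = nonzero⇒≉0 {P = constant {m} 1ℚ} (nonroot⇒nonzero (constant {m} 1ℚ) (Vec.replicate m 0ℚ)
  λ 1≡0 → 1ℚ≢0ℚ (≡.trans (≡.sym (ℚEval.ev-constant {m} 1ℚ (Vec.replicate m 0ℚ))) 1≡0))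

module PolyLinear (m : ℕ) where
  open Linear (Poly-commutativeRing m) public
  open Domain Poly-≟0 (λ {P} → Poly-cancel {P = P}) (Poly-1≉0 {m}) public

-- Transfer of independence between polynomial, rational and real matrices

module _ {m : ℕ} where

  open PolyLinear m using (Matrix; Certificate; []; step; Relation; elimination)

  Pivots : ∀ {r Col} {A : Matrix r Col} {es} → (Poly m → Set) → Certificate A es → Set
  Pivots Q [] = ⊤
  Pivots {A = A} Q (step {i} j ≉0 cert) = Q (A i j) × Pivots Q cert

  module Specialise {R : CommutativeRing 0ℓ 0ℓ} (E : Evaluation R) (xs : Vec (CommutativeRing.Carrier R) m) where

    open CommutativeRing R hiding (zero)
    open Evaluation E
    open EvaluationProperties E
    module L = Linear R
    module P = PolyLinear m

    at : ∀ {r Col} → Matrix r Col → L.Matrix r Col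
    at A e j = ev (A e j) xs

    at-elimination : ∀ {r Col} (A : Matrix r Col) i j → L.IsElim (at A) i j (at (elimination A i j))
    at-elimination A i j e k = trans (ev-⊕ (A i j ⊗ A e k) (⊖ (A e j ⊗ A i k)) xs)
      (+-cong (ev-⊗ (A i j) (A e k) xs) (trans (ev-⊖ (A e j ⊗ A i k) xs) (-‿cong (ev-⊗ (A e j) (A i k) xs))))

    certificate⇒independent : ∀ {r Col} {A : Matrix r Col} {es} (cert : Certificate A es) →
      Pivots (λ a → L.Regular (ev a xs)) cert → L.Independent (at A) es
    certificate⇒independent {A = A} [] _ = L.independent-[] (at A)
    certificate⇒independent {A = A} (step {i} j ≉0 cert) (reg , regs) = L.indep-⊆ L.split-∈
      (L.indep-elim {A = at A} {i = i} {j} (at-elimination A i j) reg (certificate⇒independent cert regs))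

    ev-sum : ∀ {r} (f : Fin r → Poly m) → ev (P.sum f) xs ≈ L.sum (λ e → ev (f e) xs)
    ev-sum {zero}  f = trans (ev-constant 0ℚ xs) κ-0
    ev-sum {suc r} f = trans (ev-⊕ (f zero) (P.sum (f ∘ suc)) xs) (+-congˡ (ev-sum (f ∘ suc)))

    ev-≋0 : ∀ {p : Poly m} → p ≋ constant 0ℚ → ev p xs ≈ 0#
    ev-≋0 {p} p≋0 = ev-zero p xs λ nz → nonzero⇒≉0 {P = p} nz p≋0

    comb-at : ∀ {r Col} {A : Matrix r Col} {c : Fin r → Poly m} {j} → P.comb c A j ≋ constant 0ℚ →
      L.comb (λ e → ev (c e) xs) (at A) j ≈ 0#
    comb-at {A = A} {c} {j} rel = trans
      (L.sum-cong (λ e → ev (c e) xs * at A e j) (λ e → ev (c e ⊗ A e j) xs) (λ e → sym (ev-⊗ (c e) (A e j) xs)))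
      (trans (sym (ev-sum (λ e → c e ⊗ A e j))) (ev-≋0 {P.comb c A j} rel))

  atℚ : ∀ {r Col} → Matrix r Col → Vec ℚ m → ℚLinear.Matrix r Col
  atℚ A xs e j = evalℚ (A e j) xs

  -- Gathers all pivots into one polynomial, so that a single nonroot keeps the whole elimination
  -- valid.
  pivot-product : ∀ {r Col} {A : Matrix r Col} {es} → Certificate A es → Poly m
  pivot-product [] = constant 1ℚ
  pivot-product {A = A} (step {i} j ≉0 cert) = A i j ⊗ pivot-product cert

  pivot-product-nonzero : ∀ {r Col} {A : Matrix r Col} {es} (cert : Certificate A es) →
    Nonzero m (pivot-product cert)
  pivot-product-nonzero [] = ≉0⇒nonzero {P = constant {m} 1ℚ} (Poly-1≉0 {m})
  pivot-product-nonzero {A = A} (step {i} j ≉0 cert) =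
    ⊗-nonzero {P = A i j} {pivot-product cert} (≉0⇒nonzero {P = A i j} ≉0) (pivot-product-nonzero cert)

  certificate⇒independentℚ : ∀ {r Col} {A : Matrix r Col} {es} (cert : Certificate A es) xs →
    evalℚ (pivot-product cert) xs ≢ 0ℚ → ℚLinear.Independent (atℚ A xs) es
  certificate⇒independentℚ cert xs nonroot =
    Specialise.certificate⇒independent ℚ-evaluation xs cert (pivots cert nonroot)
    where
    pivots : ∀ {r Col} {A : Matrix r Col} {es} (cert : Certificate A es) →
      evalℚ (pivot-product cert) xs ≢ 0ℚ → Pivots (λ a → ℚLinear.Regular (evalℚ a xs)) cert
    pivots [] _ = tt
    pivots {A = A} (step {i} j ≉0 cert) nonroot =
      let l , r = ⊗-nonroot (A i j) (pivot-product cert) xs nonroot in ℚ-cancel l , pivots cert r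

  -- A nonzero value comes from a nonzero polynomial, so pivots found at the point are pivots over
  -- the polynomials; elimination commutes with evaluation, and the point can be used again for the
  -- next row.
  independentℚ⇒certificate : ∀ {r Col} → Searchable Col → {A : Matrix r Col} → ∀ {es} xs → Unique es →
    ℚLinear.Independent (atℚ A xs) es → Certificate A es
  independentℚ⇒certificate search {A} {[]} xs u ind = []
  independentℚ⇒certificate search {A} {i ∷ es} xs u@(_ ∷ u′) ind =
    let j , ≢0 = ℚDomain.independent-pivot search {A = atℚ A xs} ind
    in step j (nonzero⇒≉0 {P = A i j} (nonroot⇒nonzero (A i j) xs ≢0))
         (independentℚ⇒certificate search xs u′
           (ℚLinear.indep-unelim {A = atℚ A xs} {atℚ (elimination A i j) xs} {i} {j}
             (Specialise.at-elimination ℚ-evaluation xs A i j) (ℚ-cancel ≢0) (∉-head u)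
             (ℚLinear.indep-⊆ {A = atℚ A xs} ℚLinear.join-∈ ind)))

  module _ (xs : Vec ℝ m) (generic : AlgebraicallyIndependent xs) where

    open Specialise ℝ-evaluation xs using () renaming (at to atℝ; module L to ℝL)

    -- Algebraic independence sends each nonzero pivot to a real apart from zero, hence to a regular
    -- one.
    certificate⇒independentℝ : ∀ {r Col} {A : Matrix r Col} {es} → Certificate A es → ℝL.Independent (atℝ A) es
    certificate⇒independentℝ cert = Specialise.certificate⇒independent ℝ-evaluation xs cert (pivots cert)
      where
      pivots : ∀ {r Col} {A : Matrix r Col} {es} (cert : Certificate A es) →
        Pivots (λ a → ℝL.Regular (Evaluation.ev ℝ-evaluation a xs)) cert
      pivots [] = tt
      pivots {A = A} (step {i} j ≉0 cert) =
        #⇒regular (Evaluation.ev ℝ-evaluation (A i j) xs) (generic (A i j) (≉0⇒nonzero {P = A i j} ≉0)) , pivots cert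

    -- Evaluating the relation gives real coefficients, one of which is apart from zero because it
    -- is the value of a nonzero polynomial at a generic point.
    relation⇒dependentℝ : ∀ {r Col} {A : Matrix r Col} {es} → Relation A es → ¬ ℝL.Independent (atℝ A) es
    relation⇒dependentℝ {A = A} (c , supp , rel , e , ce≉0) ind =
      #⇒≉ (eval (c e) xs) (generic (c e) (≉0⇒nonzero {P = c e} ce≉0))
        (ind (λ e → eval (c e) xs) (λ e e∉ → Specialise.ev-≋0 ℝ-evaluation xs {c e} (supp e e∉))
          (λ j → Specialise.comb-at ℝ-evaluation xs {A = A} {c} {j} (rel j)) e)

-- The cofactor matrix over polynomials

opaque
  unfolding plus

  negate≈ : ∀ x → negate x Defs.≈ Defs.- x
  negate≈ x = pointwise⇒≈ (negate x) (Defs.- x) λ _ → ≡.refl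

  D-xx : ∀ a b → times (plus (proj₁ a) (negate (proj₁ b))) (plus (proj₁ a) (negate (proj₁ b))) Defs.≈ D a b zero
  D-xx a b = pointwise⇒≈ (times (plus (proj₁ a) (negate (proj₁ b))) (plus (proj₁ a) (negate (proj₁ b)))) (D a b zero) λ _ → ≡.refl

  D-xy : ∀ a b → times (plus (proj₁ a) (negate (proj₁ b))) (plus (proj₂ a) (negate (proj₂ b))) Defs.≈ D a b (suc zero)
  D-xy a b = pointwise⇒≈ (times (plus (proj₁ a) (negate (proj₁ b))) (plus (proj₂ a) (negate (proj₂ b)))) (D a b (suc zero)) λ _ → ≡.refl

  D-yy : ∀ a b → times (plus (proj₂ a) (negate (proj₂ b))) (plus (proj₂ a) (negate (proj₂ b))) Defs.≈ D a b (suc (suc zero))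
  D-yy a b = pointwise⇒≈ (times (plus (proj₂ a) (negate (proj₂ b))) (plus (proj₂ a) (negate (proj₂ b)))) (D a b (suc (suc zero))) λ _ → ≡.refl

module _ {n : ℕ} where

  data Joins (e : Fin (∣EK∣ n)) (u v : Fin n) : Set where
    forward  : ends n e ≡ (u , v) → Joins e u v
    backward : ends n e ≡ (v , u) → Joins e u v

  joins-sym : ∀ {e u v} → Joins e u v → Joins e v u
  joins-sym (forward p)  = backward p
  joins-sym (backward p) = forward p

  joins-ends : ∀ e → Joins e (proj₁ (ends n e)) (proj₂ (ends n e))
  joins-ends e = forward ≡.refl

  ends-< : ∀ e → proj₁ (ends n e) Fin.< proj₂ (ends n e)
  ends-< e = proj₂ (List.∈-filter⁻ {P = λ e → proj₁ e Fin.< proj₂ e} (λ (i , j) → i Fin.<? j) {xs = List.cartesianProduct (allFin n) (allFin n)}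
    (List.∈-lookup {xs = edgesK n} e))

  joins⇒≢ : ∀ {e u v} → Joins e u v → u ≢ v
  joins⇒≢ {e} (forward p) ≡.refl = Fin.<-irrefl (≡.cong proj₁ p′) (ends-< e)
    where p′ = ≡.trans (≡.cong (λ q → proj₁ q , proj₁ q) p) (≡.cong (λ q → proj₂ q , proj₂ q) (≡.sym p))
  joins⇒≢ {e} (backward p) ≡.refl = joins⇒≢ {e} (forward p) ≡.refl

  private
    ordered-edge : ∀ {u v} → u Fin.< v → ∃[ e ] ends n e ≡ (u , v)
    ordered-edge {u} {v} u<v = Any.index uv∈ , ≡.sym (lookup-index uv∈)
      where
      uv∈ : (u , v) ∈ edgesK n
      uv∈ = List.∈-filter⁺ {P = λ e → proj₁ e Fin.< proj₂ e} (λ (i , j) → i Fin.<? j) (List.∈-cartesianProduct⁺ (List.∈-allFin u) (List.∈-allFin v)) u<v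

  edge-between : ∀ {u v} → u ≢ v → ∃[ e ] Joins e u v
  edge-between {u} {v} u≢v with Fin.<-cmp u v
  ... | tri< u<v _ _ = let e , p = ordered-edge u<v in e , forward p
  ... | tri≈ _ u≡v _ = ⊥-elim (u≢v u≡v)
  ... | tri> _ _ v<u = let e , p = ordered-edge v<u in e , backward p

  joins-other : ∀ {e u v w x} → Joins e u v → Joins e w x → (u ≡ w × v ≡ x) ⊎ (u ≡ x × v ≡ w)
  joins-other (forward p) (forward q) = let r = ≡.trans (≡.sym p) q in inj₁ (≡.cong proj₁ r , ≡.cong proj₂ r)
  joins-other (forward p) (backward q) = let r = ≡.trans (≡.sym p) q in inj₂ (≡.cong proj₁ r , ≡.cong proj₂ r)
  joins-other (backward p) (forward q) = let r = ≡.trans (≡.sym p) q in inj₂ (≡.cong proj₂ r , ≡.cong proj₁ r)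
  joins-other (backward p) (backward q) = let r = ≡.trans (≡.sym p) q in inj₁ (≡.cong proj₂ r , ≡.cong proj₁ r)

  joins? : ∀ e u v → Dec (Joins e u v)
  joins? e u v with Product.≡-dec Fin._≟_ Fin._≟_ (ends n e) (u , v) | Product.≡-dec Fin._≟_ Fin._≟_ (ends n e) (v , u)
  ... | yes p | _     = yes (forward p)
  ... | no _  | yes q = yes (backward q)
  ... | no ¬p | no ¬q = no λ { (forward p) → ¬p p ; (backward q) → ¬q q }

  X Y : Fin n → Poly (n ℕ.+ n)
  X v = variable′ (v ↑ˡ n)
  Y v = variable′ (n ↑ʳ v)

  dX dY : Fin n → Fin n → Poly (n ℕ.+ n)
  dX u v = X u ⊕ ⊖ X v
  dY u v = Y u ⊕ ⊖ Y v

  symbolicD : Fin n → Fin n → Fin 3 → Poly (n ℕ.+ n)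
  symbolicD u v zero             = dX u v ⊗ dX u v
  symbolicD u v (suc zero)       = dX u v ⊗ dY u v
  symbolicD u v (suc (suc zero)) = dY u v ⊗ dY u v

  symbolicMatrix : Fin (∣EK∣ n) → Fin n × Fin 3 → Poly (n ℕ.+ n)
  symbolicMatrix e (v , t) with ends n e
  ... | i , j with v Fin.≟ i | v Fin.≟ j
  ...   | yes _ | _     = symbolicD i j t
  ...   | no _  | yes _ = ⊖ symbolicD i j t
  ...   | no _  | no _  = constant 0ℚ

  coordinates : ∀ {A : Set} → (Fin n → A × A) → Vec A (n ℕ.+ n)
  coordinates p = Vec.tabulate (λ i → proj₁ (p i)) Vec.++ Vec.tabulate (λ i → proj₂ (p i))

  lookup-x : ∀ {A : Set} (p : Fin n → A × A) v → Vec.lookup (coordinates p) (v ↑ˡ n) ≡ proj₁ (p v)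
  lookup-x p v = ≡.trans (Vec.lookup-++ˡ (Vec.tabulate (proj₁ ∘ p)) (Vec.tabulate (proj₂ ∘ p)) v)
    (Vec.lookup∘tabulate (proj₁ ∘ p) v)

  lookup-y : ∀ {A : Set} (p : Fin n → A × A) v → Vec.lookup (coordinates p) (n ↑ʳ v) ≡ proj₂ (p v)
  lookup-y p v = ≡.trans (Vec.lookup-++ʳ (Vec.tabulate (proj₁ ∘ p)) (Vec.tabulate (proj₂ ∘ p)) v)
    (Vec.lookup∘tabulate (proj₂ ∘ p) v)

  module EvaluateD {R : CommutativeRing 0ℓ 0ℓ} (E : Evaluation R) (xs : Vec (CommutativeRing.Carrier R) (n ℕ.+ n)) where
    open CommutativeRing R hiding (zero)
    open Evaluation E
    open EvaluationProperties E

    x y : Fin n → Carrier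
    x v = Vec.lookup xs (v ↑ˡ n)
    y v = Vec.lookup xs (n ↑ʳ v)

    dx dy : Fin n → Fin n → Carrier
    dx u v = x u - x v
    dy u v = y u - y v

    ev-dX : ∀ u v → ev (dX u v) xs ≈ dx u v
    ev-dX u v = trans (ev-⊕ (X u) (⊖ X v) xs)
      (+-cong (ev-variable (u ↑ˡ n) xs) (trans (ev-⊖ (X v) xs) (-‿cong (ev-variable (v ↑ˡ n) xs))))

    ev-dY : ∀ u v → ev (dY u v) xs ≈ dy u v
    ev-dY u v = trans (ev-⊕ (Y u) (⊖ Y v) xs)
      (+-cong (ev-variable (n ↑ʳ u) xs) (trans (ev-⊖ (Y v) xs) (-‿cong (ev-variable (n ↑ʳ v) xs))))

    quadratic : Fin n → Fin n → Fin 3 → Carrier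
    quadratic u v zero             = dx u v * dx u v
    quadratic u v (suc zero)       = dx u v * dy u v
    quadratic u v (suc (suc zero)) = dy u v * dy u v

    ev-D : ∀ u v t → ev (symbolicD u v t) xs ≈ quadratic u v t
    ev-D u v zero             = trans (ev-⊗ (dX u v) (dX u v) xs) (*-cong (ev-dX u v) (ev-dX u v))
    ev-D u v (suc zero)       = trans (ev-⊗ (dX u v) (dY u v) xs) (*-cong (ev-dX u v) (ev-dY u v))
    ev-D u v (suc (suc zero)) = trans (ev-⊗ (dY u v) (dY u v) xs) (*-cong (ev-dY u v) (ev-dY u v))

  module _ (p : Points n) where

    private
      module ℝEval = EvaluationProperties ℝ-evaluation
      open EvaluateD ℝ-evaluation (coordinates p)
      open CommutativeRing ℝ-commutativeRing using (_≈_; setoid; -‿cong)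
      open Evaluation ℝ-evaluation using (ev)
      open import Relation.Binary.Reasoning.Setoid setoid

      dx≡ : ∀ u v → dx u v ≡ plus (proj₁ (p u)) (negate (proj₁ (p v)))
      dx≡ u v = ≡.cong₂ (λ a b → plus a (negate b)) (lookup-x p u) (lookup-x p v)

      dy≡ : ∀ u v → dy u v ≡ plus (proj₂ (p u)) (negate (proj₂ (p v)))
      dy≡ u v = ≡.cong₂ (λ a b → plus a (negate b)) (lookup-y p u) (lookup-y p v)

      D≈ : ∀ u v t → ev (symbolicD u v t) (coordinates p) ≈ D (p u) (p v) t
      D≈ u v zero = begin
        ev (symbolicD u v zero) (coordinates p)    ≈⟨ ev-D u v zero ⟩
        quadratic u v zero                         ≡⟨ ≡.cong₂ times (dx≡ u v) (dx≡ u v) ⟩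
        times (plus (proj₁ (p u)) (negate (proj₁ (p v)))) (plus (proj₁ (p u)) (negate (proj₁ (p v))))
                                                   ≈⟨ D-xx (p u) (p v) ⟩
        D (p u) (p v) zero                         ∎
      D≈ u v (suc zero) = begin
        ev (symbolicD u v (suc zero)) (coordinates p)    ≈⟨ ev-D u v (suc zero) ⟩
        quadratic u v (suc zero)                         ≡⟨ ≡.cong₂ times (dx≡ u v) (dy≡ u v) ⟩
        times (plus (proj₁ (p u)) (negate (proj₁ (p v)))) (plus (proj₂ (p u)) (negate (proj₂ (p v))))
                                                         ≈⟨ D-xy (p u) (p v) ⟩
        D (p u) (p v) (suc zero)                         ∎
      D≈ u v (suc (suc zero)) = begin
        ev (symbolicD u v (suc (suc zero))) (coordinates p)  ≈⟨ ev-D u v (suc (suc zero)) ⟩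
        quadratic u v (suc (suc zero))                       ≡⟨ ≡.cong₂ times (dy≡ u v) (dy≡ u v) ⟩
        times (plus (proj₂ (p u)) (negate (proj₂ (p v)))) (plus (proj₂ (p u)) (negate (proj₂ (p v))))
                                                             ≈⟨ D-yy (p u) (p v) ⟩
        D (p u) (p v) (suc (suc zero))                       ∎

      -D≈ : ∀ u v t → ev (⊖ symbolicD u v t) (coordinates p) ≈ Defs.- D (p u) (p v) t
      -D≈ u v t = begin
        ev (⊖ symbolicD u v t) (coordinates p)    ≈⟨ ℝEval.ev-⊖ (symbolicD u v t) (coordinates p) ⟩
        negate (ev (symbolicD u v t) (coordinates p))  ≈⟨ -‿cong (D≈ u v t) ⟩
        negate (D (p u) (p v) t)                  ≈⟨ negate≈ (D (p u) (p v) t) ⟩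
        Defs.- D (p u) (p v) t                    ∎

    cofactorMatrix≈ : ∀ e j → ev (symbolicMatrix e j) (coordinates p) ≈ cofactorMatrix p e j
    cofactorMatrix≈ e (v , t) with ends n e
    ... | i , j with v Fin.≟ i | v Fin.≟ j
    ...   | yes _ | _     = D≈ i j t
    ...   | no _  | yes _ = -D≈ i j t
    ...   | no _  | no _  = ℝEval.ev-constant 0ℚ (coordinates p)

-- 0- and 1-extensions at a rational point

open import Data.Rational using (_+_; _*_; -_; _-_; _≤_; _<_)
open ≡ using (refl; sym; trans; cong; cong₂; subst; subst₂; _≗_)

cross : ℚ × ℚ → ℚ × ℚ → ℚ
cross (x , y) (x′ , y′) = x * y′ - x′ * y

cross-antisym : ∀ p q → cross p q ≢ 0ℚ → cross q p ≢ 0ℚ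
cross-antisym (x , y) (x′ , y′) ≢0 ≡0 = ≢0 (trans (swap x y x′ y′) (cong -_ ≡0))
  where
  swap : ∀ x y x′ y′ → x * y′ - x′ * y ≡ - (x′ * y - x * y′)
  swap = solve-∀ ℚ-ring

veronese : ℚ × ℚ → Fin 3 → ℚ
veronese (x , y) zero             = x * x
veronese (x , y) (suc zero)       = x * y
veronese (x , y) (suc (suc zero)) = y * y

-- The quadratic form cross _ q₂ * cross _ q₃ vanishes at q₂ and q₃.
veronese-independent : ∀ α β γ q₁ q₂ q₃ → cross q₁ q₂ ≢ 0ℚ → cross q₁ q₃ ≢ 0ℚ →
  (∀ t → α * veronese q₁ t + (β * veronese q₂ t + γ * veronese q₃ t) ≡ 0ℚ) → α ≡ 0ℚ
veronese-independent α β γ (x₁ , y₁) (x₂ , y₂) (x₃ , y₃) c₁₂ c₁₃ rel =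
  ℚ-cancel c₁₂ α (ℚ-cancel c₁₃ _ (trans (form α β γ x₁ y₁ x₂ y₂ x₃ y₃)
    (trans (cong₂ _+_ (cong (y₂ * y₃ *_) (rel zero))
      (cong₂ _+_ (cong ((- (x₂ * y₃ + x₃ * y₂)) *_) (rel (suc zero))) (cong (x₂ * x₃ *_) (rel (suc (suc zero))))))
      (zeros (y₂ * y₃) (- (x₂ * y₃ + x₃ * y₂)) (x₂ * x₃)))))
  where
  zeros : ∀ a b c → a * 0ℚ + (b * 0ℚ + c * 0ℚ) ≡ 0ℚ
  zeros a b c = trans (cong₂ _+_ (ℚ.*-zeroʳ a) (cong₂ _+_ (ℚ.*-zeroʳ b) (ℚ.*-zeroʳ c))) refl
  form : ∀ α β γ x₁ y₁ x₂ y₂ x₃ y₃ →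
    (x₁ * y₃ - x₃ * y₁) * ((x₁ * y₂ - x₂ * y₁) * α) ≡
    y₂ * y₃ * (α * (x₁ * x₁) + (β * (x₂ * x₂) + γ * (x₃ * x₃)))
    + ((- (x₂ * y₃ + x₃ * y₂)) * (α * (x₁ * y₁) + (β * (x₂ * y₂) + γ * (x₃ * y₃)))
    + x₂ * x₃ * (α * (y₁ * y₁) + (β * (y₂ * y₂) + γ * (y₃ * y₃))))
  form = solve-∀ ℚ-ring

module AtPoint {n : ℕ} (xs : Vec ℚ (n ℕ.+ n)) where

  open EvaluateD {n} ℚ-evaluation xs using (x; y; dx; dy; quadratic; ev-D)
  open ℚLinear using (Independent; comb; δ; δ-same; δ-diff; sum-δ)

  d : Fin n → Fin n → ℚ × ℚ
  d u v = dx u v , dy u v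

  V : Fin n → Fin n → Fin 3 → ℚ
  V u v = veronese (d u v)

  B : ℚLinear.Matrix (∣EK∣ n) (Fin n × Fin 3)
  B = atℚ symbolicMatrix xs

  symbolicD≡V : ∀ u v t → evalℚ (symbolicD u v t) xs ≡ V u v t
  symbolicD≡V u v zero             = ev-D u v zero
  symbolicD≡V u v (suc zero)       = ev-D u v (suc zero)
  symbolicD≡V u v (suc (suc zero)) = ev-D u v (suc (suc zero))

  private
    swap-both : ∀ a b c d → (a - b) * (c - d) ≡ (b - a) * (d - c)
    swap-both = solve-∀ ℚ-ring

  V-sym : ∀ u v t → V u v t ≡ V v u t
  V-sym u v zero             = swap-both (x u) (x v) (x u) (x v)
  V-sym u v (suc zero)       = swap-both (x u) (x v) (y u) (y v)
  V-sym u v (suc (suc zero)) = swap-both (y u) (y v) (y u) (y v)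

  private
    B-first : ∀ e {i j} → ends n e ≡ (i , j) → ∀ t → B e (i , t) ≡ V i j t
    B-first e {i} {j} eq t with ends n e | eq
    ... | .(i , j) | refl with i Fin.≟ i | i Fin.≟ j
    ...   | yes _ | _   = symbolicD≡V i j t
    ...   | no ≢  | _   = ⊥-elim (≢ refl)

    B-second : ∀ e {i j} → ends n e ≡ (i , j) → i ≢ j → ∀ t → B e (j , t) ≡ - V i j t
    B-second e {i} {j} eq i≢j t with ends n e | eq
    ... | .(i , j) | refl with j Fin.≟ i | j Fin.≟ j
    ...   | yes j≡i | _   = ⊥-elim (i≢j (sym j≡i))
    ...   | no _ | yes _  = trans (ℚEval.ev-⊖ (symbolicD i j t) xs) (cong -_ (symbolicD≡V i j t))
    ...   | no _ | no ≢   = ⊥-elim (≢ refl)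

    B-third : ∀ e {i j} → ends n e ≡ (i , j) → ∀ v → v ≢ i → v ≢ j → ∀ t → B e (v , t) ≡ 0ℚ
    B-third e {i} {j} eq v v≢i v≢j t with ends n e | eq
    ... | .(i , j) | refl with v Fin.≟ i | v Fin.≟ j
    ...   | yes v≡i | _      = ⊥-elim (v≢i v≡i)
    ...   | no _ | yes v≡j   = ⊥-elim (v≢j v≡j)
    ...   | no _ | no _      = ℚEval.ev-constant 0ℚ xs

  -- Edges are stored with the smaller end first, so the edges at `v` occur in both orientations.
  -- The sign `σ` absorbs the orientation, `V` being symmetric.
  record Row (e : Fin (∣EK∣ n)) (u v : Fin n) : Set where
    field
      σ        : ℚ
      σ*σ≡1    : σ * σ ≡ 1ℚ
      at-left  : ∀ t → B e (u , t) ≡ σ * V u v t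
      at-right : ∀ t → B e (v , t) ≡ - (σ * V u v t)
      at-other : ∀ w → w ≢ u → w ≢ v → ∀ t → B e (w , t) ≡ 0ℚ

  row : ∀ {e u v} → Joins e u v → Row e u v
  row {e} {u} {v} (forward p) = record
    { σ = 1ℚ ; σ*σ≡1 = refl
    ; at-left  = λ t → trans (B-first e p t) (sym (ℚ.*-identityˡ (V u v t)))
    ; at-right = λ t → trans (B-second e p (joins⇒≢ (forward p)) t) (cong -_ (sym (ℚ.*-identityˡ (V u v t))))
    ; at-other = λ w w≢u w≢v → B-third e p w w≢u w≢v }
  row {e} {u} {v} (backward p) = record
    { σ = - 1ℚ ; σ*σ≡1 = refl
    ; at-left  = λ t → trans (B-second e p (joins⇒≢ (forward p)) t)
        (trans (cong -_ (V-sym v u t)) (neg (V u v t)))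
    ; at-right = λ t → trans (B-first e p t) (trans (V-sym v u t) (neg-neg (V u v t)))
    ; at-other = λ w w≢u w≢v → B-third e p w w≢v w≢u }
    where
    neg : ∀ a → - a ≡ - 1ℚ * a
    neg = solve-∀ ℚ-ring
    neg-neg : ∀ a → a ≡ - (- 1ℚ * a)
    neg-neg = solve-∀ ℚ-ring

  σ-cancel : ∀ {e u v} (r : Row e u v) a → a * Row.σ r ≡ 0ℚ → a ≡ 0ℚ
  σ-cancel r a aσ≡0 = trans (sym (ℚ.*-identityʳ a)) (trans (cong (a *_) (sym (Row.σ*σ≡1 r)))
    (trans (sym (ℚ.*-assoc a (Row.σ r) (Row.σ r))) (trans (cong (_* Row.σ r) aσ≡0) (ℚ.*-zeroˡ (Row.σ r)))))

  Avoids : Fin n → List (Fin (∣EK∣ n)) → Set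
  Avoids v J = ∀ {e} → e ∈ J → ∀ {w} → ¬ Joins e v w

  avoids-zero : ∀ {v J} → Avoids v J → ∀ {e} → e ∈ J → ∀ t → B e (v , t) ≡ 0ℚ
  avoids-zero {v} av {e} e∈ t = Row.at-other (row {e} (joins-ends e)) v
    (λ { refl → av e∈ (joins-ends e) }) (λ { refl → av e∈ (joins-sym (joins-ends e)) }) t

  -- The rows of `J` vanish in the three columns of `v`. There a relation on `es` and `J` becomes a
  -- relation among the vectors `V v a` of the star `es` alone.
  module EdgesAt {v : Fin n} (J : List (Fin (∣EK∣ n))) (avoids : Avoids v J) (c : Fin (∣EK∣ n) → ℚ)
    (es : List (Fin (∣EK∣ n))) (unique : Unique es) (supp : ∀ e → e ∉ es → e ∉ J → c e ≡ 0ℚ)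
    (rel : ∀ j → comb c B j ≡ 0ℚ) where

    at-v : ∀ t → ℚLinear.listSum (λ e → c e * B e (v , t)) es ≡ 0ℚ
    at-v t = trans (sym (ℚLinear.sum-support (λ e → c e * B e (v , t)) es unique outside)) (rel (v , t))
      where
      outside : ∀ e → e ∉ es → c e * B e (v , t) ≡ 0ℚ
      outside e e∉ with Any.any? (e Fin.≟_) J
      ... | yes e∈J = trans (cong (c e *_) (avoids-zero avoids e∈J t)) (ℚ.*-zeroʳ (c e))
      ... | no e∉J  = trans (cong (_* B e (v , t)) (supp e e∉ e∉J)) (ℚ.*-zeroˡ (B e (v , t)))

    term : ∀ {e a} (r : Row e v a) t → c e * B e (v , t) ≡ c e * Row.σ r * V v a t
    term {e} r t = trans (cong (c e *_) (Row.at-left r t)) (sym (ℚ.*-assoc (c e) (Row.σ r) _))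

  NonCollinear : Fin n → Fin n → Fin n → Set
  NonCollinear v a b = cross (d v a) (d v b) ≢ 0ℚ

  joins-≢ : ∀ {v a b : Fin n} {e f} → a ≢ b → Joins e v a → Joins f v b → e ≢ f
  joins-≢ {e = e} a≢b ea fb refl with joins-other ea fb
  ... | inj₁ (_ , a≡b)      = a≢b a≡b
  ... | inj₂ (refl , refl)  = joins⇒≢ ea refl

  private
    extend-by : ∀ {J : List (Fin (∣EK∣ n))} es → Independent B J →
      (∀ c → (∀ e → e ∉ es → e ∉ J → c e ≡ 0ℚ) → (∀ j → comb c B j ≡ 0ℚ) → ∀ {e} → e ∈ es → c e ≡ 0ℚ) →
      ∀ c → (∀ e → e ∉ es → e ∉ J → c e ≡ 0ℚ) → (∀ j → comb c B j ≡ 0ℚ) → ∀ e → c e ≡ 0ℚ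
    extend-by es ind star c supp rel = ind c supp′ rel
      where
      supp′ : ∀ e → e ∉ _ → c e ≡ 0ℚ
      supp′ e e∉J with Any.any? (e Fin.≟_) es
      ... | yes e∈es = star c supp rel e∈es
      ... | no e∉es  = supp e e∉es e∉J

  -- Three pairwise non-proportional vectors have linearly independent Veronese images, so the
  -- coefficients of the star vanish and the rest is a relation on `J`.
  extend₃ : ∀ {v a b c ea eb ec J} → Joins ea v a → Joins eb v b → Joins ec v c →
    a ≢ b → a ≢ c → b ≢ c → NonCollinear v a b → NonCollinear v a c → NonCollinear v b c →
    Avoids v J → Independent B J → Independent B (ea ∷ eb ∷ ec ∷ J)
  extend₃ {v} {a} {b} {c} {ea} {eb} {ec} {J} ja jb jc a≢b a≢c b≢c ab ac bc av ind κ supp =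
    extend-by es ind star κ λ e e∉es e∉J → supp e λ
      { (here p) → e∉es (here p) ; (there (here p)) → e∉es (there (here p))
      ; (there (there (here p))) → e∉es (there (there (here p))) ; (there (there (there e∈J))) → e∉J e∈J }
    where
    es = ea ∷ eb ∷ ec ∷ []
    unique : Unique es
    unique = (joins-≢ a≢b ja jb ∷ joins-≢ a≢c ja jc ∷ []) ∷ (joins-≢ b≢c jb jc ∷ []) ∷ [] ∷ []
    ra = row ja
    rb = row jb
    rc = row jc
    star : ∀ κ → (∀ e → e ∉ es → e ∉ J → κ e ≡ 0ℚ) → (∀ j → comb κ B j ≡ 0ℚ) → ∀ {e} → e ∈ es → κ e ≡ 0ℚ
    star κ supp rel = λ
      { (here refl) → σ-cancel ra (κ ea) (veronese-independent α β γ (d v a) (d v b) (d v c) ab ac λ t → trans (abc t) (eq t))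
      ; (there (here refl)) → σ-cancel rb (κ eb) (veronese-independent β α γ (d v b) (d v a) (d v c)
          (cross-antisym (d v a) (d v b) ab) bc λ t → trans (bac t) (eq t))
      ; (there (there (here refl))) → σ-cancel rc (κ ec) (veronese-independent γ α β (d v c) (d v a) (d v b)
          (cross-antisym (d v a) (d v c) ac) (cross-antisym (d v b) (d v c) bc) λ t → trans (cab t) (eq t)) }
      where
      open EdgesAt {v} J av κ es unique supp rel
      α = κ ea * Row.σ ra
      β = κ eb * Row.σ rb
      γ = κ ec * Row.σ rc
      eq : ∀ t → α * V v a t + (β * V v b t + (γ * V v c t + 0ℚ)) ≡ 0ℚ
      eq t = trans (cong₂ _+_ (sym (term ra t)) (cong₂ _+_ (sym (term rb t)) (cong (_+ 0ℚ) (sym (term rc t))))) (at-v t)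
      abc : ∀ t → α * V v a t + (β * V v b t + γ * V v c t) ≡ α * V v a t + (β * V v b t + (γ * V v c t + 0ℚ))
      abc t = cong (λ s → α * V v a t + (β * V v b t + s)) (sym (ℚ.+-identityʳ (γ * V v c t)))
      rotate : ∀ p q r → q + (p + r) ≡ p + (q + r)
      rotate = solve-∀ ℚ-ring
      rotate′ : ∀ p q r → r + (p + q) ≡ p + (q + r)
      rotate′ = solve-∀ ℚ-ring
      bac : ∀ t → β * V v b t + (α * V v a t + γ * V v c t) ≡ α * V v a t + (β * V v b t + (γ * V v c t + 0ℚ))
      bac t = trans (rotate (α * V v a t) (β * V v b t) (γ * V v c t)) (abc t)
      cab : ∀ t → γ * V v c t + (α * V v a t + β * V v b t) ≡ α * V v a t + (β * V v b t + (γ * V v c t + 0ℚ))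
      cab t = trans (rotate′ (α * V v a t) (β * V v b t) (γ * V v c t)) (abc t)

  extend₂ : ∀ {v a b ea eb J} → Joins ea v a → Joins eb v b → a ≢ b → NonCollinear v a b →
    Avoids v J → Independent B J → Independent B (ea ∷ eb ∷ J)
  extend₂ {v} {a} {b} {ea} {eb} {J} ja jb a≢b ab av ind κ supp =
    extend-by es ind star κ λ e e∉es e∉J → supp e λ
      { (here p) → e∉es (here p) ; (there (here p)) → e∉es (there (here p)) ; (there (there e∈J)) → e∉J e∈J }
    where
    es = ea ∷ eb ∷ []
    unique : Unique es
    unique = (joins-≢ a≢b ja jb ∷ []) ∷ [] ∷ []
    ra = row ja
    rb = row jb
    star : ∀ κ → (∀ e → e ∉ es → e ∉ J → κ e ≡ 0ℚ) → (∀ j → comb κ B j ≡ 0ℚ) → ∀ {e} → e ∈ es → κ e ≡ 0ℚ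
    -- The third coefficient is zero, and repeating one of the two directions as the third point
    -- lets the single condition `ab` serve for both nondegeneracy hypotheses.
    star κ supp rel = λ
      { (here refl) → σ-cancel ra (κ ea) (veronese-independent α β 0ℚ (d v a) (d v b) (d v b) ab ab λ t →
          trans (cong (λ s → α * V v a t + (β * V v b t + s)) (ℚ.*-zeroˡ (V v b t))) (eq t))
      ; (there (here refl)) → σ-cancel rb (κ eb) (veronese-independent β α 0ℚ (d v b) (d v a) (d v a)
          (cross-antisym (d v a) (d v b) ab) (cross-antisym (d v a) (d v b) ab) λ t →
          trans (cong (λ s → β * V v b t + (α * V v a t + s)) (ℚ.*-zeroˡ (V v a t)))
            (trans (swap (α * V v a t) (β * V v b t)) (eq t))) }
      where
      open EdgesAt {v} J av κ es unique supp rel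
      α = κ ea * Row.σ ra
      β = κ eb * Row.σ rb
      eq : ∀ t → α * V v a t + (β * V v b t + 0ℚ) ≡ 0ℚ
      eq t = trans (cong₂ _+_ (sym (term ra t)) (cong (_+ 0ℚ) (sym (term rb t)))) (at-v t)
      swap : ∀ p q → q + (p + 0ℚ) ≡ p + (q + 0ℚ)
      swap p q = trans (cong (q +_) (ℚ.+-identityʳ p)) (trans (ℚ.+-comm q p) (cong (p +_) (sym (ℚ.+-identityʳ q))))

  extend₁ : ∀ {v a ea J} → Joins ea v a → dy v a ≢ 0ℚ →
    Avoids v J → Independent B J → Independent B (ea ∷ J)
  extend₁ {v} {a} {ea} {J} ja dy≢0 av ind κ supp =
    extend-by es ind star κ λ e e∉es e∉J → supp e λ { (here p) → e∉es (here p) ; (there e∈J) → e∉J e∈J }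
    where
    es = ea ∷ []
    ra = row ja
    star : ∀ κ → (∀ e → e ∉ es → e ∉ J → κ e ≡ 0ℚ) → (∀ j → comb κ B j ≡ 0ℚ) → ∀ {e} → e ∈ es → κ e ≡ 0ℚ
    star κ supp rel (here refl) = σ-cancel ra (κ ea) (ℚ-cancel dy≢0 α (ℚ-cancel dy≢0 (dy v a * α)
      (trans (reorder (dy v a) α) (trans (sym (ℚ.+-identityʳ _))
        (trans (cong (_+ 0ℚ) (sym (term ra (suc (suc zero))))) (at-v (suc (suc zero))))))))
      where
      open EdgesAt {v} J av κ es ([] ∷ []) supp rel
      α = κ ea * Row.σ ra
      reorder : ∀ y a → y * (y * a) ≡ a * (y * y)
      reorder = solve-∀ ℚ-ring

  -- 1-extension: with v at 2a - b, on the line through a and b, the rows of va and vb are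
  -- parallel at v and combine to the row of ab.
  extend₄ : ∀ {v a b c w ea eb ec ew eab J} → Joins ea v a → Joins eb v b → Joins ec v c → Joins ew v w → Joins eab a b →
    a ≢ c → a ≢ w → b ≢ c → b ≢ w → c ≢ w →
    x v ≡ x a + (x a - x b) → y v ≡ y a + (y a - y b) →
    NonCollinear a b c → NonCollinear a b w → NonCollinear v c w → Unique (eab ∷ J) →
    Avoids v J → Independent B (eab ∷ J) → Independent B (ea ∷ eb ∷ ec ∷ ew ∷ J)
  extend₄ {v} {a} {b} {c} {w} {ea} {eb} {ec} {ew} {eab} {J} ja jb jc jw jab a≢c a≢w b≢c b≢w c≢w xv yv abc abw vcw u av ind κ supp rel =
    κ≈0
    where
    es = ea ∷ eb ∷ ec ∷ ew ∷ []
    a≢b : a ≢ b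
    a≢b = joins⇒≢ jab
    ea≢eb = joins-≢ a≢b ja jb
    unique : Unique es
    unique = (ea≢eb ∷ joins-≢ a≢c ja jc ∷ joins-≢ a≢w ja jw ∷ [])
      ∷ (joins-≢ b≢c jb jc ∷ joins-≢ b≢w jb jw ∷ []) ∷ (joins-≢ c≢w jc jw ∷ []) ∷ [] ∷ []
    ra = row ja
    rb = row jb
    rc = row jc
    rw = row jw
    rab = row jab
    supported : ∀ e → e ∉ es → e ∉ J → κ e ≡ 0ℚ
    supported e e∉es e∉J = supp e λ
      { (here p) → e∉es (here p) ; (there (here p)) → e∉es (there (here p))
      ; (there (there (here p))) → e∉es (there (there (here p)))
      ; (there (there (there (here p)))) → e∉es (there (there (there (here p))))
      ; (there (there (there (there e∈J)))) → e∉J e∈J }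
    open EdgesAt {v} J av κ es unique supported rel
    α = κ ea * Row.σ ra
    β = κ eb * Row.σ rb
    γ = κ ec * Row.σ rc
    η = κ ew * Row.σ rw
    4ℚ : ℚ
    4ℚ = 1ℚ + 1ℚ + (1ℚ + 1ℚ)
    to-a : ∀ p q → p + (p - q) - p ≡ p - q
    to-a = solve-∀ ℚ-ring
    to-b : ∀ p q → p + (p - q) - q ≡ (p - q) + (p - q)
    to-b = solve-∀ ℚ-ring
    dx-va : dx v a ≡ dx a b
    dx-va = trans (cong (_- x a) xv) (to-a (x a) (x b))
    dy-va : dy v a ≡ dy a b
    dy-va = trans (cong (_- y a) yv) (to-a (y a) (y b))
    dx-vb : dx v b ≡ dx a b + dx a b
    dx-vb = trans (cong (_- x b) xv) (to-b (x a) (x b))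
    dy-vb : dy v b ≡ dy a b + dy a b
    dy-vb = trans (cong (_- y b) yv) (to-b (y a) (y b))
    V-va : ∀ t → V v a t ≡ V a b t
    V-va t = cong₂ (λ p q → veronese (p , q) t) dx-va dy-va
    quadruple : ∀ p q → (p + p) * (q + q) ≡ 4ℚ * (p * q)
    quadruple = solve-∀ ℚ-ring
    V-vb : ∀ t → V v b t ≡ 4ℚ * V a b t
    V-vb t = trans (cong₂ (λ p q → veronese (p , q) t) dx-vb dy-vb) (by-t t)
      where
      by-t : ∀ t → veronese (dx a b + dx a b , dy a b + dy a b) t ≡ 4ℚ * V a b t
      by-t zero             = quadruple (dx a b) (dx a b)
      by-t (suc zero)       = quadruple (dx a b) (dy a b)
      by-t (suc (suc zero)) = quadruple (dy a b) (dy a b)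
    -- Since `v` lies on the line `ab`, moving the base point from `a` to `v` does not change the
    -- cross product with `a - b`.
    cross-ab-v : ∀ u → NonCollinear a b u → cross (d a b) (d v u) ≢ 0ℚ
    cross-ab-v u abu = subst (_≢ 0ℚ) (sym eq) abu
      where
      identity : ∀ xa ya xb yb xu yu →
        (xa - xb) * (ya + (ya - yb) - yu) - (xa + (xa - xb) - xu) * (ya - yb) ≡
        (xa - xb) * (ya - yu) - (xa - xu) * (ya - yb)
      identity = solve-∀ ℚ-ring
      eq : cross (d a b) (d v u) ≡ cross (d a b) (d a u)
      eq = trans (cong₂ (λ p q → cross (d a b) (p - x u , q - y u)) xv yv)
        (identity (x a) (y a) (x b) (y b) (x u) (y u))
    -- Here `v - a` equals `a - b` and `v - b` is twice `a - b`; the Veronese map squares the factor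
    -- 2.
    ε = α + 4ℚ * β
    eq : ∀ t → ε * V a b t + (γ * V v c t + η * V v w t) ≡ 0ℚ
    eq t = trans (regroup α β γ η (V a b t) (V v c t) (V v w t))
      (trans (cong₂ (λ p q → α * p + (β * q + (γ * V v c t + (η * V v w t + 0ℚ)))) (sym (V-va t)) (sym (V-vb t)))
      (trans (cong₂ _+_ (sym (term ra t)) (cong₂ _+_ (sym (term rb t)) (cong₂ _+_ (sym (term rc t)) (cong (_+ 0ℚ) (sym (term rw t))))))
        (at-v t)))
      where
      regroup : ∀ α β γ η p q r → (α + 4ℚ * β) * p + (γ * q + η * r) ≡ α * p + (β * (4ℚ * p) + (γ * q + (η * r + 0ℚ)))
      regroup = solve-∀ ℚ-ring
    abc′ = cross-ab-v c abc
    abw′ = cross-ab-v w abw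
    ε≡0 : ε ≡ 0ℚ
    ε≡0 = veronese-independent ε γ η (d a b) (d v c) (d v w) abc′ abw′ eq
    κec≡0 : κ ec ≡ 0ℚ
    κec≡0 = σ-cancel rc (κ ec) (veronese-independent γ ε η (d v c) (d a b) (d v w)
      (cross-antisym (d a b) (d v c) abc′) vcw λ t → trans (rotate (ε * V a b t) (γ * V v c t) (η * V v w t)) (eq t))
      where
      rotate : ∀ p q r → q + (p + r) ≡ p + (q + r)
      rotate = solve-∀ ℚ-ring
    κew≡0 : κ ew ≡ 0ℚ
    κew≡0 = σ-cancel rw (κ ew) (veronese-independent η ε γ (d v w) (d a b) (d v c)
      (cross-antisym (d a b) (d v w) abw′) (cross-antisym (d v c) (d v w) vcw)
      λ t → trans (rotate (ε * V a b t) (γ * V v c t) (η * V v w t)) (eq t))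
      where
      rotate : ∀ p q r → r + (p + q) ≡ p + (q + r)
      rotate = solve-∀ ℚ-ring
    -- As `ε` vanishes, the rows of `va` and `vb` cancel at `v`. What they leave at `a` and `b` is
    -- this multiple of the row of `ab`, the sign of that row being its own inverse.
    τ = 4ℚ * β * Row.σ rab
    v≢a = joins⇒≢ ja
    v≢b = joins⇒≢ jb

    combine : ∀ j → κ ea * B ea j + κ eb * B eb j ≡ τ * B eab j
    combine (z , t) = by-vertex (z Fin.≟ v) (z Fin.≟ a) (z Fin.≟ b)
      where
      σa = Row.σ ra
      σb = Row.σ rb
      σab = Row.σ rab
      val : ∀ {p q r} → B ea (z , t) ≡ p → B eb (z , t) ≡ q → B eab (z , t) ≡ r →
        κ ea * p + κ eb * q ≡ τ * r → κ ea * B ea (z , t) + κ eb * B eb (z , t) ≡ τ * B eab (z , t)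
      val refl refl refl eq = eq
      α≡ : κ ea * σa ≡ - (4ℚ * β)
      α≡ = trans (undo α (4ℚ * β)) (trans (cong (_- 4ℚ * β) ε≡0) (ℚ.+-identityˡ (- (4ℚ * β))))
        where
        undo : ∀ p q → p ≡ p + q - q
        undo = solve-∀ ℚ-ring
      by-vertex : Dec (z ≡ v) → Dec (z ≡ a) → Dec (z ≡ b) → κ ea * B ea (z , t) + κ eb * B eb (z , t) ≡ τ * B eab (z , t)
      by-vertex (yes refl) _ _ = val (trans (Row.at-left ra t) (cong (σa *_) (V-va t)))
        (trans (Row.at-left rb t) (cong (σb *_) (V-vb t))) (Row.at-other rab z v≢a v≢b t)
        (trans (factor (κ ea) σa (κ eb) σb (V a b t)) (trans (cong (_* V a b t) ε≡0) (trans (ℚ.*-zeroˡ (V a b t)) (sym (ℚ.*-zeroʳ τ)))))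
        where
        factor : ∀ k s l r p → k * (s * p) + l * (r * (4ℚ * p)) ≡ (k * s + 4ℚ * (l * r)) * p
        factor = solve-∀ ℚ-ring
      by-vertex (no z≢v) (yes refl) _ = val (trans (Row.at-right ra t) (cong (λ p → - (σa * p)) (V-va t)))
        (Row.at-other rb z (z≢v) a≢b t) (Row.at-left rab t)
        (trans (left (κ ea) σa (κ eb) (V a b t)) (trans (cong (λ p → - (p * V a b t)) α≡) (sym (trans (right 4ℚ β σab (V a b t))
          (trans (cong (λ s → 4ℚ * β * s * V a b t) (Row.σ*σ≡1 rab)) (drop (4ℚ * β) (V a b t)))))))
        where
        left : ∀ k s l p → k * (- (s * p)) + l * 0ℚ ≡ - (k * s * p)
        left = solve-∀ ℚ-ring
        right : ∀ f b s p → f * b * s * (s * p) ≡ f * b * (s * s) * p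
        right = solve-∀ ℚ-ring
        drop : ∀ f p → f * 1ℚ * p ≡ - (- f * p)
        drop = solve-∀ ℚ-ring
      by-vertex (no z≢v) (no z≢a) (yes refl) = val (Row.at-other ra z z≢v z≢a t)
        (trans (Row.at-right rb t) (cong (λ p → - (σb * p)) (V-vb t))) (Row.at-right rab t)
        (trans (left (κ ea) (κ eb) σb (V a b t)) (sym (trans (right 4ℚ β σab (V a b t))
          (trans (cong (λ s → - (4ℚ * β * s * V a b t)) (Row.σ*σ≡1 rab)) (drop (κ eb) σb (V a b t))))))
        where
        left : ∀ k l s p → k * 0ℚ + l * (- (s * (4ℚ * p))) ≡ - (4ℚ * (l * s) * p)
        left = solve-∀ ℚ-ring
        right : ∀ f b s p → f * b * s * (- (s * p)) ≡ - (f * b * (s * s) * p)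
        right = solve-∀ ℚ-ring
        drop : ∀ l s p → - (4ℚ * (l * s) * 1ℚ * p) ≡ - (4ℚ * (l * s) * p)
        drop = solve-∀ ℚ-ring
      by-vertex (no z≢v) (no z≢a) (no z≢b) = val (Row.at-other ra z z≢v z≢a t) (Row.at-other rb z z≢v z≢b t)
        (Row.at-other rab z z≢a z≢b t)
        (trans (cong₂ _+_ (ℚ.*-zeroʳ (κ ea)) (ℚ.*-zeroʳ (κ eb))) (sym (ℚ.*-zeroʳ τ)))

    -- The coefficients of `va` and `vb` are traded for `τ` on `ab`, which gives a relation
    -- supported on `ab` and `J`.
    κ′ : Fin (∣EK∣ n) → ℚ
    κ′ e = κ e + (δ ea e * (- κ ea) + (δ eb e * (- κ eb) + δ eab e * τ))

    comb-κ′ : ∀ j → comb κ′ B j ≡ 0ℚ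
    comb-κ′ j = trans (ℚLinear.sum-cong (λ e → κ′ e * B e j) (λ e → f₁ e + (f₂ e + (f₃ e + f₄ e))) λ e →
        distribute (κ e) (δ ea e) (- κ ea) (δ eb e) (- κ eb) (δ eab e) τ (B e j))
      (trans (ℚLinear.∑-distrib-+ f₁ (λ e → f₂ e + (f₃ e + f₄ e)))
      (trans (cong (ℚLinear.sum f₁ +_) (trans (ℚLinear.∑-distrib-+ f₂ (λ e → f₃ e + f₄ e))
        (cong (ℚLinear.sum f₂ +_) (ℚLinear.∑-distrib-+ f₃ f₄))))
      (trans (cong₂ _+_ (rel j) (cong₂ _+_ (sum-δ ea (λ e → (- κ ea) * B e j)) (cong₂ _+_ (sum-δ eb (λ e → (- κ eb) * B e j)) (sum-δ eab (λ e → τ * B e j)))))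
      (trans (collect (κ ea) (B ea j) (κ eb) (B eb j) (τ * B eab j))
        (trans (cong (λ s → τ * B eab j - s) (combine j)) (ℚ.+-inverseʳ (τ * B eab j)))))))
      where
      f₁ f₂ f₃ f₄ : Fin (∣EK∣ n) → ℚ
      f₁ e = κ e * B e j
      f₂ e = δ ea e * ((- κ ea) * B e j)
      f₃ e = δ eb e * ((- κ eb) * B e j)
      f₄ e = δ eab e * (τ * B e j)
      distribute : ∀ k p a q b r t z → (k + (p * a + (q * b + r * t))) * z ≡ k * z + (p * (a * z) + (q * (b * z) + r * (t * z)))
      distribute = solve-∀ ℚ-ring
      collect : ∀ a p b q r → 0ℚ + (- a * p + (- b * q + r)) ≡ r - (a * p + b * q)
      collect = solve-∀ ℚ-ring

    v∉ab : ∀ {e z} → Joins e v z → eab ≢ e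
    v∉ab je refl with joins-other je jab
    ... | inj₁ (v≡a , _) = v≢a v≡a
    ... | inj₂ (v≡b , _) = v≢b v≡b

    κ′-value : ∀ e {p q r} → δ ea e ≡ p → δ eb e ≡ q → δ eab e ≡ r →
      κ′ e ≡ κ e + (p * (- κ ea) + (q * (- κ eb) + r * τ))
    κ′-value e refl refl refl = refl

    plain : ∀ p a b t → p + (0ℚ * a + (0ℚ * b + 0ℚ * t)) ≡ p
    plain = solve-∀ ℚ-ring

    κ′-other : ∀ e → ea ≢ e → eb ≢ e → eab ≢ e → κ′ e ≡ κ e
    κ′-other e a b c = trans (κ′-value e (δ-diff a) (δ-diff b) (δ-diff c)) (plain (κ e) (- κ ea) (- κ eb) τ)

    κ′-supp : ∀ e → e ∉ eab ∷ J → κ′ e ≡ 0ℚ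
    κ′-supp e e∉ = by-edge (ea Fin.≟ e) (eb Fin.≟ e)
      where
      eab≢e : eab ≢ e
      eab≢e eab≡e = e∉ (here (sym eab≡e))
      by-edge : Dec (ea ≡ e) → Dec (eb ≡ e) → κ′ e ≡ 0ℚ
      by-edge (yes refl) _ = trans (κ′-value ea (δ-same ea) (δ-diff (ea≢eb ∘ sym)) (δ-diff eab≢e)) (vanish (κ ea) (κ eb) τ)
        where
        vanish : ∀ a b t → a + (1ℚ * (- a) + (0ℚ * (- b) + 0ℚ * t)) ≡ 0ℚ
        vanish = solve-∀ ℚ-ring
      by-edge (no _) (yes refl) = trans (κ′-value eb (δ-diff ea≢eb) (δ-same eb) (δ-diff eab≢e)) (vanish (κ eb) (κ ea) τ)
        where
        vanish : ∀ b a t → b + (0ℚ * (- a) + (1ℚ * (- b) + 0ℚ * t)) ≡ 0ℚ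
        vanish = solve-∀ ℚ-ring
      by-edge (no ea≢e) (no eb≢e) = trans (κ′-other e ea≢e eb≢e eab≢e) (by-edge′ (ec Fin.≟ e) (ew Fin.≟ e))
        where
        by-edge′ : Dec (ec ≡ e) → Dec (ew ≡ e) → κ e ≡ 0ℚ
        by-edge′ (yes refl) _ = κec≡0
        by-edge′ (no _) (yes refl) = κew≡0
        by-edge′ (no ec≢e) (no ew≢e) = supp e λ
          { (here p) → ea≢e (sym p) ; (there (here p)) → eb≢e (sym p) ; (there (there (here p))) → ec≢e (sym p)
          ; (there (there (there (here p)))) → ew≢e (sym p) ; (there (there (there (there e∈J)))) → e∉ (there e∈J) }

    κ′≈0 : ∀ e → κ′ e ≡ 0ℚ
    κ′≈0 = ind κ′ κ′-supp comb-κ′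

    eab∉ : eab ∉ ea ∷ eb ∷ ec ∷ ew ∷ J
    eab∉ (here p) = v∉ab ja p
    eab∉ (there (here p)) = v∉ab jb p
    eab∉ (there (there (here p))) = v∉ab jc p
    eab∉ (there (there (there (here p)))) = v∉ab jw p
    eab∉ (there (there (there (there p)))) = ∉-head u p

    τ≡0 : τ ≡ 0ℚ
    τ≡0 = trans (sym (trans (κ′-value eab (δ-diff (v∉ab ja ∘ sym)) (δ-diff (v∉ab jb ∘ sym)) (δ-same eab))
      (trans (cong (_+ (0ℚ * (- κ ea) + (0ℚ * (- κ eb) + 1ℚ * τ))) (supp eab eab∉)) (only (- κ ea) (- κ eb) τ)))) (κ′≈0 eab)
      where
      only : ∀ a b t → 0ℚ + (0ℚ * a + (0ℚ * b + 1ℚ * t)) ≡ t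
      only = solve-∀ ℚ-ring

    β≡0 : β ≡ 0ℚ
    β≡0 = ℚ-cancel {4ℚ} (λ ()) β (σ-cancel rab (4ℚ * β) τ≡0)

    α≡0 : α ≡ 0ℚ
    α≡0 = trans (sym (ℚ.+-identityʳ α)) (trans (cong (α +_) (sym (trans (cong (4ℚ *_) β≡0) (ℚ.*-zeroʳ 4ℚ)))) ε≡0)

    κ≈0 : ∀ e → κ e ≡ 0ℚ
    κ≈0 e = by-edge (ea Fin.≟ e) (eb Fin.≟ e) (eab Fin.≟ e)
      where
      by-edge : Dec (ea ≡ e) → Dec (eb ≡ e) → Dec (eab ≡ e) → κ e ≡ 0ℚ
      by-edge (yes refl) _ _ = σ-cancel ra (κ ea) α≡0
      by-edge (no _) (yes refl) _ = σ-cancel rb (κ eb) β≡0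
      by-edge (no _) (no _) (yes refl) = supp eab eab∉
      by-edge (no p) (no q) (no r) = trans (sym (κ′-other e p q r)) (κ′≈0 e)

-- The rank bound

module RankBound {n : ℕ} (xs : Vec ℚ (n ℕ.+ n)) where

  open AtPoint {n} xs
  open EvaluateD {n} ℚ-evaluation xs using (x; y; dx; dy)
  open ℚLinear using (Independent; comb; sum; sum-cong; sum-zero; sum-linear; sum-support; ∑-comm; *-sum)

  dot : (Fin 3 → ℚ) → (Fin 3 → ℚ) → ℚ
  dot f g = f 0F * g 0F + (f 1F * g 1F + f 2F * g 2F)

  -- The row of `uv` is, up to sign, `V u v` at `u` and its negative at `v`, so this says that `M`
  -- is orthogonal to every row.
  Motion : (Fin n → Fin 3 → ℚ) → Set
  Motion M = ∀ u v → dot (V u v) (M u) ≡ dot (V u v) (M v)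

  dot-zero : ∀ {f} g → (∀ t → f t ≡ 0ℚ) → dot f g ≡ 0ℚ
  dot-zero {f} g f≡0 = trans (cong₂ _+_ (vanish 0F) (cong₂ _+_ (vanish 1F) (vanish 2F))) refl
    where
    vanish : ∀ t → f t * g t ≡ 0ℚ
    vanish t = trans (cong (_* g t) (f≡0 t)) (ℚ.*-zeroˡ (g t))

  dot-congˡ : ∀ {f f′} g → (∀ t → f t ≡ f′ t) → dot f g ≡ dot f′ g
  dot-congˡ g f≡ = cong₂ _+_ (cong (_* g 0F) (f≡ 0F)) (cong₂ _+_ (cong (_* g 1F) (f≡ 1F)) (cong (_* g 2F) (f≡ 2F)))

  module _ (M : Fin n → Fin 3 → ℚ) (motion : Motion M) where

    row-orthogonal : ∀ e → sum (λ w → dot (λ t → B e (w , t)) (M w)) ≡ 0ℚ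
    row-orthogonal e = trans (sum-support (λ w → dot (λ t → B e (w , t)) (M w)) (u ∷ v ∷ []) ((joins⇒≢ j ∷ []) ∷ [] ∷ []) outside)
      (trans (cong₂ (λ p q → p + (q + 0ℚ)) (dot-congˡ (M u) at-left) (dot-congˡ (M v) at-right))
      (trans (factor σ (V u v 0F) (V u v 1F) (V u v 2F) (M u 0F) (M u 1F) (M u 2F) (M v 0F) (M v 1F) (M v 2F))
        (trans (cong (λ p → σ * (p - dot (V u v) (M v))) (motion u v))
          (trans (cong (σ *_) (ℚ.+-inverseʳ (dot (V u v) (M v)))) (ℚ.*-zeroʳ σ)))))
      where
      u = proj₁ (ends n e)
      v = proj₂ (ends n e)
      j : Joins e u v
      j = joins-ends e
      open Row (row j)
      outside : ∀ w → w ∉ u ∷ v ∷ [] → dot (λ t → B e (w , t)) (M w) ≡ 0ℚ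
      outside w w∉ = dot-zero (M w) (at-other w (w∉ ∘ here) (w∉ ∘ there ∘ here))
      factor : ∀ s a b c p q r p′ q′ r′ →
        (s * a * p + (s * b * q + s * c * r)) + (((- (s * a)) * p′ + ((- (s * b)) * q′ + (- (s * c)) * r′)) + 0ℚ) ≡
        s * ((a * p + (b * q + c * r)) - (a * p′ + (b * q′ + c * r′)))
      factor = solve-∀ ℚ-ring

    comb-orthogonal : ∀ κ → sum (λ w → dot (λ t → comb κ B (w , t)) (M w)) ≡ 0ℚ
    comb-orthogonal κ = trans (sum-cong (λ w → dot (λ t → comb κ B (w , t)) (M w)) (λ w → sum (λ e → κ e * dot (λ t → B e (w , t)) (M w))) distribute)
      (trans (∑-comm (λ w e → κ e * dot (λ t → B e (w , t)) (M w)))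
        (sum-zero {f = λ e → sum (λ w → κ e * dot (λ t → B e (w , t)) (M w))} λ e →
          trans (sym (*-sum (κ e) (λ w → dot (λ t → B e (w , t)) (M w))))
            (trans (cong (κ e *_) (row-orthogonal e)) (ℚ.*-zeroʳ (κ e)))))
      where
      distribute : ∀ w → dot (λ t → comb κ B (w , t)) (M w) ≡ sum (λ e → κ e * dot (λ t → B e (w , t)) (M w))
      distribute w = sym (trans (sum-linear (λ e → κ e * dot (λ t → B e (w , t)) (M w))
          (λ e → κ e * B e (w , 0F)) (λ e → κ e * (B e (w , 1F) * M w 1F + B e (w , 2F) * M w 2F)) (M w 0F) 1ℚ
          (λ e → expand (κ e) (B e (w , 0F)) (M w 0F) (B e (w , 1F) * M w 1F + B e (w , 2F) * M w 2F)))
        (trans (cong (λ s → M w 0F * comb κ B (w , 0F) + 1ℚ * s)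
          (sum-linear (λ e → κ e * (B e (w , 1F) * M w 1F + B e (w , 2F) * M w 2F))
            (λ e → κ e * B e (w , 1F)) (λ e → κ e * B e (w , 2F)) (M w 1F) (M w 2F)
            (λ e → expand′ (κ e) (B e (w , 1F)) (M w 1F) (B e (w , 2F)) (M w 2F))))
        (tidy (M w 0F) (comb κ B (w , 0F)) (M w 1F) (comb κ B (w , 1F)) (M w 2F) (comb κ B (w , 2F)))))
        where
        expand : ∀ k b m s → k * (b * m + s) ≡ m * (k * b) + 1ℚ * (k * s)
        expand = solve-∀ ℚ-ring
        expand′ : ∀ k b m b′ m′ → k * (b * m + b′ * m′) ≡ m * (k * b) + m′ * (k * b′)
        expand′ = solve-∀ ℚ-ring
        tidy : ∀ m a m′ b m″ c → m * a + 1ℚ * (m′ * b + m″ * c) ≡ a * m + (b * m′ + c * m″)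
        tidy = solve-∀ ℚ-ring

  translation : Fin 3 → Fin n → Fin 3 → ℚ
  translation 0F _ 0F = 1ℚ
  translation 1F _ 1F = 1ℚ
  translation 2F _ 2F = 1ℚ
  translation _  _ _  = 0ℚ

  module _ (o : Fin n) where

    -- Let c be `cross (d u v) (d w o)`. Pairing `V u v` with these vectors at `w` gives dx c, dy c
    -- and c², and c has the same value for `w = u` and `w = v`. With dx², dx dy, dy² from the
    -- translations these are all quadratic monomials in dx, dy, c, whence the six in 3n - 6.
    linear₁ linear₂ square : Fin n → Fin 3 → ℚ
    linear₁ w 0F = dy w o
    linear₁ w 1F = - dx w o
    linear₁ w 2F = 0ℚ
    linear₂ w 0F = 0ℚ
    linear₂ w 1F = dy w o
    linear₂ w 2F = - dx w o
    square w 0F = dy w o * dy w o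
    square w 1F = - (dx w o * dy w o + dx w o * dy w o)
    square w 2F = dx w o * dx w o

    linear₁-motion : Motion linear₁
    linear₁-motion u v = identity (x u) (y u) (x v) (y v) (x o) (y o)
      where
      identity : ∀ a b c d p q →
        (a - c) * (a - c) * (b - q) + ((a - c) * (b - d) * (- (a - p)) + (b - d) * (b - d) * 0ℚ) ≡
        (a - c) * (a - c) * (d - q) + ((a - c) * (b - d) * (- (c - p)) + (b - d) * (b - d) * 0ℚ)
      identity = solve-∀ ℚ-ring

    linear₂-motion : Motion linear₂
    linear₂-motion u v = identity (x u) (y u) (x v) (y v) (x o) (y o)
      where
      identity : ∀ a b c d p q →
        (a - c) * (a - c) * 0ℚ + ((a - c) * (b - d) * (b - q) + (b - d) * (b - d) * (- (a - p))) ≡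
        (a - c) * (a - c) * 0ℚ + ((a - c) * (b - d) * (d - q) + (b - d) * (b - d) * (- (c - p)))
      identity = solve-∀ ℚ-ring

    square-motion : Motion square
    square-motion u v = identity (x u) (y u) (x v) (y v) (x o) (y o)
      where
      identity : ∀ a b c d p q →
        (a - c) * (a - c) * ((b - q) * (b - q)) + ((a - c) * (b - d) * (- ((a - p) * (b - q) + (a - p) * (b - q))) + (b - d) * (b - d) * ((a - p) * (a - p))) ≡
        (a - c) * (a - c) * ((d - q) * (d - q)) + ((a - c) * (b - d) * (- ((c - p) * (d - q) + (c - p) * (d - q))) + (b - d) * (b - d) * ((c - p) * (c - p)))
      identity = solve-∀ ℚ-ring

  module _ (w₁ w₂ w₃ : Fin n) (rest : List (Fin n)) (unique : Unique (w₁ ∷ w₂ ∷ w₃ ∷ []))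
    (y₂≢ : dy w₂ w₁ ≢ 0ℚ) (y₃≢ : dy w₃ w₁ ≢ 0ℚ) (y₂₃≢ : dy w₃ w₁ - dy w₂ w₁ ≢ 0ℚ) where

    triples : List (Fin n) → List (Fin n × Fin 3)
    triples []       = []
    triples (w ∷ ws) = (w , 0F) ∷ (w , 1F) ∷ (w , 2F) ∷ triples ws

    length-triples : ∀ ws → length (triples ws) ≡ length ws ℕ.* 3
    length-triples []       = refl
    length-triples (w ∷ ws) = cong (3 ℕ.+_) (length-triples ws)

    ∈-triples : ∀ {w ws} t → w ∈ ws → (w , t) ∈ triples ws
    ∈-triples 0F (here refl) = here refl
    ∈-triples 1F (here refl) = there (here refl)
    ∈-triples 2F (here refl) = there (there (here refl))
    ∈-triples t (there w∈)   = there (there (there (∈-triples t w∈)))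

    -- Omitting six columns at w₁, w₂, w₃ loses nothing, by orthogonality to six motions.
    columns : List (Fin n × Fin 3)
    columns = (w₂ , 2F) ∷ (w₃ , 1F) ∷ (w₃ , 2F) ∷ triples rest

    Within : List (Fin (∣EK∣ n)) → Set
    Within es = ∀ {e} → e ∈ es → proj₁ (ends n e) ∈ w₁ ∷ w₂ ∷ w₃ ∷ rest × proj₂ (ends n e) ∈ w₁ ∷ w₂ ∷ w₃ ∷ rest

    -- The motions centred at `w₁` vanish at `w₁`, so they yield equations in the unknowns `α`, `β`,
    -- `γ` at `w₂` and `w₃` alone. Once these are zero, the translations dispose of the three
    -- columns at `w₁`.
    columns-suffice : ∀ {es} → Within es → ∀ κ → (∀ e → e ∉ es → κ e ≡ 0ℚ) →
      (∀ {j} → j ∈ columns → comb κ B j ≡ 0ℚ) → ∀ j → comb κ B j ≡ 0ℚ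
    columns-suffice {es} within κ supp rel (w , t) = everywhere (w Fin.≟ w₁) (w Fin.≟ w₂) (w Fin.≟ w₃)
      where
      z : Fin n → Fin 3 → ℚ
      z w t = comb κ B (w , t)
      z-outside : ∀ w → w ∉ w₁ ∷ w₂ ∷ w₃ ∷ [] → ∀ t → z w t ≡ 0ℚ
      z-outside w w∉ t = by-cases (Any.any? (w Fin.≟_) rest)
        where
        by-cases : Dec (w ∈ rest) → z w t ≡ 0ℚ
        by-cases (yes w∈) = rel (there (there (there (∈-triples t w∈))))
        by-cases (no w∉rest) = sum-zero {f = λ e → κ e * B e (w , t)} λ e → term e (Any.any? (e Fin.≟_) es)
          where
          w∉ws : w ∉ w₁ ∷ w₂ ∷ w₃ ∷ rest
          w∉ws (here p) = w∉ (here p)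
          w∉ws (there (here p)) = w∉ (there (here p))
          w∉ws (there (there (here p))) = w∉ (there (there (here p)))
          w∉ws (there (there (there p))) = w∉rest p
          term : ∀ e → Dec (e ∈ es) → κ e * B e (w , t) ≡ 0ℚ
          term e (no e∉)  = trans (cong (_* B e (w , t)) (supp e e∉)) (ℚ.*-zeroˡ (B e (w , t)))
          term e (yes e∈) = trans (cong (κ e *_) (Row.at-other (row (joins-ends e)) w
            (λ { refl → w∉ws (proj₁ (within e∈)) }) (λ { refl → w∉ws (proj₂ (within e∈)) }) t)) (ℚ.*-zeroʳ (κ e))
      three : ∀ M → Motion M → dot (z w₁) (M w₁) + (dot (z w₂) (M w₂) + (dot (z w₃) (M w₃) + 0ℚ)) ≡ 0ℚ
      three M motion = trans (sym (sum-support (λ w → dot (z w) (M w)) (w₁ ∷ w₂ ∷ w₃ ∷ []) unique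
        (λ w w∉ → dot-zero (M w) (z-outside w w∉)))) (comb-orthogonal M motion κ)
      α = z w₂ 0F
      β = z w₂ 1F
      γ = z w₃ 0F
      z₂₂ : z w₂ 2F ≡ 0ℚ
      z₂₂ = rel (here refl)
      z₃₁ : z w₃ 1F ≡ 0ℚ
      z₃₁ = rel (there (here refl))
      z₃₂ : z w₃ 2F ≡ 0ℚ
      z₃₂ = rel (there (there (here refl)))
      X₂ = dx w₂ w₁
      Y₂ = dy w₂ w₁
      X₃ = dx w₃ w₁
      Y₃ = dy w₃ w₁
      dot₀ : ∀ f g → (∀ t → g t ≡ 0ℚ) → dot f g ≡ 0ℚ
      dot₀ f g g≡0 = trans (cong₂ _+_ (vanish 0F) (cong₂ _+_ (vanish 1F) (vanish 2F))) refl
        where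
        vanish : ∀ t → f t * g t ≡ 0ℚ
        vanish t = trans (cong (f t *_) (g≡0 t)) (ℚ.*-zeroʳ (f t))
      dx₀ : dx w₁ w₁ ≡ 0ℚ
      dx₀ = ℚ.+-inverseʳ (x w₁)
      dy₀ : dy w₁ w₁ ≡ 0ℚ
      dy₀ = ℚ.+-inverseʳ (y w₁)
      two : ∀ M → Motion M → (∀ t → M w₁ t ≡ 0ℚ) →
        (α * M w₂ 0F + (β * M w₂ 1F + 0ℚ * M w₂ 2F)) + ((γ * M w₃ 0F + (0ℚ * M w₃ 1F + 0ℚ * M w₃ 2F)) + 0ℚ) ≡ 0ℚ
      two M motion M≡0 = trans (cong₂ (λ p q → p + (q + 0ℚ))
          (cong (λ s → α * M w₂ 0F + (β * M w₂ 1F + s * M w₂ 2F)) (sym z₂₂))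
          (cong₂ (λ s r → γ * M w₃ 0F + (s * M w₃ 1F + r * M w₃ 2F)) (sym z₃₁) (sym z₃₂)))
        (trans (sym (ℚ.+-identityˡ _)) (trans (cong (_+ (dot (z w₂) (M w₂) + (dot (z w₃) (M w₃) + 0ℚ))) (sym (dot₀ (z w₁) (M w₁) M≡0)))
          (three M motion)))
      β≡0 : β ≡ 0ℚ
      β≡0 = ℚ-cancel y₂≢ β (trans (simplify α β γ X₂ Y₂ X₃ Y₃) (two (linear₂ w₁) (linear₂-motion w₁) λ
        { 0F → refl ; 1F → dy₀ ; 2F → cong -_ dx₀ }))
        where
        simplify : ∀ α β γ X Y X′ Y′ → Y * β ≡ (α * 0ℚ + (β * Y + 0ℚ * (- X))) + ((γ * 0ℚ + (0ℚ * Y′ + 0ℚ * (- X′))) + 0ℚ)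
        simplify = solve-∀ ℚ-ring
      first : α * Y₂ + γ * Y₃ ≡ 0ℚ
      first = trans (trans (simplify α γ X₂ Y₂ X₃ Y₃)
        (cong (λ s → (α * Y₂ + (s * (- X₂) + 0ℚ * 0ℚ)) + ((γ * Y₃ + (0ℚ * (- X₃) + 0ℚ * 0ℚ)) + 0ℚ)) (sym β≡0)))
        (two (linear₁ w₁) (linear₁-motion w₁) λ { 0F → dy₀ ; 1F → cong -_ dx₀ ; 2F → refl })
        where
        simplify : ∀ α γ X Y X′ Y′ → α * Y + γ * Y′ ≡ (α * Y + (0ℚ * (- X) + 0ℚ * 0ℚ)) + ((γ * Y′ + (0ℚ * (- X′) + 0ℚ * 0ℚ)) + 0ℚ)
        simplify = solve-∀ ℚ-ring
      second : α * (Y₂ * Y₂) + γ * (Y₃ * Y₃) ≡ 0ℚ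
      second = trans (trans (simplify α γ X₂ Y₂ X₃ Y₃)
        (cong (λ s → (α * (Y₂ * Y₂) + (s * (- (X₂ * Y₂ + X₂ * Y₂)) + 0ℚ * (X₂ * X₂))) + ((γ * (Y₃ * Y₃) + (0ℚ * (- (X₃ * Y₃ + X₃ * Y₃)) + 0ℚ * (X₃ * X₃))) + 0ℚ)) (sym β≡0)))
        (two (square w₁) (square-motion w₁) λ
          { 0F → trans (cong₂ _*_ dy₀ dy₀) refl
          ; 1F → trans (cong₂ (λ p q → - (p * q + p * q)) dx₀ dy₀) refl
          ; 2F → trans (cong₂ _*_ dx₀ dx₀) refl })
        where
        simplify : ∀ α γ X Y X′ Y′ → α * (Y * Y) + γ * (Y′ * Y′) ≡
          (α * (Y * Y) + (0ℚ * (- (X * Y + X * Y)) + 0ℚ * (X * X))) + ((γ * (Y′ * Y′) + (0ℚ * (- (X′ * Y′ + X′ * Y′)) + 0ℚ * (X′ * X′))) + 0ℚ)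
        simplify = solve-∀ ℚ-ring
      -- `first` and `second` form a Vandermonde system in `Y₂` and `Y₃`, which are nonzero and
      -- distinct.
      γ≡0 : γ ≡ 0ℚ
      γ≡0 = ℚ-cancel y₃≢ γ (ℚ-cancel y₂₃≢ (Y₃ * γ) (trans (eliminate α γ Y₂ Y₃)
        (trans (cong₂ (λ p q → p - Y₂ * q) second first) (trans (cong (λ p → 0ℚ - p) (ℚ.*-zeroʳ Y₂)) refl))))
        where
        eliminate : ∀ α γ Y Y′ → (Y′ - Y) * (Y′ * γ) ≡ (α * (Y * Y) + γ * (Y′ * Y′)) - Y * (α * Y + γ * Y′)
        eliminate = solve-∀ ℚ-ring
      α≡0 : α ≡ 0ℚ
      α≡0 = ℚ-cancel y₂≢ α (trans (simplify α Y₂ Y₃) (trans (cong (λ s → α * Y₂ + s * Y₃) (sym γ≡0)) first))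
        where
        simplify : ∀ α Y Y′ → Y * α ≡ α * Y + 0ℚ * Y′
        simplify = solve-∀ ℚ-ring
      at-w₂ : ∀ t → z w₂ t ≡ 0ℚ
      at-w₂ 0F = α≡0
      at-w₂ 1F = β≡0
      at-w₂ 2F = z₂₂
      at-w₃ : ∀ t → z w₃ t ≡ 0ℚ
      at-w₃ 0F = γ≡0
      at-w₃ 1F = z₃₁
      at-w₃ 2F = z₃₂
      at-w₁ : ∀ t → z w₁ t ≡ 0ℚ
      at-w₁ t = trans (sym (pick t)) (trans (sym (trans
          (cong₂ (λ p q → dot (z w₁) (translation t w₁) + (p + (q + 0ℚ))) (dot-zero (translation t w₂) at-w₂) (dot-zero (translation t w₃) at-w₃))
          (ℚ.+-identityʳ _)))
        (three (translation t) (λ _ _ → refl)))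
        where
        pick : ∀ t → dot (z w₁) (translation t w₁) ≡ z w₁ t
        pick 0F = pick₀ (z w₁ 0F) (z w₁ 1F) (z w₁ 2F)
          where
          pick₀ : ∀ a b c → a * 1ℚ + (b * 0ℚ + c * 0ℚ) ≡ a
          pick₀ = solve-∀ ℚ-ring
        pick 1F = pick₁ (z w₁ 0F) (z w₁ 1F) (z w₁ 2F)
          where
          pick₁ : ∀ a b c → a * 0ℚ + (b * 1ℚ + c * 0ℚ) ≡ b
          pick₁ = solve-∀ ℚ-ring
        pick 2F = pick₂ (z w₁ 0F) (z w₁ 1F) (z w₁ 2F)
          where
          pick₂ : ∀ a b c → a * 0ℚ + (b * 0ℚ + c * 1ℚ) ≡ c
          pick₂ = solve-∀ ℚ-ring
      everywhere : Dec (w ≡ w₁) → Dec (w ≡ w₂) → Dec (w ≡ w₃) → z w t ≡ 0ℚ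
      everywhere (yes refl) _ _ = at-w₁ t
      everywhere (no _) (yes refl) _ = at-w₂ t
      everywhere (no _) (no _) (yes refl) = at-w₃ t
      everywhere (no p) (no q) (no r) = z-outside w (λ { (here e) → p e ; (there (here e)) → q e ; (there (there (here e))) → r e }) t

    rank-bound : ∀ {es} → Unique es → Within es → Independent B es → length es ℕ.≤ 3 ℕ.+ length rest ℕ.* 3
    rank-bound {es} u within ind = ℕ.≤-trans
      (ℚDomain.rows≤columns (length columns) (λ e l → B e (List.lookup columns l)) es u λ κ supp rel →
        ind κ supp (columns-suffice within κ supp λ {j} j∈ →
          subst (λ j → comb κ B j ≡ 0ℚ) (sym (lookup-index j∈)) (rel (Any.index j∈))))
      (ℕ.≤-reflexive (cong (3 ℕ.+_) (length-triples rest)))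

-- Generic independence

-- The recursion makes `ι (suc k)` unfold to `1ℚ + ι k`, the form in which the ring identities below
-- are stated.
ι : ℕ → ℚ
ι zero    = 0ℚ
ι (suc k) = 1ℚ + ι k

0≤ι : ∀ k → 0ℚ ℚ.≤ ι k
0≤ι zero    = ℚ.≤-refl
0≤ι (suc k) = ℚ.≤-trans (ℚ.<⇒≤ (ℚ.positive⁻¹ 1ℚ)) (subst (ℚ._≤ 1ℚ + ι k) (ℚ.+-identityʳ 1ℚ) (ℚ.+-monoʳ-≤ 1ℚ (0≤ι k)))

0<ι : ∀ k → 0ℚ ℚ.< ι (suc k)
0<ι k = ℚ.<-≤-trans (ℚ.positive⁻¹ 1ℚ) (subst (ℚ._≤ 1ℚ + ι k) (ℚ.+-identityʳ 1ℚ) (ℚ.+-monoʳ-≤ 1ℚ (0≤ι k)))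

ι-injective : ∀ j k → ι j ≡ ι k → j ≡ k
ι-injective zero zero _ = refl
ι-injective zero (suc k) eq = ⊥-elim (ℚ.<-irrefl eq (0<ι k))
ι-injective (suc j) zero eq = ⊥-elim (ℚ.<-irrefl (sym eq) (0<ι j))
ι-injective (suc j) (suc k) eq = cong suc (ι-injective j k (ℚGroup.∙-cancelˡ 1ℚ (ι j) (ι k) eq))

ι-+ : ∀ j k → ι (j ℕ.+ k) ≡ ι j + ι k
ι-+ zero    k = sym (ℚ.+-identityˡ (ι k))
ι-+ (suc j) k = trans (cong (1ℚ +_) (ι-+ j k)) (sym (ℚ.+-assoc 1ℚ (ι j) (ι k)))

-≢0 : ∀ {p q} → p ≢ q → p - q ≢ 0ℚ
-≢0 {p} {q} p≢q p-q≡0 = p≢q (trans (sym (undo p q)) (trans (cong (_+ q) p-q≡0) (ℚ.+-identityˡ q)))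
  where
  undo : ∀ p q → p - q + q ≡ p
  undo = solve-∀ ℚ-ring

nonroot : ∀ {m} (Ps : List (Poly m)) → All (Nonzero m) Ps → ∃[ xs ] All (λ P → evalℚ P xs ≢ 0ℚ) Ps
nonroot {m} Ps nz =
  let xs , P≢0 , _ = common-nonroot (product Ps) (product Ps) (nonzero Ps nz) (nonzero Ps nz) in xs , factors Ps xs P≢0
  where
  product : List (Poly m) → Poly m
  product []       = constant 1ℚ
  product (P ∷ Ps) = P ⊗ product Ps
  nonzero : ∀ Ps → All (Nonzero m) Ps → Nonzero m (product Ps)
  nonzero [] [] = ≉0⇒nonzero {P = constant {m} 1ℚ} (Poly-1≉0 {m})
  nonzero (P ∷ Ps) (p ∷ ps) = ⊗-nonzero {P = P} {product Ps} p (nonzero Ps ps)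
  factors : ∀ Ps xs → evalℚ (product Ps) xs ≢ 0ℚ → All (λ P → evalℚ P xs ≢ 0ℚ) Ps
  factors [] xs _ = []
  factors (P ∷ Ps) xs ≢0 = let l , r = ⊗-nonroot P (product Ps) xs ≢0 in l ∷ factors Ps xs r

module Generic (n : ℕ) where

  open PolyLinear (n ℕ.+ n) using (Independent; Certificate; certificate⇒independent; independent⇒certificate; indep-⊆)
  open ℚLinear using () renaming (Independent to Independentℚ)

  private
    m = n ℕ.+ n
    A = symbolicMatrix {n}

  Edge : Set
  Edge = Fin (∣EK∣ n)

  columns-searchable : Searchable (Fin n × Fin 3)
  columns-searchable P? with Fin.any? (λ v → Fin.any? (λ t → P? (v , t)))
  ... | yes (v , t , p) = yes ((v , t) , p)
  ... | no ¬p           = no λ { ((v , t) , p) → ¬p (v , t , p) }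

  -- Independence over the polynomials: this is the generic matroid, decidable and free of any
  -- choice of a point.
  Gen : List Edge → Set
  Gen es = Unique es × Independent A es

  gen-⊆ : ∀ {es fs} → Unique fs → (∀ {e} → e ∈ fs → e ∈ es) → Gen es → Gen fs
  gen-⊆ u fs⊆es (_ , ind) = u , indep-⊆ fs⊆es ind

  -- The pivots of the old set and the nondegeneracy conditions of the next extension are nonzero
  -- polynomials, so one rational point serves all of them. `generalise` is the way back.
  specialise : ∀ {es} → Gen es → (Ps : List (Poly m)) → All (Nonzero m) Ps →
    ∃[ xs ] (Independentℚ (atℚ A xs) es × All (λ P → evalℚ P xs ≢ 0ℚ) Ps)
  specialise {es} (u , ind) Ps nz = xs , certificate⇒independentℚ cert xs (All.head ≢0s) , All.tail ≢0s
    where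
    cert : Certificate A es
    cert = independent⇒certificate columns-searchable u ind
    point = nonroot (pivot-product cert ∷ Ps) (pivot-product-nonzero cert ∷ nz)
    xs = proj₁ point
    ≢0s = proj₂ point

  generalise : ∀ {es} xs → Unique es → Independentℚ (atℚ A xs) es → Gen es
  generalise xs u ind = u , certificate⇒independent (independentℚ⇒certificate columns-searchable xs u ind)

  area : Fin n → Fin n → Fin n → Poly m
  area v a b = dX v a ⊗ dY v b ⊕ ⊖ (dX v b ⊗ dY v a)

  module _ (xs : Vec ℚ m) where
    open EvaluateD {n} ℚ-evaluation xs
    open AtPoint {n} xs using (d)

    ev-area : ∀ v a b → evalℚ (area v a b) xs ≡ cross (d v a) (d v b)
    ev-area v a b = trans (ℚEval.ev-⊕ (dX v a ⊗ dY v b) (⊖ (dX v b ⊗ dY v a)) xs)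
      (cong₂ _+_ (trans (ℚEval.ev-⊗ (dX v a) (dY v b) xs) (cong₂ _*_ (ev-dX v a) (ev-dY v b)))
        (trans (ℚEval.ev-⊖ (dX v b ⊗ dY v a) xs) (cong -_ (trans (ℚEval.ev-⊗ (dX v b) (dY v a) xs) (cong₂ _*_ (ev-dX v b) (ev-dY v a))))))

    -- The determinant of v - c and v - w for v = 2a - b.
    reflected-area : Fin n → Fin n → Fin n → Fin n → ℚ
    reflected-area a b c w = (x a + (x a - x b) - x c) * (y a + (y a - y b) - y w) - (x a + (x a - x b) - x w) * (y a + (y a - y b) - y c)

  reflectX reflectY : Fin n → Fin n → Fin n → Poly m
  reflectX a b c = X a ⊕ dX a b ⊕ ⊖ X c
  reflectY a b c = Y a ⊕ dY a b ⊕ ⊖ Y c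

  reflected : Fin n → Fin n → Fin n → Fin n → Poly m
  reflected a b c w = reflectX a b c ⊗ reflectY a b w ⊕ ⊖ (reflectX a b w ⊗ reflectY a b c)

  ev-reflected : ∀ xs a b c w → evalℚ (reflected a b c w) xs ≡ reflected-area xs a b c w
  ev-reflected xs a b c w = trans (ℚEval.ev-⊕ (reflectX a b c ⊗ reflectY a b w) (⊖ (reflectX a b w ⊗ reflectY a b c)) xs)
      (cong₂ _+_ (trans (ℚEval.ev-⊗ (reflectX a b c) (reflectY a b w) xs) (cong₂ _*_ (rx c) (ry w)))
        (trans (ℚEval.ev-⊖ (reflectX a b w ⊗ reflectY a b c) xs) (cong -_ (trans (ℚEval.ev-⊗ (reflectX a b w) (reflectY a b c) xs) (cong₂ _*_ (rx w) (ry c))))))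
    where
    open EvaluateD {n} ℚ-evaluation xs
    rx : ∀ c → evalℚ (reflectX a b c) xs ≡ x a + (x a - x b) - x c
    rx c = trans (ℚEval.ev-⊕ (X a ⊕ dX a b) (⊖ X c) xs) (cong₂ _+_
      (trans (ℚEval.ev-⊕ (X a) (dX a b) xs) (cong₂ _+_ (ℚEval.ev-variable _ xs) (ev-dX a b)))
      (trans (ℚEval.ev-⊖ (X c) xs) (cong -_ (ℚEval.ev-variable _ xs))))
    ry : ∀ c → evalℚ (reflectY a b c) xs ≡ y a + (y a - y b) - y c
    ry c = trans (ℚEval.ev-⊕ (Y a ⊕ dY a b) (⊖ Y c) xs) (cong₂ _+_
      (trans (ℚEval.ev-⊕ (Y a) (dY a b) xs) (cong₂ _+_ (ℚEval.ev-variable _ xs) (ev-dY a b)))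
      (trans (ℚEval.ev-⊖ (Y c) xs) (cong -_ (ℚEval.ev-variable _ xs))))

  -- Distinct points of a parabola are never collinear in threes, their area being a Vandermonde
  -- product, so this one configuration witnesses nonvanishing. The parameter `f` may send two
  -- vertices to the same point.
  parabola : (Fin n → ℕ) → Vec ℚ m
  parabola f = coordinates {n} λ i → ι (f i) , ι (f i) * ι (f i)

  parabola-area : ∀ (f : Fin n → ℕ) v a b → f v ≢ f a → f v ≢ f b → f b ≢ f a → ∀ {p} →
    p ≡ (ι (f v) - ι (f a)) * (ι (f v) * ι (f v) - ι (f b) * ι (f b)) - (ι (f v) - ι (f b)) * (ι (f v) * ι (f v) - ι (f a) * ι (f a)) → p ≢ 0ℚ
  parabola-area f v a b va vb ba eq p≡0 = *-nonzeroℚ {(ι (f v) - ι (f a)) * (ι (f v) - ι (f b))} {ι (f b) - ι (f a)}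
      (*-nonzeroℚ {ι (f v) - ι (f a)} {ι (f v) - ι (f b)} (distinct {f v} {f a} va) (distinct {f v} {f b} vb)) (distinct {f b} {f a} ba)
    (trans (sym (vandermonde (ι (f v)) (ι (f a)) (ι (f b)))) (trans (sym eq) p≡0))
    where
    distinct : ∀ {j k} → j ≢ k → ι j - ι k ≢ 0ℚ
    distinct {j} {k} j≢k = -≢0 {ι j} {ι k} (j≢k ∘ ι-injective j k)
    vandermonde : ∀ v a b → (v - a) * (v * v - b * b) - (v - b) * (v * v - a * a) ≡ (v - a) * (v - b) * (b - a)
    vandermonde = solve-∀ ℚ-ring

  module _ (f : Fin n → ℕ) where
    open EvaluateD {n} ℚ-evaluation (parabola f) using (x; y)

    parabola-x : ∀ v → x v ≡ ι (f v)
    parabola-x = lookup-x (λ i → ι (f i) , ι (f i) * ι (f i))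

    parabola-y : ∀ v → y v ≡ ι (f v) * ι (f v)
    parabola-y = lookup-y (λ i → ι (f i) , ι (f i) * ι (f i))

  toℕ-≢ : ∀ (i j : Fin n) → i ≢ j → toℕ i ≢ toℕ j
  toℕ-≢ i j i≢j = i≢j ∘ Fin.toℕ-injective

  area-nonzero : ∀ {v a b} → v ≢ a → v ≢ b → a ≢ b → Nonzero m (area v a b)
  area-nonzero {v} {a} {b} va vb ab = nonroot⇒nonzero (area v a b) (parabola toℕ)
    (parabola-area toℕ v a b (toℕ-≢ v a va) (toℕ-≢ v b vb) (toℕ-≢ b a (ab ∘ sym))
      (trans (ev-area (parabola toℕ) v a b)
        (cong₂ _-_ (cong₂ _*_ (cong₂ _-_ (parabola-x toℕ v) (parabola-x toℕ a)) (cong₂ _-_ (parabola-y toℕ v) (parabola-y toℕ b)))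
          (cong₂ _*_ (cong₂ _-_ (parabola-x toℕ v) (parabola-x toℕ b)) (cong₂ _-_ (parabola-y toℕ v) (parabola-y toℕ a))))))

  dY-nonzero : ∀ {v a} → v ≢ a → Nonzero m (dY v a)
  dY-nonzero {v} {a} va = nonroot⇒nonzero (dY v a) line
    (subst (_≢ 0ℚ) (sym (trans (ev-dY v a) (cong₂ _-_ (lookup-y point v) (lookup-y point a))))
      (-≢0 {ι (toℕ v)} {ι (toℕ a)} (toℕ-≢ v a va ∘ ι-injective (toℕ v) (toℕ a))))
    where
    point : Fin n → ℚ × ℚ
    point i = 0ℚ , ι (toℕ i)
    line = coordinates {n} point
    open EvaluateD {n} ℚ-evaluation line

  -- At a point where b coincides with a, the reflected area is the area of a, c, w.
  reflected-nonzero : ∀ {a b c w} → a ≢ c → a ≢ w → c ≢ w → b ≢ c → b ≢ w → Nonzero m (reflected a b c w)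
  reflected-nonzero {a} {b} {c} {w} ac aw cw bc bw = nonroot⇒nonzero (reflected a b c w) (parabola f)
    (parabola-area f a c w (subst₂ _≢_ (sym fa) (sym (f-other c (bc ∘ sym))) (toℕ-≢ a c ac))
      (subst₂ _≢_ (sym fa) (sym (f-other w (bw ∘ sym))) (toℕ-≢ a w aw))
      (subst₂ _≢_ (sym (f-other w (bw ∘ sym))) (sym (f-other c (bc ∘ sym))) (toℕ-≢ w c (cw ∘ sym)))
      (trans (ev-reflected (parabola f) a b c w)
        (trans (cong₂ _-_ (cong₂ _*_ (xr c) (yr w)) (cong₂ _*_ (xr w) (yr c))) refl)))
    where
    f : Fin n → ℕ
    f i with i Fin.≟ b
    ... | yes _ = toℕ a
    ... | no _  = toℕ i
    f-other : ∀ i → i ≢ b → f i ≡ toℕ i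
    f-other i i≢b with i Fin.≟ b
    ... | yes i≡b = ⊥-elim (i≢b i≡b)
    ... | no _    = refl
    fb : f b ≡ toℕ a
    fb with b Fin.≟ b
    ... | yes _  = refl
    ... | no b≢b = ⊥-elim (b≢b refl)
    fa : f a ≡ toℕ a
    fa with a Fin.≟ b
    ... | yes _ = refl
    ... | no _  = refl
    open EvaluateD {n} ℚ-evaluation (parabola f) using (x; y)
    collapse : ∀ p q → p + (p - p) - q ≡ p - q
    collapse = solve-∀ ℚ-ring
    fb≡fa : f b ≡ f a
    fb≡fa = trans fb (sym fa)
    xr : ∀ c → x a + (x a - x b) - x c ≡ ι (f a) - ι (f c)
    xr c = trans (cong₂ _-_ (cong₂ (λ p q → p + (p - q)) (parabola-x f a) (trans (parabola-x f b) (cong ι fb≡fa))) (parabola-x f c))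
      (collapse (ι (f a)) (ι (f c)))
    yr : ∀ c → y a + (y a - y b) - y c ≡ ι (f a) * ι (f a) - ι (f c) * ι (f c)
    yr c = trans (cong₂ _-_ (cong₂ (λ p q → p + (p - q)) (parabola-y f a) (trans (parabola-y f b) (cong (λ k → ι k * ι k) fb≡fa))) (parabola-y f c))
      (collapse (ι (f a) * ι (f a)) (ι (f c) * ι (f c)))

  Avoiding : Fin n → List Edge → Set
  Avoiding v J = ∀ {e} → e ∈ J → ∀ {w} → ¬ Joins e v w

  avoiding-∉ : ∀ {v w e J} → Avoiding v J → Joins e v w → e ∉ J
  avoiding-∉ av je e∈J = av e∈J je

  joins-distinct : ∀ {v a b : Fin n} {e f} → a ≢ b → Joins e v a → Joins f v b → e ≢ f
  joins-distinct = AtPoint.joins-≢ {n} (Vec.replicate m 0ℚ)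

  gen-[] : Gen []
  gen-[] = [] , PolyLinear.independent-[] m A

  gen-extend₁ : ∀ {v a ea J} → Joins ea v a → Avoiding v J → Gen J → Gen (ea ∷ J)
  gen-extend₁ {v} {a} {ea} {J} ja av gen@(u , _) =
    let xs , ind , ≢0s = specialise gen (dY v a ∷ []) (dY-nonzero (joins⇒≢ ja) ∷ [])
    in generalise xs (∉⇒All≢ (avoiding-∉ av ja) ∷ u)
         (AtPoint.extend₁ xs ja (subst (_≢ 0ℚ) (EvaluateD.ev-dY {n} ℚ-evaluation xs v a) (All.head ≢0s)) av ind)

  gen-extend₂ : ∀ {v a b ea eb J} → Joins ea v a → Joins eb v b → a ≢ b → Avoiding v J → Gen J → Gen (ea ∷ eb ∷ J)
  gen-extend₂ {v} {a} {b} {ea} {eb} {J} ja jb ab av gen@(u , _) =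
    let xs , ind , ≢0s = specialise gen (area v a b ∷ []) (area-nonzero (joins⇒≢ ja) (joins⇒≢ jb) ab ∷ [])
    in generalise xs ((joins-distinct ab ja jb ∷ ∉⇒All≢ (avoiding-∉ av ja)) ∷ ∉⇒All≢ (avoiding-∉ av jb) ∷ u)
         (AtPoint.extend₂ xs ja jb ab (subst (_≢ 0ℚ) (ev-area xs v a b) (All.head ≢0s)) av ind)

  gen-extend₃ : ∀ {v a b c ea eb ec J} → Joins ea v a → Joins eb v b → Joins ec v c → a ≢ b → a ≢ c → b ≢ c →
    Avoiding v J → Gen J → Gen (ea ∷ eb ∷ ec ∷ J)
  gen-extend₃ {v} {a} {b} {c} {ea} {eb} {ec} {J} ja jb jc ab ac bc av gen@(u , _) =
    let va = joins⇒≢ ja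
        vb = joins⇒≢ jb
        vc = joins⇒≢ jc
        xs , ind , ≢0s = specialise gen (area v a b ∷ area v a c ∷ area v b c ∷ [])
          (area-nonzero va vb ab ∷ area-nonzero va vc ac ∷ area-nonzero vb vc bc ∷ [])
    in generalise xs
         ((joins-distinct ab ja jb ∷ joins-distinct ac ja jc ∷ ∉⇒All≢ (avoiding-∉ av ja))
           ∷ (joins-distinct bc jb jc ∷ ∉⇒All≢ (avoiding-∉ av jb)) ∷ ∉⇒All≢ (avoiding-∉ av jc) ∷ u)
         (AtPoint.extend₃ xs ja jb jc ab ac bc (subst (_≢ 0ℚ) (ev-area xs v a b) (All.head ≢0s))
           (subst (_≢ 0ℚ) (ev-area xs v a c) (All.head (All.tail ≢0s))) (subst (_≢ 0ℚ) (ev-area xs v b c) (All.head (All.tail (All.tail ≢0s)))) av ind)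

  independent-cong : ∀ {B B′ : ℚLinear.Matrix (∣EK∣ n) (Fin n × Fin 3)} {es} →
    (∀ {e} → e ∈ es → ∀ j → B e j ≡ B′ e j) → Independentℚ B es → Independentℚ B′ es
  independent-cong {B} {B′} {es} agree ind c supp rel = ind c supp λ j →
    trans (ℚLinear.sum-cong (λ e → c e * B e j) (λ e → c e * B′ e j) (λ e → term e j (Any.any? (e Fin.≟_) es))) (rel j)
    where
    term : ∀ e j → Dec (e ∈ es) → c e * B e j ≡ c e * B′ e j
    term e j (yes e∈) = cong (c e *_) (agree e∈ j)
    term e j (no e∉)  = trans (cong (_* B e j) (supp e e∉))
      (trans (ℚ.*-zeroˡ (B e j)) (sym (trans (cong (_* B′ e j) (supp e e∉)) (ℚ.*-zeroˡ (B′ e j)))))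

  module _ (xs ys : Vec ℚ m) where
    private
      module Ex = EvaluateD {n} ℚ-evaluation xs
      module Ey = EvaluateD {n} ℚ-evaluation ys

    D-agree : ∀ i j → Ex.x i ≡ Ey.x i → Ex.y i ≡ Ey.y i → Ex.x j ≡ Ey.x j → Ex.y j ≡ Ey.y j → ∀ t →
      evalℚ (symbolicD i j t) xs ≡ evalℚ (symbolicD i j t) ys
    D-agree i j xi yi xj yj t = trans (AtPoint.symbolicD≡V {n} xs i j t)
      (trans (cong₂ (λ p q → veronese (p , q) t) (cong₂ _-_ xi xj) (cong₂ _-_ yi yj)) (sym (AtPoint.symbolicD≡V {n} ys i j t)))

    matrix-agree : ∀ e → let i , j = ends n e in Ex.x i ≡ Ey.x i → Ex.y i ≡ Ey.y i → Ex.x j ≡ Ey.x j → Ex.y j ≡ Ey.y j →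
      ∀ k → evalℚ (A e k) xs ≡ evalℚ (A e k) ys
    matrix-agree e xi yi xj yj (v , t) with ends n e
    ... | i , j with v Fin.≟ i | v Fin.≟ j
    ...   | yes _ | _     = D-agree i j xi yi xj yj t
    ...   | no _  | yes _ = trans (ℚEval.ev-⊖ (symbolicD i j t) xs)
        (trans (cong -_ (D-agree i j xi yi xj yj t)) (sym (ℚEval.ev-⊖ (symbolicD i j t) ys)))
    ...   | no _  | no _  = trans (ℚEval.ev-constant {m} 0ℚ xs) (sym (ℚEval.ev-constant {m} 0ℚ ys))

  -- Only `v` is moved to its special position. The rows of `ab` and `J` do not meet `v`, so their
  -- independence at the well-chosen point `xs` persists at `ys`, and independence at `ys` implies
  -- generic independence however special `ys` is.
  gen-extend₄ : ∀ {v a b c w ea eb ec ew eab J} → Joins ea v a → Joins eb v b → Joins ec v c → Joins ew v w → Joins eab a b →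
    a ≢ c → a ≢ w → b ≢ c → b ≢ w → c ≢ w → Avoiding v J → Gen (eab ∷ J) → Gen (ea ∷ eb ∷ ec ∷ ew ∷ J)
  gen-extend₄ {v} {a} {b} {c} {w} {ea} {eb} {ec} {ew} {eab} {J} ja jb jc jw jab ac aw bc bw cw av gen@(u@(_ ∷ u′) , _) =
    generalise ys
      ((joins-distinct ab ja jb ∷ joins-distinct ac ja jc ∷ joins-distinct aw ja jw ∷ ∉⇒All≢ (avoiding-∉ av ja))
        ∷ (joins-distinct bc jb jc ∷ joins-distinct bw jb jw ∷ ∉⇒All≢ (avoiding-∉ av jb))
        ∷ (joins-distinct cw jc jw ∷ ∉⇒All≢ (avoiding-∉ av jc)) ∷ ∉⇒All≢ (avoiding-∉ av jw) ∷ u′)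
      (AtPoint.extend₄ ys ja jb jc jw jab ac aw bc bw cw xv yv
        (subst (_≢ 0ℚ) (trans (ev-area xs a b c) (cross-moved c va vb vc)) (All.head ≢0s))
        (subst (_≢ 0ℚ) (trans (ev-area xs a b w) (cross-moved w va vb vw)) (All.head (All.tail ≢0s)))
        (subst (_≢ 0ℚ) (trans (ev-reflected xs a b c w) reflected-moved) (All.head (All.tail (All.tail ≢0s))))
        u av (independent-cong agree (proj₁ (proj₂ special))))
    where
    ab = joins⇒≢ jab
    va = joins⇒≢ ja
    vb = joins⇒≢ jb
    vc = joins⇒≢ jc
    vw = joins⇒≢ jw
    special = specialise gen (area a b c ∷ area a b w ∷ reflected a b c w ∷ [])
      (area-nonzero ab ac bc ∷ area-nonzero ab aw bw ∷ reflected-nonzero ac aw cw bc bw ∷ [])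
    xs = proj₁ special
    ≢0s = proj₂ (proj₂ special)
    module Ex = EvaluateD {n} ℚ-evaluation xs
    moved : ∀ i → Dec (v ≡ i) → ℚ × ℚ
    moved i (yes _) = Ex.x a + (Ex.x a - Ex.x b) , Ex.y a + (Ex.y a - Ex.y b)
    moved i (no _)  = Ex.x i , Ex.y i
    point : Fin n → ℚ × ℚ
    point i = moved i (v Fin.≟ i)
    ys = coordinates {n} point
    module Ey = EvaluateD {n} ℚ-evaluation ys
    moved-other : ∀ i (v≟i : Dec (v ≡ i)) → v ≢ i → moved i v≟i ≡ (Ex.x i , Ex.y i)
    moved-other i (yes v≡i) v≢i = ⊥-elim (v≢i v≡i)
    moved-other i (no _)    _   = refl
    moved-v : (v≟v : Dec (v ≡ v)) → moved v v≟v ≡ (Ex.x a + (Ex.x a - Ex.x b) , Ex.y a + (Ex.y a - Ex.y b))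
    moved-v (yes _)  = refl
    moved-v (no v≢v) = ⊥-elim (v≢v refl)
    x-other : ∀ {i} → v ≢ i → Ex.x i ≡ Ey.x i
    x-other {i} v≢i = sym (trans (lookup-x point i) (cong proj₁ (moved-other i (v Fin.≟ i) v≢i)))
    y-other : ∀ {i} → v ≢ i → Ex.y i ≡ Ey.y i
    y-other {i} v≢i = sym (trans (lookup-y point i) (cong proj₂ (moved-other i (v Fin.≟ i) v≢i)))
    xv : Ey.x v ≡ Ey.x a + (Ey.x a - Ey.x b)
    xv = trans (lookup-x point v) (trans (cong proj₁ (moved-v (v Fin.≟ v)))
      (cong₂ (λ p q → p + (p - q)) (x-other va) (x-other vb)))
    yv : Ey.y v ≡ Ey.y a + (Ey.y a - Ey.y b)
    yv = trans (lookup-y point v) (trans (cong proj₂ (moved-v (v Fin.≟ v)))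
      (cong₂ (λ p q → p + (p - q)) (y-other va) (y-other vb)))
    cross-moved : ∀ c → v ≢ a → v ≢ b → v ≢ c →
      cross (AtPoint.d {n} xs a b) (AtPoint.d {n} xs a c) ≡ cross (AtPoint.d {n} ys a b) (AtPoint.d {n} ys a c)
    cross-moved c va vb vc = cong₂ cross
      (cong₂ _,_ (cong₂ _-_ (x-other va) (x-other vb)) (cong₂ _-_ (y-other va) (y-other vb)))
      (cong₂ _,_ (cong₂ _-_ (x-other va) (x-other vc)) (cong₂ _-_ (y-other va) (y-other vc)))
    reflected-moved : reflected-area xs a b c w ≡ cross (AtPoint.d {n} ys v c) (AtPoint.d {n} ys v w)
    reflected-moved = cong₂ cross (cong₂ _,_ (dxv vc) (dyv vc)) (cong₂ _,_ (dxv vw) (dyv vw))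
      where
      dxv : ∀ {u} → v ≢ u → Ex.x a + (Ex.x a - Ex.x b) - Ex.x u ≡ Ey.dx v u
      dxv vu = cong₂ _-_ (trans (cong₂ (λ p q → p + (p - q)) (x-other va) (x-other vb)) (sym xv)) (x-other vu)
      dyv : ∀ {u} → v ≢ u → Ex.y a + (Ex.y a - Ex.y b) - Ex.y u ≡ Ey.dy v u
      dyv vu = cong₂ _-_ (trans (cong₂ (λ p q → p + (p - q)) (y-other va) (y-other vb)) (sym yv)) (y-other vu)
    agree : ∀ {e} → e ∈ eab ∷ J → ∀ k → atℚ A xs e k ≡ atℚ A ys e k
    agree {e} e∈ = matrix-agree xs ys e (x-other v≢i) (y-other v≢i) (x-other v≢j) (y-other v≢j)
      where
      avoid : ∀ {e} → e ∈ eab ∷ J → ∀ {w} → ¬ Joins e v w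
      avoid (here refl) je with joins-other je jab
      ... | inj₁ (v≡a , _) = va v≡a
      ... | inj₂ (v≡b , _) = vb v≡b
      avoid (there e∈) je = av e∈ je
      v≢i : v ≢ proj₁ (ends n e)
      v≢i v≡i = avoid e∈ (subst (λ i → Joins e i (proj₂ (ends n e))) (sym v≡i) (joins-ends e))
      v≢j : v ≢ proj₂ (ends n e)
      v≢j v≡j = avoid e∈ (subst (λ i → Joins e i (proj₁ (ends n e))) (sym v≡j) (joins-sym (joins-ends e)))

  gen-rank : ∀ {w₁ w₂ w₃} rest {es} → w₁ ≢ w₂ → w₁ ≢ w₃ → w₂ ≢ w₃ → Gen es →
    (∀ {e} → e ∈ es → proj₁ (ends n e) ∈ w₁ ∷ w₂ ∷ w₃ ∷ rest × proj₂ (ends n e) ∈ w₁ ∷ w₂ ∷ w₃ ∷ rest) →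
    length es ℕ.≤ 3 ℕ.+ length rest ℕ.* 3
  gen-rank {w₁} {w₂} {w₃} rest 12≢ 13≢ 23≢ gen@(u , _) within =
    RankBound.rank-bound xs w₁ w₂ w₃ rest ((12≢ ∷ 13≢ ∷ []) ∷ (23≢ ∷ []) ∷ [] ∷ [])
      (subst (_≢ 0ℚ) (ev-dY w₂ w₁) (All.head ≢0s)) (subst (_≢ 0ℚ) (ev-dY w₃ w₁) (All.head (All.tail ≢0s)))
      (subst (_≢ 0ℚ) (trans (ev-dY w₃ w₂) (difference (y w₃) (y w₂) (y w₁))) (All.head (All.tail (All.tail ≢0s))))
      u within (proj₁ (proj₂ special))
    where
    special = specialise gen (dY w₂ w₁ ∷ dY w₃ w₁ ∷ dY w₃ w₂ ∷ [])
      (dY-nonzero (12≢ ∘ sym) ∷ dY-nonzero (13≢ ∘ sym) ∷ dY-nonzero (23≢ ∘ sym) ∷ [])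
    xs = proj₁ special
    ≢0s = proj₂ (proj₂ special)
    open EvaluateD {n} ℚ-evaluation xs
    difference : ∀ p q r → p - q ≡ (p - r) - (q - r)
    difference = solve-∀ ℚ-ring

-- The closure of an edge set

VertexSet : ℕ → Set
VertexSet n = Fin n → Bool

from-does : ∀ {P : Set} (P? : Dec P) → does P? ≡ true → P
from-does (yes p) _ = p

infixl 6 _∖_

_∖_ : ∀ {n} → VertexSet n → Fin n → VertexSet n
(W ∖ v) u = W u ∧ not (does (v Fin.≟ u))

∖-elim : ∀ {n} {W : VertexSet n} {v u} → (W ∖ v) u ≡ true → W u ≡ true × v ≢ u
∖-elim {W = W} {v} {u} p with W u | v Fin.≟ u
... | true | no v≢u = refl , v≢u
∖-elim () | true | yes _
∖-elim () | false | yes _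
∖-elim () | false | no _

∖-intro : ∀ {n} {W : VertexSet n} {v u} → W u ≡ true → v ≢ u → (W ∖ v) u ≡ true
∖-intro {W = W} {v} {u} Wu v≢u rewrite Wu | dec-false (v Fin.≟ u) v≢u = refl

-- What the combinatorial argument needs of the cofactor matroid. Good W r says that the closed
-- graph adj has r independent edges inside W; good-1, good-2, good-3 are 0-extensions and good-4
-- is a 1-extension on a non-edge ab.
record Rigidity (n : ℕ) : Set₁ where
  field
    adj        : Fin n → Fin n → Bool
    adj-sym    : ∀ {u v} → adj u v ≡ true → adj v u ≡ true
    adj-irrefl : ∀ {u v} → adj u v ≡ true → u ≢ v
    Good       : VertexSet n → ℕ → Set
    good-0     : ∀ {W} → Good W 0
    good-⊆     : ∀ {W W′ r} → (∀ {u} → W u ≡ true → W′ u ≡ true) → Good W r → Good W′ r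
    good-1     : ∀ {W v a r} → W v ≡ true → (W ∖ v) a ≡ true → adj v a ≡ true → Good (W ∖ v) r → Good W (1 ℕ.+ r)
    good-2     : ∀ {W v a b r} → W v ≡ true → (W ∖ v) a ≡ true → (W ∖ v) b ≡ true →
                 adj v a ≡ true → adj v b ≡ true → a ≢ b → Good (W ∖ v) r → Good W (2 ℕ.+ r)
    good-3     : ∀ {W v a b c r} → W v ≡ true → (W ∖ v) a ≡ true → (W ∖ v) b ≡ true → (W ∖ v) c ≡ true →
                 adj v a ≡ true → adj v b ≡ true → adj v c ≡ true →
                 a ≢ b → a ≢ c → b ≢ c → Good (W ∖ v) r → Good W (3 ℕ.+ r)
    good-4     : ∀ {W v a b c w r} → W v ≡ true →
                 (W ∖ v) a ≡ true → (W ∖ v) b ≡ true → (W ∖ v) c ≡ true → (W ∖ v) w ≡ true →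
                 adj v a ≡ true → adj v b ≡ true → adj v c ≡ true → adj v w ≡ true →
                 a ≢ b → a ≢ c → a ≢ w → b ≢ c → b ≢ w → c ≢ w → adj a b ≢ true → Good (W ∖ v) r → Good W (4 ℕ.+ r)
    K₅-closed  : ∀ {v c w a b} → a ≢ b → adj v c ≡ true → adj v w ≡ true → adj c w ≡ true →
                 adj a v ≡ true → adj a c ≡ true → adj a w ≡ true →
                 adj b v ≡ true → adj b c ≡ true → adj b w ≡ true → adj a b ≡ true

-- Bases and closures in a decidable matroid

module Matroid {m : ℕ} (Gen : List (Fin m) → Set) (gen-unique : ∀ {es} → Gen es → Unique es) (gen-[] : Gen [])
  (gen-⊆ : ∀ {es fs} → Unique fs → (∀ {e} → e ∈ fs → e ∈ es) → Gen es → Gen fs)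
  (gen? : ∀ es → Unique es → Dec (Gen es))
  (gen-augment : ∀ {is js} → Gen is → Gen js → length is ℕ.< length js → ∃[ e ] (e ∈ js × e ∉ is × Gen (e ∷ is)))
  {X : Fin m → Set} (X? : Decidable X) where

  private
    Maximal : List (Fin m) → List (Fin m) → Set
    Maximal L I = Gen I × (∀ {e} → e ∈ I → X e) × (∀ {e} → e ∈ L → X e → e ∈ I ⊎ ¬ Gen (e ∷ I))

    drop-second : ∀ {f e I} → Gen (f ∷ e ∷ I) → Gen (f ∷ I)
    drop-second {f} {e} {I} gen = gen-⊆ (unique (gen-unique gen)) (λ { (here p) → here p ; (there p) → there (there p) }) gen
      where
      unique : Unique (f ∷ e ∷ I) → Unique (f ∷ I)
      unique ((_ ∷ pf) ∷ (_ ∷ u)) = pf ∷ u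

    scan : ∀ L → ∃[ I ] Maximal L I
    scan [] = [] , gen-[] , (λ ()) , λ ()
    scan (e ∷ L) with scan L
    ... | I , gen , I⊆X , max with X? e | Any.any? (e Fin.≟_) I
    ... | no ¬Xe | _ = I , gen , I⊆X , λ { (here refl) Xe → ⊥-elim (¬Xe Xe) ; (there e∈) → max e∈ }
    ... | yes _ | yes e∈I = I , gen , I⊆X , λ { (here refl) _ → inj₁ e∈I ; (there e∈) → max e∈ }
    ... | yes Xe | no e∉I with gen? (e ∷ I) (∉⇒All≢ e∉I ∷ gen-unique gen)
    ... | no ¬gen = I , gen , I⊆X , λ { (here refl) _ → inj₂ ¬gen ; (there e∈) → max e∈ }
    ... | yes gen′ = e ∷ I , gen′ , (λ { (here refl) → Xe ; (there e∈) → I⊆X e∈ })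
        , λ { (here refl) _ → inj₁ (here refl) ; (there f∈) Xf → enlarge (max f∈ Xf) }
      where
      enlarge : ∀ {f} → f ∈ I ⊎ ¬ Gen (f ∷ I) → f ∈ e ∷ I ⊎ ¬ Gen (f ∷ e ∷ I)
      enlarge (inj₁ f∈I)  = inj₁ (there f∈I)
      enlarge (inj₂ ¬gen) = inj₂ (¬gen ∘ drop-second)

  opaque

    maximal : ∃[ I ] Maximal (allFin m) I
    maximal = scan (allFin m)

  basis : List (Fin m)
  basis = proj₁ maximal

  basis-gen : Gen basis
  basis-gen = proj₁ (proj₂ maximal)

  basis⊆X : ∀ {e} → e ∈ basis → X e
  basis⊆X = proj₁ (proj₂ (proj₂ maximal))

  -- Closure is measured against one fixed basis instead of by ranks, which makes it decidable.
  data InClosure (e : Fin m) : Set where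
    member    : e ∈ basis → InClosure e
    dependent : ¬ Gen (e ∷ basis) → InClosure e

  X⊆closure : ∀ {e} → X e → InClosure e
  X⊆closure {e} Xe = [ member , dependent ]′ (proj₂ (proj₂ (proj₂ maximal)) (List.∈-allFin e) Xe)

  inClosure? : Decidable InClosure
  inClosure? e with Any.any? (e Fin.≟_) basis
  ... | yes e∈ = yes (member e∈)
  ... | no e∉ with gen? (e ∷ basis) (∉⇒All≢ e∉ ∷ gen-unique basis-gen)
  ... | yes gen = no λ { (member e∈) → e∉ e∈ ; (dependent ¬gen) → ¬gen gen }
  ... | no ¬gen = yes (dependent ¬gen)

  -- A larger independent set would augment the basis by one of its own elements, which the closure
  -- excludes.
  closure-rank : ∀ {J} → All InClosure J → Gen J → length J ℕ.≤ length basis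
  closure-rank J⊆ gen = ℕ.≮⇒≥ λ lt →
    let e , e∈J , e∉basis , gen′ = gen-augment basis-gen gen lt in contradict (All.lookup J⊆ e∈J) e∉basis gen′
    where
    contradict : ∀ {e} → InClosure e → e ∉ basis → Gen (e ∷ basis) → ⊥
    contradict (member e∈) e∉ gen = e∉ e∈
    contradict (dependent ¬gen) e∉ gen = ¬gen gen

  -- `J` is augmented from `e ∷ basis`. As long as `e` is not chosen, the new element lies in the
  -- basis, so the set stays in the closure and its size is limited; hence `e` is chosen at last,
  -- and the auxiliary elements are dropped. This is what lets a non-edge of the closed graph serve
  -- in a 1-extension.
  outside-closure : ∀ {J e} → All InClosure J → Gen J → ¬ InClosure e → Gen (e ∷ J)
  outside-closure {J} {e} J⊆ gen e∉C = go (suc (length basis)) J⊆ gen (ℕ.m≤n+m _ _)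
    where
    e∉basis : e ∉ basis
    e∉basis = e∉C ∘ member
    gen-e : Gen (e ∷ basis)
    gen-e = decidable-stable (gen? (e ∷ basis) (∉⇒All≢ e∉basis ∷ gen-unique basis-gen)) (e∉C ∘ dependent)
    -- The fuel `k` bounds how far `J` is from exceeding the basis; at zero `closure-rank` is
    -- contradicted.
    go : ∀ k {J} → All InClosure J → Gen J → suc (length basis) ℕ.≤ length J ℕ.+ k → Gen (e ∷ J)
    go zero J⊆ gen le = ⊥-elim (ℕ.<⇒≱ (subst (suc (length basis) ℕ.≤_) (ℕ.+-identityʳ _) le) (closure-rank J⊆ gen))
    go (suc k) {J} J⊆ gen le with gen-augment gen gen-e (s≤s (closure-rank J⊆ gen))
    ... | f , here refl , _ , gen′ = gen′
    ... | f , there f∈ , _ , gen′ = drop-second (go k (member f∈ ∷ J⊆) gen′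
          (subst (suc (length basis) ℕ.≤_) (ℕ.+-suc (length J) k) le))

module Closure {n : ℕ} {X : Fin (∣EK∣ n) → Set} (X? : Decidable X) where

  open Generic n
  open PolyLinear (n ℕ.+ n) using (Certificate; Relation; dichotomy; augment; relation⇒dependent; certificate⇒independent)

  gen? : ∀ es → Unique es → Dec (Gen es)
  gen? es u = decide (dichotomy columns-searchable (symbolicMatrix {n}) es u)
    where
    decide : Certificate (symbolicMatrix {n}) es ⊎ Relation (symbolicMatrix {n}) es → Dec (Gen es)
    decide (inj₁ cert) = yes (u , certificate⇒independent cert)
    decide (inj₂ rel)  = no λ gen → relation⇒dependent {es = es} rel (proj₂ gen)

  gen-augment : ∀ {is js} → Gen is → Gen js → length is ℕ.< length js → ∃[ e ] (e ∈ js × e ∉ is × Gen (e ∷ is))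
  gen-augment {is} {js} (u , ind) (u′ , ind′) lt =
    let e , e∈ , e∉ , ind″ = augment columns-searchable (symbolicMatrix {n}) is js u ind u′ ind′ lt
    in e , e∈ , e∉ , (∉⇒All≢ e∉ ∷ u) , ind″

  open Matroid Gen proj₁ gen-[] gen-⊆ gen? gen-augment X? public

  Adj : Fin n → Fin n → Set
  Adj u v = ∃[ e ] (Joins e u v × InClosure e)

  opaque

    adj? : ∀ u v → Dec (Adj u v)
    adj? u v = Fin.any? λ e → joins? e u v ×-dec inClosure? e

  record Inside (W : VertexSet n) (e : Edge) : Set where
    constructor inside
    field
      first  : W (proj₁ (ends n e)) ≡ true
      second : W (proj₂ (ends n e)) ≡ true

  Independent-in : VertexSet n → ℕ → Set
  Independent-in W r = ∃[ J ] (All InClosure J × All (Inside W) J × Gen J × length J ≡ r)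

  inside-joins : ∀ {W : VertexSet n} {e u v} → Joins e u v → W u ≡ true → W v ≡ true → Inside W e
  inside-joins {W} (forward p) Wu Wv  = inside (trans (cong (W ∘ proj₁) p) Wu) (trans (cong (W ∘ proj₂) p) Wv)
  inside-joins {W} (backward p) Wu Wv = inside (trans (cong (W ∘ proj₁) p) Wv) (trans (cong (W ∘ proj₂) p) Wu)

  avoiding : ∀ {W : VertexSet n} {v J} → All (Inside (W ∖ v)) J → Avoiding v J
  avoiding {W} {v} {J} ins {e} e∈ {w} = by-end (All.lookup ins e∈)
    where
    by-end : Inside (W ∖ v) e → ¬ Joins e v w
    by-end (inside i j) (forward p)  = proj₂ (∖-elim {W = W} {v} i) (sym (cong proj₁ p))
    by-end (inside i j) (backward p) = proj₂ (∖-elim {W = W} {v} j) (sym (cong proj₂ p))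

  weaken : ∀ {W : VertexSet n} v {J} → All (Inside (W ∖ v)) J → All (Inside W) J
  weaken {W} v = All.map λ { (inside i j) → inside (proj₁ (∖-elim {W = W} {v} i)) (proj₁ (∖-elim {W = W} {v} j)) }

  inside-edge : ∀ (W : VertexSet n) {v a e} → W v ≡ true → (W ∖ v) a ≡ true → Joins e v a → Inside W e
  inside-edge W {v} Wv Wa je = inside-joins {W} je Wv (proj₁ (∖-elim {W = W} {v} Wa))

  Misses : Fin n → Edge → Set
  Misses z e = ∀ {x} → ¬ Joins e z x

  miss : ∀ {e} {p q : Fin n} z → Joins e p q → z ≢ p → z ≢ q → Misses z e
  miss z j z≢p z≢q je with joins-other je j
  ... | inj₁ (z≡p , _) = z≢p z≡p
  ... | inj₂ (z≡q , _) = z≢q z≡q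

  avoid : ∀ {z J} → All (Misses z) J → Avoiding z J
  avoid {z} misses e∈ = All.lookup {P = Misses z} misses e∈

  EndsIn : List (Fin n) → Edge → Set
  EndsIn ws e = proj₁ (ends n e) ∈ ws × proj₂ (ends n e) ∈ ws

  ends-in : ∀ {ws e} {p q : Fin n} → Joins e p q → p ∈ ws → q ∈ ws → EndsIn ws e
  ends-in {ws} (forward p) p∈ q∈  = subst (_∈ ws) (sym (cong proj₁ p)) p∈ , subst (_∈ ws) (sym (cong proj₂ p)) q∈
  ends-in {ws} (backward p) p∈ q∈ = subst (_∈ ws) (sym (cong proj₁ p)) q∈ , subst (_∈ ws) (sym (cong proj₂ p)) p∈

  -- Extensions by 1, 2, 3 and 3 edges build K₅ minus `ab`: nine independent edges, which is the
  -- rank 3 · 5 - 6 of K₅. An edge `ab` outside the closure would make a tenth.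
  K₅-adj : ∀ {v c w a b} → a ≢ b → Adj v c → Adj v w → Adj c w → Adj a v → Adj a c → Adj a w → Adj b v → Adj b c → Adj b w → Adj a b
  K₅-adj {v} {c} {w} {a} {b} a≢b (vc , j-vc , C-vc) (vw , j-vw , C-vw) (cw , j-cw , C-cw)
    (av , j-av , C-av) (ac , j-ac , C-ac) (aw , j-aw , C-aw) (bv , j-bv , C-bv) (bc , j-bc , C-bc) (bw , j-bw , C-bw) =
    finish (edge-between a≢b)
    where
    v≢c = joins⇒≢ j-vc
    v≢w = joins⇒≢ j-vw
    c≢w = joins⇒≢ j-cw
    a≢v = joins⇒≢ j-av
    a≢c = joins⇒≢ j-ac
    a≢w = joins⇒≢ j-aw
    b≢v = joins⇒≢ j-bv
    b≢c = joins⇒≢ j-bc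
    b≢w = joins⇒≢ j-bw
    J₁ J₂ J₃ J₄ : List Edge
    J₁ = vc ∷ []
    J₂ = vw ∷ cw ∷ J₁
    J₃ = av ∷ ac ∷ aw ∷ J₂
    J₄ = bv ∷ bc ∷ bw ∷ J₃
    miss₁ : ∀ z → z ≢ v → z ≢ c → All (Misses z) J₁
    miss₁ z zv zc = miss z j-vc zv zc ∷ []
    miss₂ : ∀ z → z ≢ v → z ≢ c → z ≢ w → All (Misses z) J₂
    miss₂ z zv zc zw = miss z j-vw zv zw ∷ miss z j-cw zc zw ∷ miss₁ z zv zc
    gen₁ : Gen J₁
    gen₁ = gen-extend₁ j-vc (λ ()) gen-[]
    gen₂ : Gen J₂
    gen₂ = gen-extend₂ (joins-sym j-vw) (joins-sym j-cw) v≢c (avoid (miss₁ w (v≢w ∘ sym) (c≢w ∘ sym))) gen₁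
    gen₃ : Gen J₃
    gen₃ = gen-extend₃ j-av j-ac j-aw v≢c v≢w c≢w (avoid (miss₂ a a≢v a≢c a≢w)) gen₂
    gen₄ : Gen J₄
    gen₄ = gen-extend₃ j-bv j-bc j-bw v≢c v≢w c≢w
      (avoid (miss b j-av (a≢b ∘ sym) b≢v ∷ miss b j-ac (a≢b ∘ sym) b≢c ∷ miss b j-aw (a≢b ∘ sym) b≢w ∷ miss₂ b b≢v b≢c b≢w)) gen₃
    closed₄ : All InClosure J₄
    closed₄ = C-bv ∷ C-bc ∷ C-bw ∷ C-av ∷ C-ac ∷ C-aw ∷ C-vw ∷ C-cw ∷ C-vc ∷ []
    ws = v ∷ c ∷ w ∷ a ∷ b ∷ []
    Ends = EndsIn ws
    v∈ : v ∈ ws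
    v∈ = here refl
    c∈ : c ∈ ws
    c∈ = there (here refl)
    w∈ : w ∈ ws
    w∈ = there (there (here refl))
    a∈ : a ∈ ws
    a∈ = there (there (there (here refl)))
    b∈ : b ∈ ws
    b∈ = there (there (there (there (here refl))))
    within : All Ends J₄
    within = ends-in j-bv b∈ v∈ ∷ ends-in j-bc b∈ c∈ ∷ ends-in j-bw b∈ w∈
      ∷ ends-in j-av a∈ v∈ ∷ ends-in j-ac a∈ c∈ ∷ ends-in j-aw a∈ w∈
      ∷ ends-in j-vw v∈ w∈ ∷ ends-in j-cw c∈ w∈ ∷ ends-in j-vc v∈ c∈ ∷ []
    too-many : ∀ {ab} → Joins ab a b → ¬ Gen (ab ∷ J₄)
    too-many j-ab gen = ℕ.<-irrefl refl (gen-rank (a ∷ b ∷ []) v≢c v≢w c≢w gen (All.lookup {P = Ends} (ends-in j-ab a∈ b∈ ∷ within)))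
    finish : ∃[ ab ] Joins ab a b → Adj a b
    finish (ab , j-ab) = ab , j-ab , decidable-stable (inClosure? ab) λ ab∉C → too-many j-ab (outside-closure closed₄ gen₄ ab∉C)

  private
    Grown : VertexSet n → Fin n → ℕ → ℕ → Set
    Grown W v k r = Independent-in (W ∖ v) r → Independent-in W (k ℕ.+ r)

    grow₁ : ∀ W {v a r} → W v ≡ true → (W ∖ v) a ≡ true → Adj v a → Grown W v 1 r
    grow₁ W {v} Wv Wa (ea , ja , Ca) (J , closed , ins , gen , size) =
      ea ∷ J , Ca ∷ closed , inside-edge W Wv Wa ja ∷ weaken {W} v ins ,
      gen-extend₁ ja (avoiding {W} {v} ins) gen , cong suc size

    grow₂ : ∀ W {v a b r} → W v ≡ true → (W ∖ v) a ≡ true → (W ∖ v) b ≡ true →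
      Adj v a → Adj v b → a ≢ b → Grown W v 2 r
    grow₂ W {v} Wv Wa Wb (ea , ja , Ca) (eb , jb , Cb) a≢b (J , closed , ins , gen , size) =
      ea ∷ eb ∷ J , Ca ∷ Cb ∷ closed ,
      inside-edge W Wv Wa ja ∷ inside-edge W Wv Wb jb ∷ weaken {W} v ins ,
      gen-extend₂ ja jb a≢b (avoiding {W} {v} ins) gen , cong (2 ℕ.+_) size

    grow₃ : ∀ W {v a b c r} → W v ≡ true → (W ∖ v) a ≡ true → (W ∖ v) b ≡ true → (W ∖ v) c ≡ true →
      Adj v a → Adj v b → Adj v c → a ≢ b → a ≢ c → b ≢ c → Grown W v 3 r
    grow₃ W {v} Wv Wa Wb Wc (ea , ja , Ca) (eb , jb , Cb) (ec , jc , Cc) a≢b a≢c b≢c (J , closed , ins , gen , size) =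
      ea ∷ eb ∷ ec ∷ J , Ca ∷ Cb ∷ Cc ∷ closed ,
      inside-edge W Wv Wa ja ∷ inside-edge W Wv Wb jb ∷ inside-edge W Wv Wc jc ∷ weaken {W} v ins ,
      gen-extend₃ ja jb jc a≢b a≢c b≢c (avoiding {W} {v} ins) gen , cong (3 ℕ.+_) size

    grow₄ : ∀ W {v a b c w r} → W v ≡ true → (W ∖ v) a ≡ true → (W ∖ v) b ≡ true → (W ∖ v) c ≡ true → (W ∖ v) w ≡ true →
      Adj v a → Adj v b → Adj v c → Adj v w → a ≢ c → a ≢ w → b ≢ c → b ≢ w → c ≢ w →
      ¬ Adj a b → ∃[ e ] Joins e a b → Grown W v 4 r
    grow₄ W {v} Wv Wa Wb Wc Ww (ea , ja , Ca) (eb , jb , Cb) (ec , jc , Cc) (ew , jw , Cw) a≢c a≢w b≢c b≢w c≢w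
      ¬ab (eab , jab) (J , closed , ins , gen , size) =
      ea ∷ eb ∷ ec ∷ ew ∷ J , Ca ∷ Cb ∷ Cc ∷ Cw ∷ closed ,
      inside-edge W Wv Wa ja ∷ inside-edge W Wv Wb jb ∷ inside-edge W Wv Wc jc ∷ inside-edge W Wv Ww jw ∷ weaken {W} v ins ,
      gen-extend₄ ja jb jc jw jab a≢c a≢w b≢c b≢w c≢w (avoiding {W} {v} ins)
        (outside-closure closed gen λ Cab → ¬ab (eab , jab , Cab)) ,
      cong (4 ℕ.+_) size

    Adj-sym : ∀ {u v} → Adj u v → Adj v u
    Adj-sym (e , je , Ce) = e , joins-sym je , Ce

    Adj-irrefl : ∀ {u v} → Adj u v → u ≢ v
    Adj-irrefl (e , je , Ce) = joins⇒≢ je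

  rigidity : Rigidity n
  rigidity = record
    { adj = λ u v → does (adj? u v)
    ; adj-sym = λ {u} {v} uv → dec-true (adj? v u) (Adj-sym (from-does (adj? u v) uv))
    ; adj-irrefl = λ {u} {v} uv → Adj-irrefl (from-does (adj? u v) uv)
    ; Good = Independent-in
    ; good-0 = [] , [] , [] , gen-[] , refl
    ; good-⊆ = λ W⊆ (J , closed , ins , gen , size) →
        J , closed , All.map (λ { (inside i j) → inside (W⊆ i) (W⊆ j) }) ins , gen , size
    ; good-1 = λ {W} {v} {a} Wv Wa va → grow₁ W Wv Wa (from-does (adj? v a) va)
    ; good-2 = λ {W} {v} {a} {b} Wv Wa Wb va vb →
        grow₂ W Wv Wa Wb (from-does (adj? v a) va) (from-does (adj? v b) vb)
    ; good-3 = λ {W} {v} {a} {b} {c} Wv Wa Wb Wc va vb vc →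
        grow₃ W Wv Wa Wb Wc (from-does (adj? v a) va) (from-does (adj? v b) vb) (from-does (adj? v c) vc)
    ; good-4 = λ {W} {v} {a} {b} {c} {w} Wv Wa Wb Wc Ww va vb vc vw a≢b a≢c a≢w b≢c b≢w c≢w ¬ab →
        grow₄ W Wv Wa Wb Wc Ww (from-does (adj? v a) va) (from-does (adj? v b) vb) (from-does (adj? v c) vc)
          (from-does (adj? v w) vw) a≢c a≢w b≢c b≢w c≢w (¬ab ∘ dec-true (adj? a b)) (edge-between a≢b)
    ; K₅-closed = λ {v} {c} {w} {a} {b} a≢b vc vw cw av ac aw bv bc bw → dec-true (adj? a b) (K₅-adj a≢b
        (from-does (adj? v c) vc) (from-does (adj? v w) vw) (from-does (adj? c w) cw)
        (from-does (adj? a v) av) (from-does (adj? a c) ac) (from-does (adj? a w) aw)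
        (from-does (adj? b v) bv) (from-does (adj? b c) bc) (from-does (adj? b w) bw)) }

-- The random ordering

open ℚLinear using (sum; sum-cong; sum-zero; sum-linear; ∑-distrib-+; ∑-comm; *-sum; δ; δ-same; δ-diff; sum-δ)

count : ∀ {n} → VertexSet n → ℕ
count {zero}  W = 0
count {suc n} W = if W zero then suc (count (W ∘ suc)) else count (W ∘ suc)

count-cong : ∀ {n} {W W′ : VertexSet n} → W ≗ W′ → count W ≡ count W′
count-cong {zero}  W≗ = refl
count-cong {suc n} {W} {W′} W≗ with W zero | W′ zero | W≗ zero
... | true  | .true  | refl = cong suc (count-cong (W≗ ∘ suc))
... | false | .false | refl = count-cong (W≗ ∘ suc)

count-∖ : ∀ {n} {W : VertexSet n} {v} → W v ≡ true → count W ≡ suc (count (W ∖ v))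
count-∖ {suc n} {W} {zero} Wv with W zero | Wv
... | true | refl = cong suc (count-cong λ u → sym (Bool.∧-identityʳ (W (suc u))))
count-∖ {suc n} {W} {suc v} Wv with W zero
... | true  = cong suc (trans (count-∖ {W = W ∘ suc} Wv) (cong suc (count-cong same)))
  where
  same : ∀ u → (W ∘ suc ∖ v) u ≡ (W ∖ suc v) (suc u)
  same u with v Fin.≟ u
  ... | yes _ = refl
  ... | no _  = refl
... | false = trans (count-∖ {W = W ∘ suc} Wv) (cong suc (count-cong same))
  where
  same : ∀ u → (W ∘ suc ∖ v) u ≡ (W ∖ suc v) (suc u)
  same u with v Fin.≟ u
  ... | yes _ = refl
  ... | no _  = refl

pick : ∀ {n} (W : VertexSet n) {k} → count W ≡ suc k → ∃[ v ] (W v ≡ true × count (W ∖ v) ≡ k)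
pick {n} W {k} eq with Fin.any? (λ v → W v Bool.≟ true)
... | yes (v , Wv) = v , Wv , ℕ.suc-injective (trans (sym (count-∖ {W = W} {v} Wv)) eq)
... | no none = ⊥-elim (0≢suc (trans (sym (empty W λ v → Bool.¬-not λ Wv → none (v , Wv))) eq))
  where
  0≢suc : 0 ≢ suc k
  0≢suc ()
  empty : ∀ {n} (W : VertexSet n) → (∀ v → W v ≡ false) → count W ≡ 0
  empty {zero}  W _ = refl
  empty {suc n} W W≡ with W zero | W≡ zero
  ... | false | refl = empty (W ∘ suc) (W≡ ∘ suc)

𝟙 : Bool → ℚ
𝟙 true  = 1ℚ
𝟙 false = 0ℚ

ι-count : ∀ {n} (W : VertexSet n) → sum (λ v → 𝟙 (W v)) ≡ ι (count W)
ι-count {zero}  W = refl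
ι-count {suc n} W with W zero
... | true  = cong (1ℚ +_) (ι-count (W ∘ suc))
... | false = trans (ℚ.+-identityˡ _) (ι-count (W ∘ suc))

sum-mono : ∀ {n} (f g : Fin n → ℚ) → (∀ v → f v ≤ g v) → sum f ≤ sum g
sum-mono {zero}  f g f≤g = ℚ.≤-refl
sum-mono {suc n} f g f≤g = ℚ.+-mono-≤ (f≤g zero) (sum-mono (f ∘ suc) (g ∘ suc) (f≤g ∘ suc))

sum-mono-< : ∀ {n} (f g : Fin n → ℚ) v → (∀ v → f v ≤ g v) → f v < g v → sum f < sum g
sum-mono-< f g zero    f≤g lt = ℚ.+-mono-<-≤ lt (sum-mono (f ∘ suc) (g ∘ suc) (f≤g ∘ suc))
sum-mono-< f g (suc v) f≤g lt = ℚ.+-mono-≤-< (f≤g zero) (sum-mono-< (f ∘ suc) (g ∘ suc) v (f≤g ∘ suc) lt)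

6ℚ 7/2 3ℚ 4ℚ : ℚ
3ℚ  = 1ℚ + (1ℚ + 1ℚ)
4ℚ  = 1ℚ + 3ℚ
6ℚ  = 3ℚ + 3ℚ
7/2 = 3ℚ + ½

opaque

  -- This is 6/(k + 1). Afterwards it enters only through the cleared form `h-spec`, so estimates
  -- are multiplied by the denominator first.
  h : ℕ → ℚ
  h k = 6ℚ * ℚ.1/_ (ι (suc k)) {{ℚ.pos⇒nonZero (ι (suc k)) {{ℚ.positive (0<ι k)}}}}

  h-spec : ∀ k → ι (suc k) * h k ≡ 6ℚ
  h-spec k = trans (swap (ι (suc k)) 6ℚ (ℚ.1/ ι (suc k))) (trans (cong (6ℚ *_) (ℚ.*-inverseʳ (ι (suc k)))) (ℚ.*-identityʳ 6ℚ))
    where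
    instance
      nz : ℚ.NonZero (ι (suc k))
      nz = ℚ.pos⇒nonZero (ι (suc k)) {{ℚ.positive (0<ι k)}}
    swap : ∀ a b c → a * (b * c) ≡ b * (a * c)
    swap = solve-∀ ℚ-ring

*-cancelˡ-≤ : ∀ k {p q} → ι (suc k) * p ≤ ι (suc k) * q → p ≤ q
*-cancelˡ-≤ k = ℚ.*-cancelˡ-≤-pos (ι (suc k)) {{ℚ.positive (0<ι k)}}

h-≥0 : ∀ k → 0ℚ ≤ h k
h-≥0 k = *-cancelˡ-≤ k (subst₂ _≤_ (sym (ℚ.*-zeroʳ (ι (suc k)))) (sym (h-spec k)) (0≤ι 6))

-- Expected number of edges gained by a vertex with D neighbours in a random ordering,
-- bounded below according to whether the neighbours form a clique.
Ψ : ℕ → Bool → ℚ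
Ψ 0 _ = 0ℚ
Ψ 1 _ = ½
Ψ 2 _ = 1ℚ
Ψ (suc (suc (suc k))) true  = 3ℚ - h (3 ℕ.+ k)
Ψ (suc (suc (suc k))) false = 7/2 - h (2 ℕ.+ k)

-- The value 4 is a 1-extension, which takes a non-edge and two further neighbours; every other
-- value is a 0-extension.
gain : ℕ → Bool → ℕ
gain (suc (suc (suc (suc k)))) true  = 3
gain (suc (suc (suc (suc k)))) false = 4
gain D _ = D

-- The difference 6/(3 + k) - 6/(4 + k) is largest at `k = 0`, where it is exactly 1/2; there the
-- clique and non-clique values agree. Thus a set of unknown kind may be charged the clique value.
3ℚ-h≤7/2-h : ∀ k → 3ℚ - h (3 ℕ.+ k) ≤ 7/2 - h (2 ℕ.+ k)
3ℚ-h≤7/2-h k = subst₂ _≤_ (left (h (3 ℕ.+ k)) (h (2 ℕ.+ k))) (right (h (2 ℕ.+ k)))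
    (ℚ.+-monoˡ-≤ (3ℚ - h (2 ℕ.+ k)) (*-cancelˡ-≤ (2 ℕ.+ k) (begin
      N * (h (2 ℕ.+ k) - h (3 ℕ.+ k))    ≡⟨ expand N (h (2 ℕ.+ k)) (h (3 ℕ.+ k)) ⟩
      N * h (2 ℕ.+ k) - ι (4 ℕ.+ k) * h (3 ℕ.+ k) + h (3 ℕ.+ k)
        ≡⟨ cong₂ (λ p q → p - q + h (3 ℕ.+ k)) (h-spec (2 ℕ.+ k)) (h-spec (3 ℕ.+ k)) ⟩
      6ℚ - 6ℚ + h (3 ℕ.+ k)              ≡⟨ ℚ.+-identityˡ (h (3 ℕ.+ k)) ⟩
      h (3 ℕ.+ k)                        ≤⟨ *-cancelˡ-≤ 3 small ⟩
      3ℚ * ½                             ≤⟨ ℚ.*-monoʳ-≤-nonNeg ½ 3≤N ⟩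
      N * ½                              ∎)))
  where
  open ℚ.≤-Reasoning
  N = ι (3 ℕ.+ k)
  left : ∀ p q → q - p + (3ℚ - q) ≡ 3ℚ - p
  left = solve-∀ ℚ-ring
  right : ∀ q → ½ + (3ℚ - q) ≡ 7/2 - q
  right = solve-∀ ℚ-ring
  expand : ∀ N p q → N * (p - q) ≡ N * p - (1ℚ + N) * q + q
  expand = solve-∀ ℚ-ring
  3≤N : 3ℚ ≤ N
  3≤N = ℚ.+-monoʳ-≤ 1ℚ (ℚ.+-monoʳ-≤ 1ℚ (subst (_≤ ι (1 ℕ.+ k)) (ℚ.+-identityʳ 1ℚ) (ℚ.+-monoʳ-≤ 1ℚ (0≤ι k))))
  small : 4ℚ * h (3 ℕ.+ k) ≤ 4ℚ * (3ℚ * ½)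
  small = ℚ.≤-trans (ℚ.*-monoʳ-≤-nonNeg (h (3 ℕ.+ k)) {{ℚ.nonNegative (h-≥0 (3 ℕ.+ k))}} (ℚ.+-monoʳ-≤ 1ℚ 3≤N)) (ℚ.≤-reflexive (h-spec (3 ℕ.+ k)))

Ψ-≥ : ∀ k κ → 3ℚ - h (3 ℕ.+ k) ≤ Ψ (3 ℕ.+ k) κ
Ψ-≥ k true  = ℚ.≤-refl
Ψ-≥ k false = 3ℚ-h≤7/2-h k

2-Ψ : ∀ κ → Ψ 2 κ ≡ 1ℚ
2-Ψ true = refl
2-Ψ false = refl

module Potential {n : ℕ} (R : Rigidity n) where

  open Rigidity R

  NonEdge : VertexSet n → Set
  NonEdge B = ∃[ a ] ∃[ b ] (B a ≡ true × B b ≡ true × a ≢ b × adj a b ≢ true)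

  nonEdge? : ∀ B → Dec (NonEdge B)
  nonEdge? B = Fin.any? λ a → Fin.any? λ b →
    (B a Bool.≟ true) ×-dec (B b Bool.≟ true) ×-dec ¬? (a Fin.≟ b) ×-dec ¬? (adj a b Bool.≟ true)

  clique-adj : ∀ {B a b} → ¬ NonEdge B → B a ≡ true → B b ≡ true → a ≢ b → adj a b ≡ true
  clique-adj {B} {a} {b} none Ba Bb a≢b = decidable-stable (adj a b Bool.≟ true) λ ¬ab → none (a , b , Ba , Bb , a≢b , ¬ab)

  clique : VertexSet n → Bool
  clique B = not (does (nonEdge? B))

  clique-true : ∀ {B} → ¬ NonEdge B → clique B ≡ true
  clique-true {B} none = cong not (dec-false (nonEdge? B) none)

  clique-false : ∀ {B} → NonEdge B → clique B ≡ false
  clique-false {B} pair = cong not (dec-true (nonEdge? B) pair)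

  ψ : VertexSet n → ℚ
  ψ B = Ψ (count B) (clique B)

  nonEdge-⊆ : ∀ {B B′} → (∀ {u} → B u ≡ true → B′ u ≡ true) → NonEdge B → NonEdge B′
  nonEdge-⊆ B⊆B′ (a , b , Ba , Bb , rest) = a , b , B⊆B′ Ba , B⊆B′ Bb , rest

  clique-cong : ∀ {B B′} → B ≗ B′ → clique B ≡ clique B′
  clique-cong {B} {B′} B≗ = by-cases (nonEdge? B)
    where
    by-cases : Dec (NonEdge B) → clique B ≡ clique B′
    by-cases (yes p) = trans (clique-false p) (sym (clique-false (nonEdge-⊆ (λ {u} Bu → trans (sym (B≗ u)) Bu) p)))
    by-cases (no ¬p) = trans (clique-true ¬p) (sym (clique-true (¬p ∘ nonEdge-⊆ (λ {u} Bu → trans (B≗ u) Bu))))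

  ψ-cong : ∀ {B B′} → B ≗ B′ → ψ B ≡ ψ B′
  ψ-cong B≗ = cong₂ Ψ (count-cong B≗) (clique-cong B≗)

  nb : Fin n → VertexSet n → VertexSet n
  nb v W u = W u ∧ adj v u

  nb-W : ∀ {v W u} → nb v W u ≡ true → W u ≡ true
  nb-W {v} {W} {u} p with W u | adj v u
  ... | true | true = refl

  nb-adj : ∀ {v W u} → nb v W u ≡ true → adj v u ≡ true
  nb-adj {v} {W} {u} p with W u | adj v u
  ... | true | true = refl

  nb-intro : ∀ {v W u} → W u ≡ true → adj v u ≡ true → nb v W u ≡ true
  nb-intro Wu vu rewrite Wu | vu = refl

  nb-∖ : ∀ v W u → nb v (W ∖ u) ≗ nb v W ∖ u
  nb-∖ v W u w with W w | adj v w | does (u Fin.≟ w)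
  ... | true  | true  | true  = refl
  ... | true  | true  | false = refl
  ... | true  | false | true  = refl
  ... | true  | false | false = refl
  ... | false | _     | _     = refl

  -- Condition on which of `v` and its D neighbours in `B` comes last: D + 1 times the expected gain
  -- is the gain at `B` if `v` is last, plus this sum over the neighbour that is last.
  loss : VertexSet n → ℚ
  loss B = sum (λ u → 𝟙 (B u) * ψ (B ∖ u))

  loss-≥ : ∀ B q → (∀ {u} → B u ≡ true → q ≤ ψ (B ∖ u)) → ι (count B) * q ≤ loss B
  loss-≥ B q bound = ℚ.≤-trans (ℚ.≤-reflexive (trans (cong (_* q) (sym (ι-count B))) (ℚLinear.sum-* (λ u → 𝟙 (B u)) q)))
    (sum-mono (λ u → 𝟙 (B u) * q) (λ u → 𝟙 (B u) * ψ (B ∖ u)) λ u → term u (B u) refl)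
    where
    term : ∀ u b → B u ≡ b → 𝟙 b * q ≤ 𝟙 b * ψ (B ∖ u)
    term u true  Bu = ℚ.*-monoˡ-≤-nonNeg 1ℚ (bound Bu)
    term u false _  = ℚ.≤-reflexive (trans (ℚ.*-zeroˡ q) (sym (ℚ.*-zeroˡ (ψ (B ∖ u)))))

  loss-≥′ : ∀ B w q q′ → B w ≡ true → (∀ {u} → B u ≡ true → w ≢ u → q ≤ ψ (B ∖ u)) → q′ ≤ ψ (B ∖ w) →
    ι (count B) * q + (q′ - q) ≤ loss B
  loss-≥′ B w q q′ Bw bound bound′ = ℚ.≤-trans (ℚ.≤-reflexive (sym total))
      (sum-mono f (λ u → 𝟙 (B u) * ψ (B ∖ u)) λ u → term u (w Fin.≟ u) (B u) refl)
    where
    f : Fin n → ℚ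
    f u = 𝟙 (B u) * q + δ w u * (q′ - q)
    total : sum f ≡ ι (count B) * q + (q′ - q)
    total = trans (∑-distrib-+ (λ u → 𝟙 (B u) * q) (λ u → δ w u * (q′ - q)))
      (cong₂ _+_ (trans (sym (ℚLinear.sum-* (λ u → 𝟙 (B u)) q)) (cong (_* q) (ι-count B))) (sum-δ w (λ _ → q′ - q)))
    at-w : ∀ q q′ → 1ℚ * q + 1ℚ * (q′ - q) ≡ 1ℚ * q′
    at-w = solve-∀ ℚ-ring
    off-w : ∀ b q r → b * q + 0ℚ * r ≡ b * q
    off-w = solve-∀ ℚ-ring
    term : ∀ u → Dec (w ≡ u) → ∀ b → B u ≡ b → 𝟙 b * q + δ w u * (q′ - q) ≤ 𝟙 b * ψ (B ∖ u)
    term u (yes refl) true Bu = ℚ.≤-trans (ℚ.≤-reflexive (trans (cong (λ t → 1ℚ * q + t * (q′ - q)) (δ-same w)) (at-w q q′)))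
      (ℚ.*-monoˡ-≤-nonNeg 1ℚ bound′)
    term u (yes refl) false Bu = ⊥-elim (absurd (trans (sym Bw) Bu))
      where
      absurd : true ≢ false
      absurd ()
    term u (no w≢u) true Bu = ℚ.≤-trans (ℚ.≤-reflexive (trans (cong (λ t → 1ℚ * q + t * (q′ - q)) (δ-diff w≢u)) (off-w 1ℚ q (q′ - q))))
      (ℚ.*-monoˡ-≤-nonNeg 1ℚ (bound Bu w≢u))
    term u (no w≢u) false Bu = ℚ.≤-reflexive (trans (cong (λ t → 0ℚ * q + t * (q′ - q)) (δ-diff w≢u))
      (trans (off-w 0ℚ q (q′ - q)) (trans (ℚ.*-zeroˡ q) (sym (ℚ.*-zeroˡ (ψ (B ∖ u)))))))

  module Local (v : Fin n) (B : VertexSet n) (B⊆N : ∀ {u} → B u ≡ true → adj v u ≡ true) where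

    Goal : ℕ → Bool → Set
    Goal D κ = ι (suc D) * Ψ D κ ≤ ι (gain D κ) + loss B

    private
      smaller : ∀ {D u} → count B ≡ suc D → B u ≡ true → count (B ∖ u) ≡ D
      smaller {u = u} eq Bu = ℕ.suc-injective (trans (sym (count-∖ {W = B} {u} Bu)) eq)

      loss-≥-at : ∀ {D} q → count B ≡ D → (∀ {u} → B u ≡ true → q ≤ ψ (B ∖ u)) → ι D * q ≤ loss B
      loss-≥-at q refl bound = loss-≥ B q bound

      conclude : ∀ D κ r → ι (suc D) * Ψ D κ ≡ ι (gain D κ) + r → r ≤ loss B → Goal D κ
      conclude D κ r eq r≤ = ℚ.≤-trans (ℚ.≤-reflexive eq) (ℚ.+-monoʳ-≤ (ι (gain D κ)) r≤)

      ψ-at : ∀ {D u} → count B ≡ suc D → B u ≡ true → ψ (B ∖ u) ≡ Ψ D (clique (B ∖ u))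
      ψ-at eq Bu = cong (λ D → Ψ D _) (smaller eq Bu)

      expand : ∀ a b c → a * (b - c) ≡ a * b - a * c
      expand = solve-∀ ℚ-ring

      -- If both deletions left cliques, then `v`, `a`, `b` and two more members of `B` would carry
      -- K₅ minus `ab` in the closed graph, which then contains `ab`.
      at-most-one : ∀ {k a b} → count B ≡ 4 ℕ.+ k → B a ≡ true → B b ≡ true → a ≢ b → adj a b ≢ true →
        ¬ NonEdge (B ∖ a) → NonEdge (B ∖ b)
      at-most-one {k} {a} {b} eq Ba Bb a≢b ¬ab clique-a = decidable-stable (nonEdge? (B ∖ b)) λ clique-b →
          ¬ab (closed clique-b (pick (B ∖ a ∖ b) size))
        where
        size : count (B ∖ a ∖ b) ≡ suc (suc k)
        size = ℕ.suc-injective (trans (sym (count-∖ {W = B ∖ a} {b} (∖-intro {W = B} {a} Bb a≢b))) (smaller eq Ba))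
        closed : ¬ NonEdge (B ∖ b) → ∃[ c ] ((B ∖ a ∖ b) c ≡ true × count (B ∖ a ∖ b ∖ c) ≡ suc k) → adj a b ≡ true
        closed clique-b (c , Bc , size′) = closed′ (pick (B ∖ a ∖ b ∖ c) size′)
          where
          closed′ : ∃[ w ] ((B ∖ a ∖ b ∖ c) w ≡ true × count (B ∖ a ∖ b ∖ c ∖ w) ≡ k) → adj a b ≡ true
          closed′ (w , Bw , _) =
            let Bac , b≢c = ∖-elim {W = B ∖ a} {b} Bc
                Bc′ , a≢c = ∖-elim {W = B} {a} Bac
                Babw , c≢w = ∖-elim {W = B ∖ a ∖ b} {c} Bw
                Baw , b≢w = ∖-elim {W = B ∖ a} {b} Babw
                Bw′ , a≢w = ∖-elim {W = B} {a} Baw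
                Bab = ∖-intro {W = B} {a} Bb a≢b
                Bba = ∖-intro {W = B} {b} Ba (a≢b ∘ sym)
                Bbc = ∖-intro {W = B} {b} Bc′ b≢c
                Bbw = ∖-intro {W = B} {b} Bw′ b≢w
            in K₅-closed a≢b (B⊆N Bc′) (B⊆N Bw′) (clique-adj {B ∖ a} clique-a Bac Baw c≢w)
                 (adj-sym (B⊆N Ba)) (clique-adj {B ∖ b} clique-b Bba Bbc a≢c) (clique-adj {B ∖ b} clique-b Bba Bbw a≢w)
                 (adj-sym (B⊆N Bb)) (clique-adj {B ∖ a} clique-a Bab Bac b≢c) (clique-adj {B ∖ a} clique-a Bab Baw b≢w)

      -- Equality holds when B minus one vertex is a clique, the case that fixes Ψ.
      non-clique : ∀ {k} → count B ≡ 4 ℕ.+ k → NonEdge B → Goal (4 ℕ.+ k) false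
      non-clique {k} eq (a , b , Ba , Bb , a≢b , ¬ab) = by-cases (nonEdge? (B ∖ a))
        where
        N = ι (3 ℕ.+ k)
        p = h (2 ℕ.+ k)
        q = h (3 ℕ.+ k)
        small = 3ℚ - q
        large = 7/2 - p
        -- The defect `N * p - (1ℚ + N) * q` is 6 - 6, so the recurrence holds with equality.
        identity : ∀ N p q → (1ℚ + (1ℚ + N)) * (7/2 - q) ≡
          (4ℚ + ((1ℚ + N) * (7/2 - p) + ((3ℚ - q) - (7/2 - p)))) + (N * p - (1ℚ + N) * q)
        identity = solve-∀ ℚ-ring
        balance : ι (5 ℕ.+ k) * (7/2 - q) ≡ 4ℚ + (ι (4 ℕ.+ k) * large + (small - large))
        balance = trans (identity N p q) (trans (cong₂ (λ s t → (4ℚ + (ι (4 ℕ.+ k) * large + (small - large))) + (s - t)) (h-spec (2 ℕ.+ k)) (h-spec (3 ℕ.+ k)))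
          (trans (cong ((4ℚ + (ι (4 ℕ.+ k) * large + (small - large))) +_) (ℚ.+-inverseʳ 6ℚ)) (ℚ.+-identityʳ _)))
        with-exception : ∀ w → B w ≡ true → (∀ {u} → B u ≡ true → w ≢ u → NonEdge (B ∖ u)) → Goal (4 ℕ.+ k) false
        with-exception w Bw others = conclude (4 ℕ.+ k) false _ balance
          (subst (λ D → ι D * large + (small - large) ≤ loss B) eq (loss-≥′ B w large small Bw
            (λ Bu w≢u → ℚ.≤-reflexive (sym (trans (ψ-at eq Bu) (cong (Ψ (3 ℕ.+ k)) (clique-false (others Bu w≢u))))))
            (ℚ.≤-trans (Ψ-≥ k (clique (B ∖ w))) (ℚ.≤-reflexive (sym (ψ-at eq Bw))))))
        keep : ∀ {u} → u ≢ a → u ≢ b → NonEdge (B ∖ u)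
        keep {u} u≢a u≢b = a , b , ∖-intro {W = B} {u} Ba u≢a , ∖-intro {W = B} {u} Bb u≢b , a≢b , ¬ab
        -- Deleting any vertex other than `a` and `b` keeps the non-edge `ab`, so only these two can
        -- leave a clique, and not both do.
        by-cases : Dec (NonEdge (B ∖ a)) → Goal (4 ℕ.+ k) false
        by-cases (yes pair) = with-exception b Bb λ {u} _ b≢u → other u b≢u (u Fin.≟ a)
          where
          other : ∀ u → b ≢ u → Dec (u ≡ a) → NonEdge (B ∖ u)
          other u b≢u (yes refl) = pair
          other u b≢u (no u≢a)   = keep u≢a (b≢u ∘ sym)
        by-cases (no clique-a) = with-exception a Ba λ {u} _ a≢u → other u a≢u (u Fin.≟ b)
          where
          other : ∀ u → a ≢ u → Dec (u ≡ b) → NonEdge (B ∖ u)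
          other u a≢u (yes refl) = at-most-one eq Ba Bb a≢b ¬ab clique-a
          other u a≢u (no u≢b)   = keep (a≢u ∘ sym) u≢b

      is-clique : ∀ {k} → count B ≡ 4 ℕ.+ k → ¬ NonEdge B → Goal (4 ℕ.+ k) true
      is-clique {k} eq none = conclude (4 ℕ.+ k) true (ι (4 ℕ.+ k) * (3ℚ - h (3 ℕ.+ k)))
        (trans (expand (ι (5 ℕ.+ k)) 3ℚ (h (4 ℕ.+ k))) (trans (cong (λ s → ι (5 ℕ.+ k) * 3ℚ - s) (h-spec (4 ℕ.+ k)))
          (trans (shift (ι (4 ℕ.+ k))) (cong (ι 3 +_) (sym (trans (expand (ι (4 ℕ.+ k)) 3ℚ (h (3 ℕ.+ k)))
            (cong (λ s → ι (4 ℕ.+ k) * 3ℚ - s) (h-spec (3 ℕ.+ k)))))))))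
        (loss-≥-at (3ℚ - h (3 ℕ.+ k)) eq λ {u} Bu → ℚ.≤-reflexive (sym (trans (ψ-at eq Bu)
          (cong (Ψ (3 ℕ.+ k)) (clique-true (none ∘ nonEdge-⊆ (proj₁ ∘ ∖-elim {W = B} {u})))))))
        where
        shift : ∀ m → (1ℚ + m) * 3ℚ - 6ℚ ≡ ι 3 + (m * 3ℚ - 6ℚ)
        shift = solve-∀ ℚ-ring

    local : ∀ D → count B ≡ D → Goal D (clique B)
    local 0 eq = conclude 0 (clique B) (ι 0 * 0ℚ) refl (loss-≥-at 0ℚ eq λ {u} Bu → ⊥-elim (absurd (trans (sym eq) (count-∖ {W = B} {u} Bu))))
      where
      absurd : ∀ {k} → 0 ≢ suc k
      absurd ()
    local 1 eq = conclude 1 (clique B) (ι 1 * 0ℚ) refl (loss-≥-at 0ℚ eq λ Bu → ℚ.≤-reflexive (sym (ψ-at eq Bu)))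
    local 2 eq = conclude 2 (clique B) (ι 2 * ½) refl (loss-≥-at ½ eq λ Bu → ℚ.≤-reflexive (sym (ψ-at eq Bu)))
    local 3 eq = conclude 3 (clique B) (ι 3 * 1ℚ) (three (clique B)) (loss-≥-at 1ℚ eq λ {u} Bu → ℚ.≤-reflexive (sym (trans (ψ-at eq Bu) (2-Ψ (clique (B ∖ u))))))
      where
      three : ∀ κ → ι 4 * Ψ 3 κ ≡ ι (gain 3 κ) + ι 3 * 1ℚ
      three true  = trans (expand (ι 4) 3ℚ (h 3)) (cong (λ s → ι 4 * 3ℚ - s) (h-spec 3))
      three false = trans (cong (λ s → ι 4 * (7/2 - s)) h2≡2) refl
        where
        h2≡2 : h 2 ≡ 1ℚ + 1ℚ
        h2≡2 = ℚ.≤-antisym (*-cancelˡ-≤ 2 (ℚ.≤-reflexive (h-spec 2))) (*-cancelˡ-≤ 2 (ℚ.≤-reflexive (sym (h-spec 2))))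
    local (suc (suc (suc (suc k)))) eq = by-cases (nonEdge? B)
      where
      by-cases : Dec (NonEdge B) → Goal (4 ℕ.+ k) (clique B)
      by-cases (yes pair) = subst (Goal (4 ℕ.+ k)) (sym (clique-false pair)) (non-clique eq pair)
      by-cases (no none)  = subst (Goal (4 ℕ.+ k)) (sym (clique-true none)) (is-clique eq none)

  -- By linearity, a lower bound for the expected number of independent edges gained when `W` is
  -- built in random order.
  total : VertexSet n → ℚ
  total W = sum (λ v → 𝟙 (W v) * ψ (nb v W))

  gained : VertexSet n → Fin n → ℕ
  gained W v = gain (count (nb v W)) (clique (nb v W))

  private
    absurd : true ≢ false
    absurd ()

    self-∖ : ∀ (W : VertexSet n) v → (W ∖ v) v ≡ false
    self-∖ W v = trans (cong (λ b → W v ∧ not b) (dec-true (v Fin.≟ v) refl)) (Bool.∧-zeroʳ (W v))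

    other-∖ : ∀ (W : VertexSet n) {v u} → v ≢ u → (W ∖ v) u ≡ W u
    other-∖ W {v} {u} v≢u = trans (cong (λ b → W u ∧ not b) (dec-false (v Fin.≟ u) v≢u)) (Bool.∧-identityʳ (W u))

  module _ (W : VertexSet n) where

    private
      summand : Fin n → Fin n → ℚ
      summand v u = 𝟙 (W u) * (𝟙 ((W ∖ u) v) * ψ (nb v (W ∖ u)))

      -- A last vertex that is neither `v` nor in `B` leaves the neighbourhood of `v` unchanged and
      -- contributes `ψ B`; there are |W| - |B| - 1 such vertices. The other cases form the
      -- inequality `Local.local`.
      per-vertex : ∀ v → ι (count W) * (𝟙 (W v) * ψ (nb v W)) ≤ 𝟙 (W v) * ι (gained W v) + sum (summand v)
      per-vertex v = by-cases (W v) refl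
        where
        B = nb v W
        p = ψ B
        by-cases : ∀ b → W v ≡ b → ι (count W) * (𝟙 b * p) ≤ 𝟙 b * ι (gained W v) + sum (summand v)
        by-cases false Wv = ℚ.≤-reflexive (trans (trans (cong (ι (count W) *_) (ℚ.*-zeroˡ p)) (ℚ.*-zeroʳ (ι (count W))))
          (sym (trans (cong₂ _+_ (ℚ.*-zeroˡ (ι (gained W v))) (sum-zero {f = summand v} vanish)) (ℚ.+-identityˡ 0ℚ))))
          where
          vanish : ∀ u → summand v u ≡ 0ℚ
          vanish u = trans (cong (λ b → 𝟙 (W u) * (𝟙 b * ψ (nb v (W ∖ u)))) (cong (_∧ not (does (u Fin.≟ v))) Wv))
            (trans (cong (𝟙 (W u) *_) (ℚ.*-zeroˡ (ψ (nb v (W ∖ u))))) (ℚ.*-zeroʳ (𝟙 (W u))))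
        by-cases true Wv = ℚ.≤-trans (ℚ.≤-reflexive (spread (ι (count W)) p (ι (count B))))
          (ℚ.≤-trans (ℚ.+-monoˡ-≤ (ι (count W) * p - ι (count B) * p - p) (Local.local v B (nb-adj {v} {W}) (count B) refl))
            (ℚ.≤-reflexive (trans (collect (ι (gained W v)) (loss B) (ι (count W) * p) (ι (count B) * p) p)
              (cong (1ℚ * ι (gained W v) +_) (sym total-summand)))))
          where
          spread : ∀ w p d → w * (1ℚ * p) ≡ (1ℚ + d) * p + (w * p - d * p - p)
          spread = solve-∀ ℚ-ring
          collect : ∀ g l w d p → (g + l) + (w - d - p) ≡ 1ℚ * g + (l + (- d + (w + - p)))
          collect = solve-∀ ℚ-ring
          pieces : ∀ u → summand v u ≡ 𝟙 (B u) * ψ (B ∖ u) + (𝟙 (B u) * (- p) + (𝟙 (W u) * p + δ v u * (- p)))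
          pieces u = by-vertex (v Fin.≟ u)
            where
            at-v : ∀ p q r → 1ℚ * (0ℚ * q) ≡ 0ℚ * r + (0ℚ * (- p) + (1ℚ * p + 1ℚ * (- p)))
            at-v = solve-∀ ℚ-ring
            outside : ∀ p q r → 0ℚ * q ≡ 0ℚ * r + (0ℚ * (- p) + (0ℚ * p + 0ℚ * (- p)))
            outside = solve-∀ ℚ-ring
            nonadjacent : ∀ p r → 1ℚ * (1ℚ * p) ≡ 0ℚ * r + (0ℚ * (- p) + (1ℚ * p + 0ℚ * (- p)))
            nonadjacent = solve-∀ ℚ-ring
            adjacent : ∀ p r → 1ℚ * (1ℚ * r) ≡ 1ℚ * r + (1ℚ * (- p) + (1ℚ * p + 0ℚ * (- p)))
            adjacent = solve-∀ ℚ-ring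
            Right : Bool → Bool → ℚ → ℚ
            Right b w d = 𝟙 b * ψ (B ∖ u) + (𝟙 b * (- p) + (𝟙 w * p + d * (- p)))
            rewrite-right : ∀ {b w d} → B u ≡ b → W u ≡ w → δ v u ≡ d → Right b w d ≡ Right (B u) (W u) (δ v u)
            rewrite-right refl refl refl = refl
            rewrite-left : ∀ {w z q} → W u ≡ w → (W ∖ u) v ≡ z → ψ (nb v (W ∖ u)) ≡ q → summand v u ≡ 𝟙 w * (𝟙 z * q)
            rewrite-left refl refl refl = refl
            by-vertex : Dec (v ≡ u) → summand v u ≡ Right (B u) (W u) (δ v u)
            by-vertex (yes refl) = trans (rewrite-left Wv (self-∖ W v) refl) (trans (at-v p (ψ (nb v (W ∖ v))) (ψ (B ∖ v)))
              (rewrite-right (trans (cong (W v ∧_) (Bool.¬-not λ vv → adj-irrefl vv refl)) (Bool.∧-zeroʳ (W v))) Wv (δ-same v)))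
            by-vertex (no v≢u) = by-membership (W u) refl (adj v u) refl
              where
              inW : (W ∖ u) v ≡ true
              inW = trans (other-∖ W (v≢u ∘ sym)) Wv
              by-membership : ∀ w → W u ≡ w → ∀ a → adj v u ≡ a → summand v u ≡ Right (B u) (W u) (δ v u)
              by-membership false Wu _ _ = trans (rewrite-left Wu inW refl) (trans (outside p (1ℚ * ψ (nb v (W ∖ u))) (ψ (B ∖ u)))
                (rewrite-right (cong (_∧ adj v u) Wu) Wu (δ-diff v≢u)))
              by-membership true Wu false vu = trans (rewrite-left Wu inW (ψ-cong λ w → trans (nb-∖ v W u w) (unchanged w (u Fin.≟ w))))
                (trans (nonadjacent p (ψ (B ∖ u))) (rewrite-right Bu Wu (δ-diff v≢u)))
                where
                Bu : B u ≡ false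
                Bu = trans (cong (W u ∧_) vu) (Bool.∧-zeroʳ (W u))
                unchanged : ∀ w → Dec (u ≡ w) → (B ∖ u) w ≡ B w
                unchanged w (yes refl) = trans (self-∖ B u) (sym Bu)
                unchanged w (no u≢w)   = other-∖ B u≢w
              by-membership true Wu true vu = trans (rewrite-left Wu inW (ψ-cong (nb-∖ v W u)))
                (trans (adjacent p (ψ (B ∖ u))) (rewrite-right (nb-intro {v} {W} Wu vu) Wu (δ-diff v≢u)))
          f₁ f₂ f₃ f₄ : Fin n → ℚ
          f₁ u = 𝟙 (B u) * ψ (B ∖ u)
          f₂ u = 𝟙 (B u) * (- p)
          f₃ u = 𝟙 (W u) * p
          f₄ u = δ v u * (- p)
          total-summand : sum (summand v) ≡ loss B + (- (ι (count B) * p) + (ι (count W) * p + - p))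
          total-summand = trans (sum-cong (summand v) (λ u → f₁ u + (f₂ u + (f₃ u + f₄ u))) pieces)
            (trans (∑-distrib-+ f₁ (λ u → f₂ u + (f₃ u + f₄ u)))
            (cong (loss B +_) (trans (∑-distrib-+ f₂ (λ u → f₃ u + f₄ u))
            (cong₂ _+_ (trans (sym (ℚLinear.sum-* (λ u → 𝟙 (B u)) (- p))) (trans (cong (_* (- p)) (ι-count B)) (sym (ℚ.neg-distribʳ-* (ι (count B)) p))))
            (trans (∑-distrib-+ f₃ f₄)
              (cong₂ _+_ (trans (sym (ℚLinear.sum-* (λ u → 𝟙 (W u)) p)) (cong (_* p) (ι-count W))) (sum-δ v (λ _ → - p))))))))

    -- Averaging over the vertex of W that comes last.
    average : ι (count W) * total W ≤ sum (λ u → 𝟙 (W u) * (ι (gained W u) + total (W ∖ u)))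
    average = ℚ.≤-trans (ℚ.≤-reflexive (*-sum (ι (count W)) (λ v → 𝟙 (W v) * ψ (nb v W))))
      (ℚ.≤-trans (sum-mono (λ v → ι (count W) * (𝟙 (W v) * ψ (nb v W))) (λ v → 𝟙 (W v) * ι (gained W v) + sum (summand v)) per-vertex)
      (ℚ.≤-reflexive (trans (∑-distrib-+ (λ v → 𝟙 (W v) * ι (gained W v)) (λ v → sum (summand v)))
        (trans (cong (sum (λ v → 𝟙 (W v) * ι (gained W v)) +_) (trans (∑-comm summand)
            (sum-cong (λ u → sum (λ v → summand v u)) (λ u → 𝟙 (W u) * total (W ∖ u)) λ u →
              sym (*-sum (𝟙 (W u)) (λ v → 𝟙 ((W ∖ u) v) * ψ (nb v (W ∖ u)))))))
        (trans (sym (∑-distrib-+ (λ u → 𝟙 (W u) * ι (gained W u)) (λ u → 𝟙 (W u) * total (W ∖ u))))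
          (sum-cong (λ u → 𝟙 (W u) * ι (gained W u) + 𝟙 (W u) * total (W ∖ u)) (λ u → 𝟙 (W u) * (ι (gained W u) + total (W ∖ u)))
            λ u → sym (ℚ.*-distribˡ-+ (𝟙 (W u)) (ι (gained W u)) (total (W ∖ u)))))))))

    -- Values that all lie below `total W` cannot average to at least `total W`. Choosing this
    -- vertex replaces the random order.
    last-vertex : ∀ {k} → count W ≡ suc k → ∃[ u ] (W u ≡ true × total W ≤ ι (gained W u) + total (W ∖ u))
    last-vertex {k} eq = search (Fin.any? λ u → (W u Bool.≟ true) ×-dec (total W ℚ.≤? ι (gained W u) + total (W ∖ u)))
      where
      Found : Set
      Found = ∃[ u ] (W u ≡ true × total W ≤ ι (gained W u) + total (W ∖ u))
      search : Dec Found → Found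
      search (yes found) = found
      search (no none) = ⊥-elim (ℚ.<-irrefl refl (ℚ.≤-<-trans average (ℚ.<-≤-trans
        (sum-mono-< f g u₀ below below-u₀) (ℚ.≤-reflexive (trans (sym (ℚLinear.sum-* (λ u → 𝟙 (W u)) (total W))) (cong (_* total W) (ι-count W)))))))
        where
        f g : Fin n → ℚ
        f u = 𝟙 (W u) * (ι (gained W u) + total (W ∖ u))
        g u = 𝟙 (W u) * total W
        strict : ∀ u → W u ≡ true → ι (gained W u) + total (W ∖ u) < total W
        strict u Wu = ℚ.≰⇒> λ le → none (u , Wu , le)
        term : ∀ u b → W u ≡ b → 𝟙 b * (ι (gained W u) + total (W ∖ u)) ≤ 𝟙 b * total W
        term u true  Wu = ℚ.*-monoˡ-≤-nonNeg 1ℚ (ℚ.<⇒≤ (strict u Wu))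
        term u false _  = ℚ.≤-reflexive (trans (ℚ.*-zeroˡ (ι (gained W u) + total (W ∖ u))) (sym (ℚ.*-zeroˡ (total W))))
        below : ∀ u → f u ≤ g u
        below u = term u (W u) refl
        u₀ = proj₁ (pick W eq)
        Wu₀ : W u₀ ≡ true
        Wu₀ = proj₁ (proj₂ (pick W eq))
        below-u₀ : f u₀ < g u₀
        below-u₀ = subst (λ b → 𝟙 b * (ι (gained W u₀) + total (W ∖ u₀)) < 𝟙 b * total W) (sym Wu₀)
          (ℚ.*-monoʳ-<-pos 1ℚ (strict u₀ Wu₀))

  -- One, two or three neighbours allow a 0-extension, and a larger clique still uses three of its
  -- members. With a non-edge among four or more neighbours, two others complete the data of a
  -- 1-extension.
  extend : ∀ {W v r} → W v ≡ true → Good (W ∖ v) r → Good W (gained W v ℕ.+ r)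
  extend {W} {v} {r} Wv good = by-degree (count B) refl
    where
    B = nb v W
    inside : ∀ {u} → B u ≡ true → (W ∖ v) u ≡ true
    inside Bu = ∖-intro {W = W} {v} (nb-W {v} {W} Bu) (adj-irrefl (nb-adj {v} {W} Bu))
    adjacent : ∀ {u} → B u ≡ true → adj v u ≡ true
    adjacent = nb-adj {v} {W}
    Target : ℕ → Set
    Target D = Good W (gain D (clique B) ℕ.+ r)
    one : ∃[ a ] (B a ≡ true × count (B ∖ a) ≡ 0) → Good W (1 ℕ.+ r)
    one (a , Ba , _) = good-1 Wv (inside Ba) (adjacent Ba) good
    two : ∃[ a ] (B a ≡ true × count (B ∖ a) ≡ 1) → Good W (2 ℕ.+ r)
    two (a , Ba , eq) = go (pick (B ∖ a) eq)
      where
      go : ∃[ b ] ((B ∖ a) b ≡ true × count (B ∖ a ∖ b) ≡ 0) → Good W (2 ℕ.+ r)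
      go (b , Bab , _) = let Bb , a≢b = ∖-elim {W = B} {a} Bab in
        good-2 Wv (inside Ba) (inside Bb) (adjacent Ba) (adjacent Bb) a≢b good
    three : ∀ {k} → ∃[ a ] (B a ≡ true × count (B ∖ a) ≡ suc (suc k)) → Good W (3 ℕ.+ r)
    three (a , Ba , eq) = go (pick (B ∖ a) eq)
      where
      go : ∀ {k} → ∃[ b ] ((B ∖ a) b ≡ true × count (B ∖ a ∖ b) ≡ suc k) → Good W (3 ℕ.+ r)
      go (b , Bab , eq′) = go′ (pick (B ∖ a ∖ b) eq′)
        where
        go′ : ∀ {k} → ∃[ c ] ((B ∖ a ∖ b) c ≡ true × count (B ∖ a ∖ b ∖ c) ≡ k) → Good W (3 ℕ.+ r)
        go′ (c , Babc , _) =
          let Bb , a≢b = ∖-elim {W = B} {a} Bab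
              Bac , b≢c = ∖-elim {W = B ∖ a} {b} Babc
              Bc , a≢c = ∖-elim {W = B} {a} Bac
          in good-3 Wv (inside Ba) (inside Bb) (inside Bc) (adjacent Ba) (adjacent Bb) (adjacent Bc) a≢b a≢c b≢c good
    four : ∀ {k} → count B ≡ 4 ℕ.+ k → NonEdge B → Good W (4 ℕ.+ r)
    four {k} eq (a , b , Ba , Bb , a≢b , ¬ab) = go (pick (B ∖ a ∖ b) size)
      where
      size : count (B ∖ a ∖ b) ≡ suc (suc k)
      size = ℕ.suc-injective (trans (sym (count-∖ {W = B ∖ a} {b} (∖-intro {W = B} {a} Bb a≢b)))
        (ℕ.suc-injective (trans (sym (count-∖ {W = B} {a} Ba)) eq)))
      go : ∃[ c ] ((B ∖ a ∖ b) c ≡ true × count (B ∖ a ∖ b ∖ c) ≡ suc k) → Good W (4 ℕ.+ r)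
      go (c , Babc , eq′) = go′ (pick (B ∖ a ∖ b ∖ c) eq′)
        where
        go′ : ∃[ w ] ((B ∖ a ∖ b ∖ c) w ≡ true × count (B ∖ a ∖ b ∖ c ∖ w) ≡ k) → Good W (4 ℕ.+ r)
        go′ (w , Babcw , _) =
          let Bac , b≢c = ∖-elim {W = B ∖ a} {b} Babc
              Bc , a≢c = ∖-elim {W = B} {a} Bac
              Babw , c≢w = ∖-elim {W = B ∖ a ∖ b} {c} Babcw
              Baw , b≢w = ∖-elim {W = B ∖ a} {b} Babw
              Bw , a≢w = ∖-elim {W = B} {a} Baw
          in good-4 Wv (inside Ba) (inside Bb) (inside Bc) (inside Bw) (adjacent Ba) (adjacent Bb) (adjacent Bc) (adjacent Bw)
               a≢b a≢c a≢w b≢c b≢w c≢w ¬ab good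
    by-degree : ∀ D → count B ≡ D → Target (count B)
    by-degree 0 eq = subst Target (sym eq) (good-⊆ (λ {u} Wu → proj₁ (∖-elim {W = W} {v} Wu)) good)
    by-degree 1 eq = subst Target (sym eq) (one (pick B eq))
    by-degree 2 eq = subst Target (sym eq) (two (pick B eq))
    by-degree 3 eq = subst Target (sym eq) (three (pick B eq))
    by-degree (suc (suc (suc (suc k)))) eq = subst Target (sym eq) (by-clique (nonEdge? B))
      where
      by-clique : Dec (NonEdge B) → Target (4 ℕ.+ k)
      by-clique (yes pair) = subst (λ κ → Good W (gain (4 ℕ.+ k) κ ℕ.+ r)) (sym (clique-false pair)) (four eq pair)
      by-clique (no none)  = subst (λ κ → Good W (gain (4 ℕ.+ k) κ ℕ.+ r)) (sym (clique-true none)) (three (pick B eq))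

  greedy : ∀ k W → count W ≡ k → ∃[ r ] (Good W r × total W ≤ ι r)
  greedy zero W eq = 0 , good-0 , ℚ.≤-reflexive (sum-zero {f = λ v → 𝟙 (W v) * ψ (nb v W)} λ v → vanish v (W v) refl)
    where
    vanish : ∀ v b → W v ≡ b → 𝟙 b * ψ (nb v W) ≡ 0ℚ
    vanish v false _  = ℚ.*-zeroˡ (ψ (nb v W))
    vanish v true  Wv = ⊥-elim (0≢suc (trans (sym eq) (count-∖ {W = W} {v} Wv)))
      where
      0≢suc : ∀ {k} → 0 ≢ suc k
      0≢suc ()
  greedy (suc k) W eq = step (last-vertex W eq)
    where
    step : ∃[ u ] (W u ≡ true × total W ≤ ι (gained W u) + total (W ∖ u)) → ∃[ r ] (Good W r × total W ≤ ι r)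
    step (u , Wu , bound) = finish (greedy k (W ∖ u) (ℕ.suc-injective (trans (sym (count-∖ {W = W} {u} Wu)) eq)))
      where
      finish : ∃[ r ] (Good (W ∖ u) r × total (W ∖ u) ≤ ι r) → ∃[ r ] (Good W r × total W ≤ ι r)
      finish (r , good , rest) = gained W u ℕ.+ r , extend Wu good ,
        ℚ.≤-trans bound (ℚ.≤-trans (ℚ.+-monoʳ-≤ (ι (gained W u)) rest) (ℚ.≤-reflexive (sym (ι-+ (gained W u) r))))

-- Connectivity

open import Relation.Binary.Construct.Closure.ReflexiveTransitive using (Star; ε; _◅_)

open ℚLinear using (sum; sum-cong; ∑-distrib-+; *-sum)

ι-* : ∀ j k → ι (j ℕ.* k) ≡ ι j * ι k
ι-* zero    k = sym (ℚ.*-zeroˡ (ι k))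
ι-* (suc j) k = trans (ι-+ k (j ℕ.* k)) (trans (cong (ι k +_) (ι-* j k)) (sym (expand (ι j) (ι k))))
  where
  expand : ∀ a b → (1ℚ + a) * b ≡ b + a * b
  expand = solve-∀ ℚ-ring

ι-mono : ∀ {j k} → j ℕ.≤ k → ι j ≤ ι k
ι-mono {k = k} z≤n   = 0≤ι k
ι-mono (s≤s j≤k) = ℚ.+-monoʳ-≤ 1ℚ (ι-mono j≤k)

ι-reflects : ∀ j k → ι j ≤ ι k → j ℕ.≤ k
ι-reflects j k le = ℕ.≮⇒≥ λ k<j → ℚ.<-irrefl refl (ℚ.<-≤-trans (less (ι k)) (ℚ.≤-trans (ι-mono k<j) le))
  where
  less : ∀ p → p < 1ℚ + p
  less p = subst (_< 1ℚ + p) (ℚ.+-identityˡ p) (ℚ.+-monoˡ-< p (ℚ.positive⁻¹ 1ℚ))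

count-⊆ : ∀ {n} (W W′ : VertexSet n) → (∀ {u} → W u ≡ true → W′ u ≡ true) → count W ℕ.≤ count W′
count-⊆ {zero}  W W′ W⊆W′ = z≤n
count-⊆ {suc n} W W′ W⊆W′ with W zero | W′ zero | W⊆W′ {zero}
... | true  | true  | _ = s≤s (count-⊆ (W ∘ suc) (W′ ∘ suc) W⊆W′)
... | true  | false | f = ⊥-elim (absurd (f refl))
  where
  absurd : false ≢ true
  absurd ()
... | false | true  | _ = ℕ.m≤n⇒m≤1+n (count-⊆ (W ∘ suc) (W′ ∘ suc) W⊆W′)
... | false | false | _ = count-⊆ (W ∘ suc) (W′ ∘ suc) W⊆W′

count-∨ : ∀ {n} (W A B : VertexSet n) → count (λ u → W u ∧ (A u ∨ B u)) ℕ.≤ count (λ u → W u ∧ A u) ℕ.+ count B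
count-∨ {zero}  W A B = z≤n
count-∨ {suc n} W A B with W zero | A zero | B zero
... | true  | true  | true  = s≤s (ℕ.≤-trans (count-∨ (W ∘ suc) (A ∘ suc) (B ∘ suc)) (ℕ.+-monoʳ-≤ _ (ℕ.n≤1+n _)))
... | true  | true  | false = s≤s (count-∨ (W ∘ suc) (A ∘ suc) (B ∘ suc))
... | true  | false | true  = ℕ.≤-trans (s≤s (count-∨ (W ∘ suc) (A ∘ suc) (B ∘ suc))) (ℕ.≤-reflexive (sym (ℕ.+-suc _ _)))
... | true  | false | false = count-∨ (W ∘ suc) (A ∘ suc) (B ∘ suc)
... | false | _     | true  = ℕ.≤-trans (count-∨ (W ∘ suc) (A ∘ suc) (B ∘ suc)) (ℕ.+-monoʳ-≤ _ (ℕ.n≤1+n _))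
... | false | _     | false = count-∨ (W ∘ suc) (A ∘ suc) (B ∘ suc)

missing : ∀ {n} (W X : VertexSet n) → count X ℕ.< count W → ∃[ w ] (W w ≡ true × X w ≡ false)
missing W X lt = search (Fin.any? λ w → (W w Bool.≟ true) ×-dec (X w Bool.≟ false))
  where
  search : Dec (∃[ w ] (W w ≡ true × X w ≡ false)) → ∃[ w ] (W w ≡ true × X w ≡ false)
  search (yes found) = found
  search (no none) = ⊥-elim (ℕ.<⇒≱ lt (count-⊆ W X λ {u} Wu → Bool.¬-not λ Xu → none (u , Wu , Xu)))

module Graph {n : ℕ} (R : Rigidity n) (adjS : Fin n → Fin n → Bool)
  (S-sym : ∀ {u v} → adjS u v ≡ true → adjS v u ≡ true) (S-irrefl : ∀ {u v} → adjS u v ≡ true → u ≢ v) where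

  open Rigidity R
  open Potential R

  -- The closed graph contains every edge of G outside S, so together with S it inherits the
  -- connectivity of G.
  adjG : Fin n → Fin n → Bool
  adjG u v = adj u v ∨ adjS u v

  Step : VertexSet n → VertexSet n → Fin n → Fin n → Set
  Step W X a b = (W a ≡ true × X a ≡ false) × (W b ≡ true × X b ≡ false) × adjG a b ≡ true

  TwelveConnected : VertexSet n → Set
  TwelveConnected W = ∀ X → count X ℕ.< 12 → ∀ {u v} → W u ≡ true → W v ≡ true → X u ≡ false → X v ≡ false →
    Star (Step W X) u v

  degS : Fin n → ℕ
  degS v = count (adjS v)

  private
    absurd : false ≢ true
    absurd ()

    G-cases : ∀ {u v} → adjG u v ≡ true → adj u v ≡ true ⊎ adjS u v ≡ true
    G-cases {u} {v} p with adj u v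
    ... | true  = inj₁ refl
    ... | false = inj₂ p

    G-irrefl : ∀ {u v} → adjG u v ≡ true → u ≢ v
    G-irrefl {u} {v} p with G-cases {u} {v} p
    ... | inj₁ uv = adj-irrefl uv
    ... | inj₂ uv = S-irrefl uv

    G-from-adj : ∀ {u v} → adj u v ≡ true → adjG u v ≡ true
    G-from-adj uv rewrite uv = refl

    S-free : ∀ {v u} → degS v ≡ 0 → adjS v u ≢ true
    S-free {v} {u} eq vu = 0≢suc (trans (sym eq) (count-∖ {W = adjS v} {u} vu))
      where
      0≢suc : ∀ {k} → 0 ≢ suc k
      0≢suc ()

  -- Fewer than 12 neighbours would form a set separating `v` from some non-neighbour, which exists
  -- because `W` has at least 13 vertices.
  min-degree : ∀ {W v} → TwelveConnected W → 13 ℕ.≤ count W → W v ≡ true → 12 ℕ.≤ count (nb v W) ℕ.+ degS v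
  min-degree {W} {v} conn big Wv = ℕ.≤-trans (ℕ.≮⇒≥ cut) (count-∨ W (adj v) (adjS v))
    where
    N : VertexSet n
    N u = W u ∧ adjG v u
    v∉N : N v ≡ false
    v∉N = trans (cong (W v ∧_) (Bool.¬-not λ vv → G-irrefl vv refl)) (Bool.∧-zeroʳ (W v))
    12≤ : 12 ℕ.≤ count (W ∖ v)
    12≤ = ℕ.≤-pred (subst (13 ℕ.≤_) (count-∖ {W = W} {v} Wv) big)
    cut : ¬ count N ℕ.< 12
    cut lt = escape (missing (W ∖ v) N (ℕ.<-≤-trans lt 12≤))
      where
      first-step : ∀ {w} → v ≢ w → Star (Step W N) v w → ⊥
      first-step v≢v ε = v≢v refl
      first-step _ (_◅_ {j = x} (_ , (Wx , Nx) , vx) _) = absurd (trans (sym Nx) (trans (cong (_∧ adjG v x) Wx) vx))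
      escape : ∃[ w ] ((W ∖ v) w ≡ true × N w ≡ false) → ⊥
      escape (w , Ww , Nw) = let Ww′ , v≢w = ∖-elim {W = W} {v} Ww in first-step v≢w (conn N lt Wv Ww′ v∉N Nw)

  -- A path through a vertex whose neighbours form a clique can be shortcut.
  remove-simplicial : ∀ {W v} → W v ≡ true → degS v ≡ 0 → ¬ NonEdge (nb v W) → TwelveConnected W → TwelveConnected (W ∖ v)
  remove-simplicial {W} {v} Wv s≡0 none conn X lt {u} {w} Wu Ww Xu Xw =
    shortcut (proj₂ (∖-elim {W = W} {v} Wu)) (proj₂ (∖-elim {W = W} {v} Ww))
      (conn X lt (proj₁ (∖-elim {W = W} {v} Wu)) (proj₁ (∖-elim {W = W} {v} Ww)) Xu Xw)
    where
    neighbour : ∀ {a} → adjG v a ≡ true → adj v a ≡ true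
    neighbour {a} va with G-cases {v} {a} va
    ... | inj₁ p = p
    ... | inj₂ p = ⊥-elim (S-free s≡0 p)
    neighbour′ : ∀ {a} → adjG a v ≡ true → adj v a ≡ true
    neighbour′ {a} av with G-cases {a} {v} av
    ... | inj₁ p = adj-sym p
    ... | inj₂ p = ⊥-elim (S-free s≡0 (S-sym p))
    shortcut : ∀ {a b} → v ≢ a → v ≢ b → Star (Step W X) a b → Star (Step (W ∖ v) X) a b
    shortcut v≢a v≢b ε = ε
    shortcut {a} {b} v≢a v≢b (_◅_ {j = x} ((Wa , Xa) , (Wx , Xx) , ax) path) = by-vertex (v Fin.≟ x)
      where
      by-vertex : Dec (v ≡ x) → Star (Step (W ∖ v) X) a b
      by-vertex (no v≢x) = ((∖-intro {W = W} {v} Wa v≢a , Xa) , (∖-intro {W = W} {v} Wx v≢x , Xx) , ax) ◅ shortcut v≢x v≢b path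
      by-vertex (yes refl) = through path
        where
        through : Star (Step W X) v b → Star (Step (W ∖ v) X) a b
        through ε = ⊥-elim (v≢b refl)
        through (_◅_ {j = y} (_ , (Wy , Xy) , vy) path′) = by-equality (a Fin.≟ y)
          where
          v≢y : v ≢ y
          v≢y = G-irrefl vy
          by-equality : Dec (a ≡ y) → Star (Step (W ∖ v) X) a b
          by-equality (yes refl) = shortcut v≢y v≢b path′
          by-equality (no a≢y) =
            ((∖-intro {W = W} {v} Wa v≢a , Xa) , (∖-intro {W = W} {v} Wy v≢y , Xy) ,
              G-from-adj (clique-adj {nb v W} none (nb-intro {v} {W} Wa (neighbour′ ax)) (nb-intro {v} {W} Wy (neighbour vy)) a≢y))
            ◅ shortcut v≢y v≢b path′

  private
    half-bound : ∀ k s → 12 ℕ.≤ suc k ℕ.* s → h k ≤ ½ * ι s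
    half-bound k s le = *-cancelˡ-≤ k (ℚ.≤-trans (ℚ.≤-reflexive (h-spec k)) (ℚ.≤-trans
      (ℚ.*-monoˡ-≤-nonNeg ½ (ι-mono le)) (ℚ.≤-reflexive (trans (cong (½ *_) (ι-* (suc k) s)) (swap (ι (suc k)) (ι s))))))
      where
      swap : ∀ a b → ½ * (a * b) ≡ a * (½ * b)
      swap = solve-∀ ℚ-ring

    subtract : ∀ c {p q} → p ≤ q → c - q ≤ c - p
    subtract c p≤q = ℚ.+-monoʳ-≤ c (ℚ.neg-antimono-≤ p≤q)

    -- Fewer than three neighbours in the closed graph force degree at least 10 in S, and the bound
    -- to be reached is then negative.
    few : ∀ {s} → 10 ℕ.≤ s → 3ℚ - ½ * ι s ≤ 0ℚ
    few {s} le = ℚ.≤-trans (subtract 3ℚ (ℚ.*-monoˡ-≤-nonNeg ½ (ι-mono le))) (ℚ.nonPositive⁻¹ (- (1ℚ + 1ℚ)))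

  -- A vertex loses at most half of its degree in S from the average gain 3.
  Ψ-bound : ∀ D κ s → 12 ℕ.≤ D ℕ.+ s → (κ ≡ true → 1 ℕ.≤ s) → 3ℚ - ½ * ι s ≤ Ψ D κ
  Ψ-bound 0 κ s le _ = few (ℕ.≤-trans (ℕ.m≤n+m 10 2) le)
  Ψ-bound 1 κ s le _ = ℚ.≤-trans (few (ℕ.≤-trans (ℕ.m≤n+m 10 1) (ℕ.≤-pred le))) (ℚ.nonNegative⁻¹ ½)
  Ψ-bound 2 κ s le _ = ℚ.≤-trans (few (ℕ.≤-pred (ℕ.≤-pred le))) (ℚ.nonNegative⁻¹ 1ℚ)
  Ψ-bound (suc (suc (suc k))) true s le pos = subtract 3ℚ (half-bound (3 ℕ.+ k) s (enough (pos refl)))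
    where
    -- For s ≥ 1, D ≤ D s gives D + s ≤ (D + 1)s. At s = 0 the right side is zero, so simplicial
    -- vertices untouched by S must be treated apart.
    enough : 1 ℕ.≤ s → 12 ℕ.≤ (4 ℕ.+ k) ℕ.* s
    enough (s≤s {n = t} z≤n) = ℕ.≤-trans le (ℕ.≤-trans (ℕ.≤-reflexive (ℕ.+-comm (3 ℕ.+ k) (suc t)))
      (ℕ.+-monoʳ-≤ (suc t) (ℕ.m≤m*n (3 ℕ.+ k) (suc t))))
  Ψ-bound (suc (suc (suc k))) false s le _ = ℚ.≤-trans (ℚ.≤-reflexive (shift (½ * ι s)))
    (subtract 7/2 (ℚ.≤-trans (half-bound (2 ℕ.+ k) (suc s) enough) (ℚ.≤-reflexive (expand (ι s)))))
    where
    shift : ∀ t → 3ℚ - t ≡ 7/2 - (½ + t)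
    shift = solve-∀ ℚ-ring
    expand : ∀ t → ½ * (1ℚ + t) ≡ ½ + ½ * t
    expand = solve-∀ ℚ-ring
    -- The surplus 1/2 of a non-clique acts like one more edge of S: D + s ≤ D(s + 1) holds even for
    -- s = 0.
    enough : 12 ℕ.≤ (3 ℕ.+ k) ℕ.* suc s
    enough = ℕ.≤-trans le (ℕ.≤-trans (ℕ.+-monoʳ-≤ (3 ℕ.+ k) (ℕ.m≤n*m s (3 ℕ.+ k))) (ℕ.≤-reflexive (sym (ℕ.*-suc (3 ℕ.+ k) s))))

  RankAtLeast : VertexSet n → Set
  RankAtLeast W = ∃[ r ] (Good W r × count W ℕ.* 3 ℕ.≤ r ℕ.+ 6)

  from-total : ∀ {W} → ι (count W) * 3ℚ - 6ℚ ≤ total W → RankAtLeast W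
  from-total {W} bound = step (greedy (count W) W refl)
    where
    step : ∃[ r ] (Good W r × total W ≤ ι r) → RankAtLeast W
    step (r , good , total≤) = r , good , ι-reflects (count W ℕ.* 3) (r ℕ.+ 6)
      (ℚ.≤-trans (ℚ.≤-reflexive (trans (ι-* (count W) 3) (undo (ι (count W) * 3ℚ))))
        (ℚ.≤-trans (ℚ.+-monoˡ-≤ 6ℚ (ℚ.≤-trans bound total≤)) (ℚ.≤-reflexive (sym (ι-+ r 6)))))
      where
      undo : ∀ p → p ≡ p - 6ℚ + 6ℚ
      undo = solve-∀ ℚ-ring

  total-bound : (sum (λ v → ι (degS v)) ≤ 6ℚ + 6ℚ) → ∀ {W} → TwelveConnected W → 13 ℕ.≤ count W →
    (∀ v → W v ≡ true → degS v ≡ 0 → NonEdge (nb v W)) → ι (count W) * 3ℚ - 6ℚ ≤ total W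
  total-bound handshake {W} conn big no-simplicial = ℚ.≤-trans (ℚ.≤-trans (ℚ.+-monoʳ-≤ (ι (count W) * 3ℚ) (halve (sum (λ v → ι (degS v))) handshake)) (ℚ.≤-reflexive (sym sum-f)))
      (sum-mono f (λ v → 𝟙 (W v) * ψ (nb v W)) λ v → term v (W v) refl)
    where
    f : Fin n → ℚ
    -- Degrees in S are summed over all vertices so that the global handshake bound applies; outside
    -- `W` the term is at most zero.
    f v = 𝟙 (W v) * 3ℚ + (- ½) * ι (degS v)
    halve : ∀ s → s ≤ 6ℚ + 6ℚ → - 6ℚ ≤ (- ½) * s
    halve s s≤ = ℚ.≤-trans (ℚ.neg-antimono-≤ (ℚ.*-monoˡ-≤-nonNeg ½ s≤)) (ℚ.≤-reflexive (ℚ.neg-distribˡ-* ½ s))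
    sum-f : sum f ≡ ι (count W) * 3ℚ + (- ½) * sum (λ v → ι (degS v))
    sum-f = trans (∑-distrib-+ (λ v → 𝟙 (W v) * 3ℚ) (λ v → (- ½) * ι (degS v)))
      (cong₂ _+_ (trans (sym (ℚLinear.sum-* (λ v → 𝟙 (W v)) 3ℚ)) (cong (_* 3ℚ) (ι-count W))) (sym (*-sum (- ½) (λ v → ι (degS v)))))
    positive : ∀ v → W v ≡ true → clique (nb v W) ≡ true → 1 ℕ.≤ degS v
    positive v Wv κ = ℕ.n≢0⇒n>0 λ s≡0 → absurd (trans (sym (clique-false {nb v W} (no-simplicial v Wv s≡0))) κ)
    tidy : ∀ s → 1ℚ * 3ℚ + (- ½) * s ≡ 3ℚ - ½ * s
    tidy = solve-∀ ℚ-ring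
    term : ∀ v b → W v ≡ b → 𝟙 b * 3ℚ + (- ½) * ι (degS v) ≤ 𝟙 b * ψ (nb v W)
    term v true Wv = ℚ.≤-trans (ℚ.≤-reflexive (tidy (ι (degS v))))
      (ℚ.≤-trans (Ψ-bound (count (nb v W)) (clique (nb v W)) (degS v) (min-degree {W} conn big Wv) (positive v Wv)) (ℚ.≤-reflexive (sym (ℚ.*-identityˡ (ψ (nb v W))))))
    term v false _ = ℚ.≤-trans (ℚ.≤-reflexive (trans (ℚ.+-identityˡ ((- ½) * ι (degS v))) (sym (ℚ.neg-distribˡ-* ½ (ι (degS v))))))
      (ℚ.≤-trans (ℚ.neg-antimono-≤ (subst (_≤ ½ * ι (degS v)) (ℚ.*-zeroʳ ½) (ℚ.*-monoˡ-≤-nonNeg ½ (0≤ι (degS v)))))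
        (ℚ.≤-reflexive (sym (ℚ.*-zeroˡ (ψ (nb v W))))))

  -- A vertex joined to the other 12, which form a clique, makes the closed graph complete on `W`.
  -- Each vertex then contributes 3 - 6/13, and 13(3 - 6/13) = 33 = 3 · 13 - 6.
  total-K₁₃ : ∀ {W v} → count W ≡ 13 → W v ≡ true → 12 ℕ.≤ count (nb v W) → ¬ NonEdge (nb v W) →
    ι (count W) * 3ℚ - 6ℚ ≤ total W
  total-K₁₃ {W} {v} eq Wv deg none = ℚ.≤-reflexive (sym (trans
    (sum-cong (λ w → 𝟙 (W w) * ψ (nb w W)) (λ w → 𝟙 (W w) * (3ℚ - h 12)) (λ w → term w (W w) refl))
    (trans (sym (ℚLinear.sum-* (λ w → 𝟙 (W w)) (3ℚ - h 12))) (trans (cong (_* (3ℚ - h 12)) (trans (ι-count W) (cong ι eq)))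
      (trans (expand (ι 13) (h 12)) (cong₂ (λ p q → p * 3ℚ - q) (cong ι (sym eq)) (h-spec 12)))))))
    where
    expand : ∀ p q → p * (3ℚ - q) ≡ p * 3ℚ - p * q
    expand = solve-∀ ℚ-ring
    size : ∀ {w} → W w ≡ true → count (W ∖ w) ≡ 12
    size {w} Ww = ℕ.suc-injective (trans (sym (count-∖ {W = W} {w} Ww)) eq)
    all-neighbours : ∀ {u} → W u ≡ true → v ≢ u → nb v W u ≡ true
    all-neighbours {u} Wu v≢u = decidable-stable (nb v W u Bool.≟ true) λ Nu →
      ℕ.<⇒≱ (subst (count (nb v W) ℕ.<_) (trans (sym (count-∖ {W = W ∖ v} {u} (∖-intro {W = W} {v} Wu v≢u))) (size Wv))
        (s≤s (count-⊆ (nb v W) (W ∖ v ∖ u) λ {w} Nw → ∖-intro {W = W ∖ v} {u}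
          (∖-intro {W = W} {v} (nb-W {v} {W} Nw) (adj-irrefl (nb-adj {v} {W} Nw)))
          (λ u≡w → Nu (trans (cong (nb v W) u≡w) Nw))))) deg
    complete : ∀ {a b} → W a ≡ true → W b ≡ true → a ≢ b → adj a b ≡ true
    complete {a} {b} Wa Wb a≢b = by-vertex (v Fin.≟ a) (v Fin.≟ b)
      where
      by-vertex : Dec (v ≡ a) → Dec (v ≡ b) → adj a b ≡ true
      by-vertex (yes refl) _ = nb-adj {v} {W} (all-neighbours Wb a≢b)
      by-vertex (no v≢a) (yes refl) = adj-sym (nb-adj {v} {W} (all-neighbours Wa v≢a))
      by-vertex (no v≢a) (no v≢b) = clique-adj {nb v W} none (all-neighbours Wa v≢a) (all-neighbours Wb v≢b) a≢b
    everywhere : ∀ {w} → W w ≡ true → nb w W ≗ W ∖ w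
    everywhere {w} Ww u = by-vertex (w Fin.≟ u) (W u) refl
      where
      by-vertex : Dec (w ≡ u) → ∀ b → W u ≡ b → nb w W u ≡ (W ∖ w) u
      by-vertex (yes refl) _ _ = trans (trans (cong (W w ∧_) (Bool.¬-not λ ww → adj-irrefl ww refl)) (Bool.∧-zeroʳ (W w)))
        (sym (trans (cong (λ b → W w ∧ not b) (dec-true (w Fin.≟ w) refl)) (Bool.∧-zeroʳ (W w))))
      by-vertex (no w≢u) true Wu = trans (nb-intro {w} {W} Wu (complete Ww Wu w≢u)) (sym (∖-intro {W = W} {w} Wu w≢u))
      by-vertex (no w≢u) false Wu = trans (cong (_∧ adj w u) Wu) (sym (cong (_∧ not (does (w Fin.≟ u))) Wu))
    ψ-value : ∀ {w} → W w ≡ true → ψ (nb w W) ≡ 3ℚ - h 12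
    ψ-value {w} Ww = cong₂ Ψ (trans (count-cong (everywhere Ww)) (size Ww))
      (clique-true {nb w W} λ (a , b , Ba , Bb , a≢b , ¬ab) → ¬ab (complete (nb-W {w} {W} Ba) (nb-W {w} {W} Bb) a≢b))
    term : ∀ w b → W w ≡ b → 𝟙 b * ψ (nb w W) ≡ 𝟙 b * (3ℚ - h 12)
    term w true  Ww = cong (1ℚ *_) (ψ-value Ww)
    term w false _  = trans (ℚ.*-zeroˡ (ψ (nb w W))) (sym (ℚ.*-zeroˡ (3ℚ - h 12)))

  -- Induction on the number of vertices beyond 13. A simplicial vertex untouched by S is deleted
  -- and put back by a 0-extension worth exactly 3. With only 13 vertices left a deletion would
  -- break the size bound, and completeness takes over.
  rank-at-least : (sum (λ v → ι (degS v)) ≤ 6ℚ + 6ℚ) → ∀ k W → count W ≡ 13 ℕ.+ k → TwelveConnected W → RankAtLeast W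
  rank-at-least handshake k W eq conn = search (Fin.any? λ v → (W v Bool.≟ true) ×-dec (degS v ℕ.≟ 0) ×-dec ¬? (nonEdge? (nb v W)))
    where
    big : 13 ℕ.≤ count W
    big = subst (13 ℕ.≤_) (sym eq) (ℕ.m≤m+n 13 k)
    search : Dec (∃[ v ] (W v ≡ true × degS v ≡ 0 × ¬ NonEdge (nb v W))) → RankAtLeast W
    search (no none) = from-total (total-bound handshake conn big λ v Wv s≡0 →
      decidable-stable (nonEdge? (nb v W)) λ ¬pair → none (v , Wv , s≡0 , ¬pair))
    search (yes (v , Wv , s≡0 , none)) = by-size k eq
      where
      degree : 12 ℕ.≤ count (nb v W)
      degree = subst (12 ℕ.≤_) (trans (cong (count (nb v W) ℕ.+_) s≡0) (ℕ.+-identityʳ _)) (min-degree {W} conn big Wv)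
      gain≡3 : ∀ {D} → 12 ℕ.≤ D → gain D true ≡ 3
      gain≡3 (s≤s (s≤s (s≤s (s≤s _)))) = refl
      by-size : ∀ k → count W ≡ 13 ℕ.+ k → RankAtLeast W
      by-size zero eq = from-total (total-K₁₃ eq Wv degree none)
      by-size (suc k) eq = grow (rank-at-least handshake k (W ∖ v) size (remove-simplicial Wv s≡0 none conn))
        where
        size : count (W ∖ v) ≡ 13 ℕ.+ k
        size = ℕ.suc-injective (trans (sym (count-∖ {W = W} {v} Wv)) (trans eq (cong suc (ℕ.+-suc 12 k))))
        grow : RankAtLeast (W ∖ v) → RankAtLeast W
        grow (r , good , le) = 3 ℕ.+ r
          , subst (λ g → Good W (g ℕ.+ r)) (trans (cong (gain (count (nb v W))) (clique-true {nb v W} none)) (gain≡3 degree)) (extend Wv good)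
          , subst (λ c → c ℕ.* 3 ℕ.≤ 3 ℕ.+ r ℕ.+ 6) (sym (count-∖ {W = W} {v} Wv)) (ℕ.+-monoʳ-≤ 3 le)

-- Rank and span over the reals

open import Data.Fin.Subset using (Subset; _─_; _∪_; ⁅_⁆; ∣_∣; _⊆_) renaming (_∈_ to _∈ˢ_; _∉_ to _∉ˢ_)
open Defs using (EdgeSet; Adjacent; Connected[_]; RowIndependent; CofactorIndependent; HasRank) renaming (Generic to GenericPoints)

open ℚLinear using (sum; sum-cong; sum-zero; ∑-distrib-+; ∑-comm; *-sum; δ; δ-same; sum-δ)

opaque
  unfolding plus

  plus≈ : ∀ x y → plus x y Defs.≈ x Defs.+ y
  plus≈ x y = pointwise⇒≈ (plus x y) (x Defs.+ y) λ _ → refl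

  times≈ : ∀ x y → times x y Defs.≈ x Defs.* y
  times≈ x y = pointwise⇒≈ (times x y) (x Defs.* y) λ _ → refl

module ℝBridge where
  open CommutativeRing ℝ-commutativeRing using (setoid; _≈_) renaming (refl to ≈-refl; sym to ≈-sym; trans to ≈-trans; +-cong to plus-cong; *-cong to times-cong)
  open import Relation.Binary.Reasoning.Setoid setoid

  sum≈ : ∀ {m} (f g : Fin m → ℝ) → (∀ e → f e ≈ g e) → ℝLinear.sum f ≈ Defs.sum g
  sum≈ {zero}  f g f≈g = ≈-refl {0ℝ}
  sum≈ {suc m} f g f≈g = begin
    plus (f zero) (ℝLinear.sum (f ∘ suc))       ≈⟨ plus-cong {f zero} {g zero} {ℝLinear.sum (f ∘ suc)} {Defs.sum (g ∘ suc)} (f≈g zero) (sum≈ (f ∘ suc) (g ∘ suc) (f≈g ∘ suc)) ⟩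
    plus (g zero) (Defs.sum (g ∘ suc))          ≈⟨ plus≈ (g zero) (Defs.sum (g ∘ suc)) ⟩
    g zero Defs.+ Defs.sum (g ∘ suc)            ∎

  module _ {m : ℕ} {Col : Set} (A : Fin m → Col → ℝ) (A′ : Fin m → Col → ℝ) (A′≈A : ∀ e j → A′ e j ≈ A e j) where

    comb≈ : ∀ c j → ℝLinear.comb c A′ j ≈ Defs.sum (λ e → c e Defs.* A e j)
    comb≈ c j = sum≈ (λ e → times (c e) (A′ e j)) (λ e → c e Defs.* A e j) λ e → begin
      times (c e) (A′ e j)   ≈⟨ times-cong {c e} {c e} {A′ e j} {A e j} (≈-refl {c e}) (A′≈A e j) ⟩
      times (c e) (A e j)    ≈⟨ times≈ (c e) (A e j) ⟩
      c e Defs.* A e j       ∎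

    independent⇒row-independent : ∀ {es} (I : Subset m) → (∀ {e} → e ∈ˢ I → e ∈ es) →
      ℝLinear.Independent A′ es → RowIndependent A I
    independent⇒row-independent {es} I I⊆es ind c supp rel =
      ind c (λ e e∉ → supp e (e∉ ∘ I⊆es)) λ j → begin
        ℝLinear.comb c A′ j                    ≈⟨ comb≈ c j ⟩
        Defs.sum (λ e → c e Defs.* A e j)      ≈⟨ rel j ⟩
        0ℝ                                     ∎

    row-independent⇒independent : ∀ {es} (I : Subset m) → (∀ {e} → e ∈ es → e ∈ˢ I) →
      RowIndependent A I → ℝLinear.Independent A′ es
    row-independent⇒independent {es} I es⊆I ind c supp rel =
      ind c (λ e e∉ → supp e (e∉ ∘ es⊆I)) λ j → begin
        Defs.sum (λ e → c e Defs.* A e j)      ≈⟨ ≈-sym {ℝLinear.comb c A′ j} {Defs.sum (λ e → c e Defs.* A e j)} (comb≈ c j) ⟩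
        ℝLinear.comb c A′ j                    ≈⟨ rel j ⟩
        0ℝ                                     ∎

∈-tabulate : ∀ {m} {f : Fin m → Bool} {e} → f e ≡ true → e ∈ˢ Vec.tabulate f
∈-tabulate {f = f} {e} fe = Vec.lookup⇒[]= e (Vec.tabulate f) (trans (Vec.lookup∘tabulate f e) fe)

tabulate-∈ : ∀ {m} {f : Fin m → Bool} {e} → e ∈ˢ Vec.tabulate f → f e ≡ true
tabulate-∈ {f = f} {e} e∈ = trans (sym (Vec.lookup∘tabulate f e)) (Vec.[]=⇒lookup e∈)

∣tabulate∣ : ∀ {m} (f : Fin m → Bool) → ∣ Vec.tabulate f ∣ ≡ count f
∣tabulate∣ {zero}  f = refl
∣tabulate∣ {suc m} f with f zero
... | true  = cong suc (∣tabulate∣ (f ∘ suc))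
... | false = ∣tabulate∣ (f ∘ suc)

∣∣≡count : ∀ {m} (S : Subset m) → ∣ S ∣ ≡ count (Vec.lookup S)
∣∣≡count []          = refl
∣∣≡count (true ∷ S)  = cong suc (∣∣≡count S)
∣∣≡count (false ∷ S) = ∣∣≡count S

members : ∀ {m} → Subset m → List (Fin m)
members []          = []
members (true ∷ S)  = zero ∷ List.map suc (members S)
members (false ∷ S) = List.map suc (members S)

length-members : ∀ {m} (S : Subset m) → length (members S) ≡ ∣ S ∣
length-members []          = refl
length-members (true ∷ S)  = cong suc (trans (List.length-map suc (members S)) (length-members S))
length-members (false ∷ S) = trans (List.length-map suc (members S)) (length-members S)

members-unique : ∀ {m} (S : Subset m) → Unique (members S)
members-unique []          = []
members-unique (true ∷ S)  = ∉⇒All≢ zero∉ ∷ Unique.map⁺ Fin.suc-injective (members-unique S)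
  where
  zero∉ : zero ∉ List.map suc (members S)
  zero∉ z∈ with List.∈-map⁻ suc z∈
  ... | _ , _ , ()
members-unique (false ∷ S) = Unique.map⁺ Fin.suc-injective (members-unique S)

members⊆ : ∀ {m} (S : Subset m) {e} → e ∈ members S → e ∈ˢ S
members⊆ (true ∷ S) (here refl) = Vec.here
members⊆ (true ∷ S) (there e∈) with List.∈-map⁻ suc e∈
... | f , f∈ , refl = Vec.there (members⊆ S f∈)
members⊆ (false ∷ S) e∈ with List.∈-map⁻ suc e∈
... | f , f∈ , refl = Vec.there (members⊆ S f∈)

member? : ∀ {m} (es : List (Fin m)) e → Dec (e ∈ es)
member? es e = Any.any? (e Fin.≟_) es

count-members : ∀ {m} (es : List (Fin m)) → Unique es → count (λ e → does (member? es e)) ≡ length es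
count-members {m} [] _ = none m
  where
  none : ∀ m → count {m} (λ _ → false) ≡ 0
  none zero    = refl
  none (suc m) = none m
count-members (i ∷ es) u@(_ ∷ u′) = trans (count-∖ {W = W} {i} (dec-true (member? (i ∷ es) i) (here refl)))
  (cong suc (trans (count-cong same) (count-members es u′)))
  where
  W = λ e → does (member? (i ∷ es) e)
  same : ∀ e → (W ∖ i) e ≡ does (member? es e)
  same e = by-cases (i Fin.≟ e) (member? es e)
    where
    by-cases : Dec (i ≡ e) → Dec (e ∈ es) → (W ∖ i) e ≡ does (member? es e)
    by-cases (yes refl) _ = trans (cong (λ b → W i ∧ not b) (dec-true (i Fin.≟ i) refl))
      (trans (Bool.∧-zeroʳ (W i)) (sym (dec-false (member? es i) (∉-head u))))
    by-cases (no i≢e) (yes e∈) = trans (∖-intro {W = W} {i} (dec-true (member? (i ∷ es) e) (there e∈)) i≢e)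
      (sym (dec-true (member? es e) e∈))
    by-cases (no i≢e) (no e∉) = trans (cong (_∧ not (does (i Fin.≟ e))) (dec-false (member? (i ∷ es) e)
      λ { (here e≡i) → i≢e (sym e≡i) ; (there e∈) → e∉ e∈ })) (sym (dec-false (member? es e) e∉))

-- The rank of Kₙ is at most 3n - 6, from `gen-rank` with the first three vertices as the special
-- ones; the 6 stands on the left to avoid truncated subtraction.
rank-limit : ∀ {n} → 3 ℕ.≤ n → ∀ {es} → Generic.Gen n es → length es ℕ.+ 6 ℕ.≤ n ℕ.* 3
rank-limit {suc (suc (suc k))} _ {es} gen = ℕ.≤-trans
  (ℕ.+-monoˡ-≤ 6 (Generic.gen-rank (3 ℕ.+ k) {zero} {suc zero} {suc (suc zero)} rest (λ ()) (λ ()) (λ ()) gen λ _ → vertex _ , vertex _))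
  (ℕ.≤-reflexive (trans (cong (λ l → 3 ℕ.+ l ℕ.* 3 ℕ.+ 6) (List.length-tabulate (λ (i : Fin k) → Fin.suc (Fin.suc (Fin.suc i))))) (ℕ.+-comm (3 ℕ.+ k ℕ.* 3) 6)))
  where
  rest : List (Fin (3 ℕ.+ k))
  rest = List.tabulate λ i → suc (suc (suc i))
  vertex : ∀ v → v ∈ zero ∷ suc zero ∷ suc (suc zero) ∷ rest
  vertex zero                = here refl
  vertex (suc zero)          = there (here refl)
  vertex (suc (suc zero))    = there (there (here refl))
  vertex (suc (suc (suc i))) = there (there (there (List.∈-tabulate⁺ i)))
rank-limit {suc zero} (s≤s ())
rank-limit {suc (suc zero)} (s≤s (s≤s ()))

sum-≥-term : ∀ {m} (f : Fin m → ℚ) e → (∀ i → 0ℚ ≤ f i) → f e ≤ sum f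
sum-≥-term f e f≥0 = ℚ.≤-trans (ℚ.≤-reflexive (sym (sum-δ e f))) (sum-mono (λ i → δ e i * f i) f λ i → term i (e Fin.≟ i))
  where
  term : ∀ i → Dec (e ≡ i) → δ e i * f i ≤ f i
  term i (yes refl) = ℚ.≤-reflexive (trans (cong (_* f i) (δ-same i)) (ℚ.*-identityˡ (f i)))
  term i (no e≢i)   = ℚ.≤-trans (ℚ.≤-reflexive (trans (cong (_* f i) (ℚLinear.δ-diff e≢i)) (ℚ.*-zeroˡ (f i)))) (f≥0 i)

δ≥0 : ∀ {m} (i j : Fin m) → 0ℚ ≤ δ i j
δ≥0 i j = by-cases (i Fin.≟ j)
  where
  by-cases : Dec (i ≡ j) → 0ℚ ≤ δ i j
  by-cases (yes refl) = ℚ.≤-trans (ℚ.nonNegative⁻¹ 1ℚ) (ℚ.≤-reflexive (sym (δ-same i)))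
  by-cases (no i≢j)   = ℚ.≤-reflexive (sym (ℚLinear.δ-diff i≢j))

𝟙≥0 : ∀ b → 0ℚ ≤ 𝟙 b
𝟙≥0 true  = ℚ.nonNegative⁻¹ 1ℚ
𝟙≥0 false = ℚ.≤-refl

sum-δ-1 : ∀ {m} (i : Fin m) → sum (δ i) ≡ 1ℚ
sum-δ-1 i = trans (sum-cong (δ i) (λ e → δ i e * 1ℚ) (λ e → sym (ℚ.*-identityʳ (δ i e)))) (sum-δ i (λ _ → 1ℚ))

-- Degrees in S and the handshake bound

module Handshake {n : ℕ} (S : EdgeSet n) where

  JoinedIn : Fin n → Fin n → Set
  JoinedIn u v = ∃[ e ] (e ∈ˢ S × Joins {n} e u v)

  opaque

    joinedIn? : ∀ u v → Dec (JoinedIn u v)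
    joinedIn? u v = Fin.any? λ e → (e Subset.∈? S) ×-dec joins? e u v

  adjS : Fin n → Fin n → Bool
  adjS u v = does (joinedIn? u v)

  adjS⇒joined : ∀ {u v} → adjS u v ≡ true → JoinedIn u v
  adjS⇒joined {u} {v} = from-does (joinedIn? u v)

  joined⇒adjS : ∀ {u v} → JoinedIn u v → adjS u v ≡ true
  joined⇒adjS {u} {v} = dec-true (joinedIn? u v)

  adjS-sym : ∀ {u v} → adjS u v ≡ true → adjS v u ≡ true
  adjS-sym uv = flip (adjS⇒joined uv)
    where
    flip : ∀ {u v} → JoinedIn u v → adjS v u ≡ true
    flip (e , e∈ , je) = joined⇒adjS (e , e∈ , joins-sym je)

  adjS-irrefl : ∀ {u v} → adjS u v ≡ true → u ≢ v
  adjS-irrefl uv = joins⇒≢ (proj₂ (proj₂ (adjS⇒joined uv)))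

  private
    i j : Fin (∣EK∣ n) → Fin n
    i e = proj₁ (ends n e)
    j e = proj₂ (ends n e)

    -- The indicator of an edge of S joining `v` and `u`, one product of deltas per orientation, so
    -- that the sums over `u` and then over `v` collapse.
    incidence : Fin n → Fin n → Fin (∣EK∣ n) → ℚ
    incidence v u e = 𝟙 (Vec.lookup S e) * (δ (i e) v * δ (j e) u + δ (i e) u * δ (j e) v)

    incidence≥0 : ∀ v u e → 0ℚ ≤ incidence v u e
    incidence≥0 v u e = *≥0 (𝟙≥0 (Vec.lookup S e)) (ℚ.+-mono-≤ (*≥0 (δ≥0 (i e) v) (δ≥0 (j e) u)) (*≥0 (δ≥0 (i e) u) (δ≥0 (j e) v)))
      where
      *≥0 : ∀ {p q} → 0ℚ ≤ p → 0ℚ ≤ q → 0ℚ ≤ p * q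
      *≥0 {p} {q} 0≤p 0≤q = subst (_≤ p * q) (ℚ.*-zeroʳ p) (ℚ.*-monoˡ-≤-nonNeg p {{ℚ.nonNegative 0≤p}} 0≤q)

    joined-incidence : ∀ {v u e} → e ∈ˢ S → Joins e v u → 1ℚ ≤ incidence v u e
    joined-incidence {v} {u} {e} e∈ je = ℚ.≤-trans (ℚ.≤-trans (by-orientation je) (ℚ.≤-reflexive (sym (ℚ.*-identityˡ _))))
        (ℚ.≤-reflexive (cong (λ b → 𝟙 b * (δ (i e) v * δ (j e) u + δ (i e) u * δ (j e) v)) (sym (Vec.[]=⇒lookup e∈))))
      where
      one : ∀ {a b c d : Fin n} → a ≡ b → c ≡ d → δ a b * δ c d ≡ 1ℚ
      one {a} {c = c} refl refl = cong₂ _*_ (δ-same a) (δ-same c)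
      ≥0 : ∀ a b c d → 0ℚ ≤ δ {n} a b * δ {n} c d
      ≥0 a b c d = subst (_≤ δ a b * δ c d) (ℚ.*-zeroʳ (δ a b)) (ℚ.*-monoˡ-≤-nonNeg (δ a b) {{ℚ.nonNegative (δ≥0 a b)}} (δ≥0 c d))
      by-orientation : Joins e v u → 1ℚ ≤ δ (i e) v * δ (j e) u + δ (i e) u * δ (j e) v
      by-orientation (forward p) = ℚ.+-mono-≤ {1ℚ} {δ (i e) v * δ (j e) u} {0ℚ} {δ (i e) u * δ (j e) v}
        (ℚ.≤-reflexive (sym (one (cong proj₁ p) (cong proj₂ p)))) (≥0 (i e) u (j e) v)
      by-orientation (backward p) = ℚ.+-mono-≤ {0ℚ} {δ (i e) v * δ (j e) u} {1ℚ} {δ (i e) u * δ (j e) v}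
        (≥0 (i e) v (j e) u) (ℚ.≤-reflexive (sym (one (cong proj₁ p) (cong proj₂ p))))

    degree : ∀ v → ι (count (adjS v)) ≤ sum (λ e → 𝟙 (Vec.lookup S e) * (δ (i e) v + δ (j e) v))
    degree v = ℚ.≤-trans (ℚ.≤-reflexive (sym (ι-count (adjS v))))
      (ℚ.≤-trans (sum-mono (λ u → 𝟙 (adjS v u)) (λ u → sum (incidence v u)) (λ u → term u (adjS v u) refl))
      (ℚ.≤-reflexive (trans (∑-comm (incidence v)) (sum-cong (λ e → sum (λ u → incidence v u e)) (λ e → 𝟙 (Vec.lookup S e) * (δ (i e) v + δ (j e) v)) λ e →
        trans (sym (*-sum (𝟙 (Vec.lookup S e)) (λ u → δ (i e) v * δ (j e) u + δ (i e) u * δ (j e) v)))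
          (cong (𝟙 (Vec.lookup S e) *_) (trans (∑-distrib-+ (λ u → δ (i e) v * δ (j e) u) (λ u → δ (i e) u * δ (j e) v))
            (cong₂ _+_ (trans (sym (*-sum (δ (i e) v) (δ (j e)))) (trans (cong (δ (i e) v *_) (sum-δ-1 (j e))) (ℚ.*-identityʳ (δ (i e) v))))
              (sum-δ (i e) (λ _ → δ (j e) v)))))))))
      where
      term : ∀ u b → adjS v u ≡ b → 𝟙 b ≤ sum (incidence v u)
      term u false _ = ℚ.≤-trans (ℚ.≤-reflexive (sym (sum-zero {f = λ (_ : Fin (∣EK∣ n)) → 0ℚ} λ _ → refl)))
        (sum-mono (λ _ → 0ℚ) (incidence v u) (incidence≥0 v u))
      term u true vu = go (adjS⇒joined vu)
        where
        go : JoinedIn v u → 1ℚ ≤ sum (incidence v u)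
        go (e , e∈ , je) = ℚ.≤-trans (joined-incidence e∈ je) (sum-≥-term (incidence v u) e (incidence≥0 v u))

  handshake : sum (λ v → ι (count (adjS v))) ≤ ι ∣ S ∣ * (1ℚ + 1ℚ)
  handshake = ℚ.≤-trans (sum-mono (λ v → ι (count (adjS v))) (λ v → sum (λ e → 𝟙 (Vec.lookup S e) * (δ (i e) v + δ (j e) v))) degree)
    (ℚ.≤-reflexive (trans (∑-comm (λ v e → 𝟙 (Vec.lookup S e) * (δ (i e) v + δ (j e) v)))
      (trans (sum-cong (λ e → sum (λ v → 𝟙 (Vec.lookup S e) * (δ (i e) v + δ (j e) v))) (λ e → 𝟙 (Vec.lookup S e) * (1ℚ + 1ℚ)) λ e →
        trans (sym (*-sum (𝟙 (Vec.lookup S e)) (λ v → δ (i e) v + δ (j e) v)))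
          (cong (𝟙 (Vec.lookup S e) *_) (trans (∑-distrib-+ (δ (i e)) (δ (j e))) (cong₂ _+_ (sum-δ-1 (i e)) (sum-δ-1 (j e))))))
      (trans (sym (ℚLinear.sum-* (λ e → 𝟙 (Vec.lookup S e)) (1ℚ + 1ℚ)))
        (cong (_* (1ℚ + 1ℚ)) (trans (ι-count (Vec.lookup S)) (cong ι (sym (∣∣≡count S)))))))))

-- The rank of every edge set that contains F minus S

module Rigid {n : ℕ} (p : Points n) (generic : GenericPoints p) (F : EdgeSet n) (connected : Connected[ 12 ] n F)
  (S : EdgeSet n) (S≤6 : ∣ S ∣ ℕ.≤ 6) where

  remaining? : ∀ e → Dec (e ∈ˢ F ─ S)
  remaining? e = e Subset.∈? (F ─ S)

  open Handshake {n} S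
  open Closure {n} remaining? using (basis; basis-gen; basis⊆X; X⊆closure; closure-rank; rigidity; adj?)
  open Generic n using (Gen; columns-searchable)
  open PolyLinear (n ℕ.+ n) using (Certificate; Relation; dichotomy; independent⇒certificate; certificate⇒independent)
  open Graph rigidity adjS adjS-sym adjS-irrefl using (TwelveConnected; Step; adjG; RankAtLeast; rank-at-least)

  everything : VertexSet n
  everything _ = true

  count-everything : ∀ n → count {n} (λ _ → true) ≡ n
  count-everything zero    = refl
  count-everything (suc n) = cong suc (count-everything n)

  adjacent⇒adjG : ∀ {u v} → Adjacent n F u v → adjG u v ≡ true
  adjacent⇒adjG {u} {v} (e , e∈F , ends≡) = by-cases (e Subset.∈? S)
    where
    joins : Joins e u v
    joins = [ forward , backward ]′ ends≡
    by-cases : Dec (e ∈ˢ S) → adjG u v ≡ true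
    by-cases (yes e∈S) = trans (cong (does (adj? u v) ∨_) (joined⇒adjS (e , e∈S , joins))) (Bool.∨-zeroʳ (does (adj? u v)))
    by-cases (no e∉S)  = cong (_∨ adjS u v) (dec-true (adj? u v) (e , joins , X⊆closure (Subset.x∈p∧x∉q⇒x∈p─q e∈F e∉S)))

  twelve-connected : TwelveConnected everything
  twelve-connected X lt {u} {v} _ _ Xu Xv = convert (proj₂ connected (Vec.tabulate X) (subst (ℕ._< 12) (sym (∣tabulate∣ X)) lt) u v (outside Xu) (outside Xv))
    where
    absurd : true ≢ false
    absurd ()
    outside : ∀ {w} → X w ≡ false → w ∉ˢ Vec.tabulate X
    outside Xw w∈ = absurd (trans (sym (tabulate-∈ w∈)) Xw)
    inside : ∀ {w} → w ∉ˢ Vec.tabulate X → X w ≡ false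
    inside w∉ = Bool.¬-not (w∉ ∘ ∈-tabulate)
    convert : ∀ {u v} → Star (λ a b → a ∉ˢ Vec.tabulate X × b ∉ˢ Vec.tabulate X × Adjacent n F a b) u v → Star (Step everything X) u v
    convert ε = ε
    convert ((a∉ , b∉ , ab) ◅ path) = ((refl , inside a∉) , (refl , inside b∉) , adjacent⇒adjG ab) ◅ convert path

  -- The independent edges produced lie in the closure of F minus S, so they are at most as many as
  -- its basis.
  3n≤basis+6 : n ℕ.* 3 ℕ.≤ length basis ℕ.+ 6
  3n≤basis+6 = bound (rank-at-least twelve-bound (n ℕ.∸ 13) everything
      (trans (count-everything n) (sym (ℕ.m+[n∸m]≡n (proj₁ connected)))) twelve-connected)
    where
    twelve-bound : sum (λ v → ι (count (adjS v))) ≤ 6ℚ + 6ℚ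
    twelve-bound = ℚ.≤-trans handshake (ℚ.*-monoʳ-≤-nonNeg (1ℚ + 1ℚ) (ι-mono S≤6))
    bound : RankAtLeast everything → n ℕ.* 3 ℕ.≤ length basis ℕ.+ 6
    bound (r , (J , closed , _ , gen , size) , le) = ℕ.≤-trans (ℕ.≤-trans (ℕ.≤-reflexive (cong (ℕ._* 3) (sym (count-everything n)))) le)
      (ℕ.+-monoˡ-≤ 6 (subst (ℕ._≤ length basis) size (closure-rank closed gen)))

  basisSet : EdgeSet n
  basisSet = Vec.tabulate (λ e → does (member? basis e))

  ∣basisSet∣ : ∣ basisSet ∣ ≡ length basis
  ∣basisSet∣ = trans (∣tabulate∣ (λ e → does (member? basis e))) (count-members basis (proj₁ basis-gen))

  basisSet⊆basis : ∀ {e} → e ∈ˢ basisSet → e ∈ basis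
  basisSet⊆basis {e} e∈ = from-does (member? basis e) (tabulate-∈ e∈)

  symbolic : PolyLinear.Matrix (n ℕ.+ n) (∣EK∣ n) (Fin n × Fin 3)
  symbolic = symbolicMatrix {n}

  basisSet-independent : CofactorIndependent p basisSet
  basisSet-independent = ℝBridge.independent⇒row-independent (cofactorMatrix p) (Specialise.at ℝ-evaluation (coordinates p) symbolic) (cofactorMatrix≈ p)
    basisSet basisSet⊆basis
    (certificate⇒independentℝ (coordinates p) generic (independent⇒certificate columns-searchable (proj₁ basis-gen) (proj₂ basis-gen)))

  -- Elimination over the polynomials settles `I`. A relation would contradict its real
  -- independence; a certificate makes it generically independent, so it has at most 3n - 6 edges,
  -- which the basis already reaches.
  independent-bound : ∀ I → CofactorIndependent p I → ∣ I ∣ ℕ.≤ length basis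
  independent-bound I ind = by-cases (dichotomy columns-searchable symbolic (members I) (members-unique I))
    where
    3≤n : 3 ℕ.≤ n
    3≤n = ℕ.≤-trans (ℕ.m≤m+n 3 10) (proj₁ connected)
    by-cases : Certificate symbolic (members I) ⊎ Relation symbolic (members I) → ∣ I ∣ ℕ.≤ length basis
    by-cases (inj₁ cert) = subst (ℕ._≤ length basis) (length-members I)
      (ℕ.+-cancelʳ-≤ 6 (length (members I)) (length basis) (ℕ.≤-trans
        (rank-limit 3≤n (members-unique I , certificate⇒independent cert)) 3n≤basis+6))
    by-cases (inj₂ rel) = ⊥-elim (relation⇒dependentℝ (coordinates p) generic rel
      (ℝBridge.row-independent⇒independent (cofactorMatrix p) (Specialise.at ℝ-evaluation (coordinates p) symbolic) (cofactorMatrix≈ p)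
        I (members⊆ I) ind))

  -- The basis of F minus S is a largest independent set of all of Kₙ, so enlarging F minus S cannot
  -- raise the rank; spanning compares it with one added edge.
  has-rank : ∀ X → F ─ S ⊆ X → HasRank (CofactorIndependent p) X (length basis)
  has-rank X ⊆X = (basisSet , (λ e∈ → ⊆X (basis⊆X (basisSet⊆basis e∈))) , basisSet-independent , ∣basisSet∣)
    , λ I _ → independent-bound I

open import Defs

theorem7p2 : (n : ℕ) (p : Points n) → Generic p →
    (F : EdgeSet n) → Connected[ 12 ] n F →
    (S : EdgeSet n) → S ⊆ F → ∣ S ∣ ℕ.≤ 6 →
    Spans (CofactorIndependent p) (F ─ S)
theorem7p2 n p generic F connected S _ S≤6 e =
  _ , has-rank (F ─ S) (λ x → x) , has-rank ((F ─ S) ∪ ⁅ e ⁆) (Subset.p⊆p∪q ⁅ e ⁆)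
  where open Rigid {n} p generic F connected S S≤6 using (has-rank)
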